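{- Suppose $b$ and $d$ are integers satisfying $-2d<b<2d$. Let $q=e^{\pi i\tau}$ with $\operatorname{Im}\tau>0$, and let $x,y$ be nonzero complex numbers. Then \begin{align*} &\left(\sum_{m,n\in\mathbf Z}(-1)^{n-m}q^{d(m+1/2)^2+b(m+1/2)(n+1/2)+d(n+1/2)^2}x^{m+1/2}y^{n+1/2}\right)^2+\left(\sum_{m,n\in\mathbf Z}q^{dm^2+bmn+dn^2}x^my^n\right)^2\\ &=\left(\sum_{m,n\in\mathbf Z}(-1)^{n-m}q^{dm^2+bmn+dn^2}x^my^n\right)^2+\left(\sum_{m,n\in\mathbf Z}q^{d(m+1/2)^2+b(m+1/2)(n+1/2)+d(n+1/2)^2}x^{m+1/2}y^{n+1/2}\right)^2. \end{align*}
   Context: Real powers of $q$ are $q^r=e^{\pi i r\tau}$. Square roots $x^{1/2}$ and $y^{1/2}$ are fixed once and for all, and $x^{m+1/2}=x^m x^{1/2}$, $y^{n+1/2}=y^n y^{1/2}$ for integers $m,n$. -}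

module Defs where

open import Data.Empty using (⊥-elim)
open import Data.Integer.Base as ℤ using (ℤ; +_; -[1+_])
import Data.Integer.Properties as ℤ
open import Data.List.Base using (List; []; _∷_; foldr; upTo)
import Data.List.Membership.DecPropositional as DecMembership
open import Data.List.Membership.Propositional using (_∈_)
open import Data.List.Membership.Propositional.Properties using (∈-upTo⁺)
open import Data.List.Relation.Binary.Subset.Propositional using (_⊆_)
import Data.List.Relation.Unary.All as All
open import Data.List.Relation.Unary.AllPairs using ([]; _∷_)
open import Data.List.Relation.Unary.Any using (here; there)
open import Data.List.Relation.Unary.Unique.Propositional using (Unique)
open import Data.Nat.Base as ℕ using (ℕ; zero; suc; _!)
import Data.Nat.Properties as ℕ
open import Data.Product.Base using (∃; _×_; _,_; proj₁; proj₂)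
open import Data.Rational.Base
open import Data.Rational.Properties
import Data.Rational.Unnormalised.Base as ℚᵘ
import Data.Rational.Unnormalised.Properties as ℚᵘ
open import Data.Sum.Base using (inj₁; inj₂)
open import Level using (0ℓ)
open import Relation.Binary.PropositionalEquality using (_≡_; _≢_; refl; sym; trans; cong; cong₂; subst; subst₂; module ≡-Reasoning)
open import Relation.Nullary.Decidable using (yes; no; dec⇒maybe)
open import Tactic.RingSolver using (solve-∀)
open import Tactic.RingSolver.Core.AlmostCommutativeRing using (AlmostCommutativeRing; fromCommutativeRing)

ring : AlmostCommutativeRing 0ℓ 0ℓ
ring = fromCommutativeRing +-*-commutativeRing (λ p → dec⇒maybe (0ℚ ≟ p))

0<½ : 0ℚ < ½
0<½ = positive⁻¹ ½

*-pos : ∀ {p q} → 0ℚ < p → 0ℚ < q → 0ℚ < p * q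
*-pos {p} {q} 0<p 0<q = positive⁻¹ (p * q) {{pos*pos⇒pos p {{positive 0<p}} q {{positive 0<q}}}}

half-pos : ∀ {ε} → 0ℚ < ε → 0ℚ < ε * ½
half-pos 0<ε = *-pos 0<ε 0<½

halves : ∀ ε → ε * ½ + ε * ½ ≡ ε
halves = solve-∀ ring

*-mono-≤ : ∀ {p q r s} → 0ℚ ≤ p → 0ℚ ≤ s → p ≤ q → r ≤ s → p * r ≤ q * s
*-mono-≤ {p} {q} {r} {s} 0≤p 0≤s p≤q r≤s = ≤-trans
  (*-monoˡ-≤-nonNeg p {{nonNegative 0≤p}} r≤s)
  (*-monoʳ-≤-nonNeg s {{nonNegative 0≤s}} p≤q)

*-nonneg : ∀ {p q} → 0ℚ ≤ p → 0ℚ ≤ q → 0ℚ ≤ p * q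
*-nonneg {p} {q} 0≤p 0≤q = subst (_≤ p * q) (*-zeroʳ p) (*-monoˡ-≤-nonNeg p {{nonNegative 0≤p}} 0≤q)

+-nonneg : ∀ {p q} → 0ℚ ≤ p → 0ℚ ≤ q → 0ℚ ≤ p + q
+-nonneg 0≤p 0≤q = +-mono-≤ 0≤p 0≤q

≤-+ʳ : ∀ {p q} → 0ℚ ≤ q → p ≤ p + q
≤-+ʳ {p} {q} 0≤q = subst (_≤ p + q) (+-identityʳ p) (+-monoʳ-≤ p 0≤q)

∣-∣-swap : ∀ p q → ∣ p - q ∣ ≡ ∣ q - p ∣
∣-∣-swap p q = trans (sym (∣-p∣≡∣p∣ (p - q))) (cong ∣_∣ (lemma p q))
  where
  lemma : ∀ p q → - (p - q) ≡ q - p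
  lemma = solve-∀ ring

∣-∣-triangle : ∀ p q r → ∣ p - r ∣ ≤ ∣ p - q ∣ + ∣ q - r ∣
∣-∣-triangle p q r = subst (λ z → ∣ z ∣ ≤ ∣ p - q ∣ + ∣ q - r ∣) (lemma p q r) (∣p+q∣≤∣p∣+∣q∣ (p - q) (q - r))
  where
  lemma : ∀ p q r → (p - q) + (q - r) ≡ p - r
  lemma = solve-∀ ring

p≤∣p∣ : ∀ p → p ≤ ∣ p ∣
p≤∣p∣ p with ≤-total 0ℚ p
... | inj₁ 0≤p = ≤-reflexive (sym (0≤p⇒∣p∣≡p 0≤p))
... | inj₂ p≤0 = ≤-trans p≤0 (0≤∣p∣ p)

-- A real is a Cauchy sequence of rationals (the Σ-type makes the modulus of
-- convergence part of the data); equality of reals is _≈ℝ_.  The Cauchy proofs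
-- of the operations are abstract so that they never get unfolded.

IsCauchy : (ℕ → ℚ) → Set
IsCauchy x = ∀ ε → 0ℚ < ε → ∃ λ N → ∀ m n → N ℕ.≤ m → N ℕ.≤ n → ∣ x m - x n ∣ ≤ ε

record ℝ : Set where
  constructor mkℝ
  field
    seq    : ℕ → ℚ
    cauchy : IsCauchy seq

open ℝ public

Eventually : (ℕ → Set) → Set
Eventually P = ∃ λ N → ∀ n → N ℕ.≤ n → P n

infix 4 _≈ℝ_ _<ℝ_

_≈ℝ_ : ℝ → ℝ → Set
x ≈ℝ y = ∀ ε → 0ℚ < ε → Eventually λ n → ∣ seq x n - seq y n ∣ ≤ ε

_<ℝ_ : ℝ → ℝ → Set
x <ℝ y = ∃ λ δ → 0ℚ < δ × Eventually λ n → seq x n + δ ≤ seq y n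

abstract

  const-cauchy : ∀ p → IsCauchy (λ _ → p)
  const-cauchy p ε 0<ε = 0 , λ _ _ _ _ → subst (_≤ ε) (sym (cong ∣_∣ (+-inverseʳ p))) (<⇒≤ 0<ε)

  +-cauchy : ∀ x y → IsCauchy (λ n → seq x n + seq y n)
  +-cauchy (mkℝ x xc) (mkℝ y yc) ε 0<ε =
    let M , xM = xc (ε * ½) (half-pos 0<ε)
        N , yN = yc (ε * ½) (half-pos 0<ε)
    in M ℕ.⊔ N , λ m n m≥ n≥ → begin
      ∣ (x m + y m) - (x n + y n) ∣   ≡⟨ cong ∣_∣ (lemma (x m) (y m) (x n) (y n)) ⟩
      ∣ (x m - x n) + (y m - y n) ∣   ≤⟨ ∣p+q∣≤∣p∣+∣q∣ (x m - x n) (y m - y n) ⟩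
      ∣ x m - x n ∣ + ∣ y m - y n ∣   ≤⟨ +-mono-≤ (xM m n (ℕ.m⊔n≤o⇒m≤o M N m≥) (ℕ.m⊔n≤o⇒m≤o M N n≥))
                                                  (yN m n (ℕ.m⊔n≤o⇒n≤o M N m≥) (ℕ.m⊔n≤o⇒n≤o M N n≥)) ⟩
      ε * ½ + ε * ½                   ≡⟨ halves ε ⟩
      ε                               ∎
    where
    open ≤-Reasoning
    lemma : ∀ a b c d → (a + b) - (c + d) ≡ (a - c) + (b - d)
    lemma = solve-∀ ring

  neg-cauchy : ∀ x → IsCauchy (λ n → - seq x n)
  neg-cauchy (mkℝ x xc) ε 0<ε =
    let M , xM = xc ε 0<ε
    in M , λ m n m≥ n≥ → subst (_≤ ε) (trans (∣-∣-swap (x m) (x n)) (cong ∣_∣ (lemma (x m) (x n)))) (xM m n m≥ n≥)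
    where
    lemma : ∀ p q → q - p ≡ - p - - q
    lemma = solve-∀ ring

ℚ⇒ℝ : ℚ → ℝ
ℚ⇒ℝ p = mkℝ (λ _ → p) (const-cauchy p)

0ℝ 1ℝ : ℝ
0ℝ = ℚ⇒ℝ 0ℚ
1ℝ = ℚ⇒ℝ 1ℚ

infixl 6 _+ℝ_
infixl 7 _*ℝ_
infix  8 -ℝ_

_+ℝ_ : ℝ → ℝ → ℝ
x +ℝ y = mkℝ (λ n → seq x n + seq y n) (+-cauchy x y)

-ℝ_ : ℝ → ℝ
-ℝ x = mkℝ (λ n → - seq x n) (neg-cauchy x)

bounded : (x : ℝ) → ∃ λ B → 0ℚ < B × Eventually λ n → ∣ seq x n ∣ ≤ B
bounded (mkℝ x xc) =
  let N , xN = xc 1ℚ (positive⁻¹ 1ℚ)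
  in ∣ x N ∣ + 1ℚ , +-mono-≤-< (0≤∣p∣ (x N)) (positive⁻¹ 1ℚ) , N , λ n n≥ → begin
    ∣ x n ∣                   ≡⟨ cong ∣_∣ (lemma (x n) (x N)) ⟩
    ∣ x N + (x n - x N) ∣     ≤⟨ ∣p+q∣≤∣p∣+∣q∣ (x N) (x n - x N) ⟩
    ∣ x N ∣ + ∣ x n - x N ∣   ≤⟨ +-monoʳ-≤ ∣ x N ∣ (xN n N n≥ ℕ.≤-refl) ⟩
    ∣ x N ∣ + 1ℚ              ∎
  where
  open ≤-Reasoning
  lemma : ∀ p q → p ≡ q + (p - q)
  lemma = solve-∀ ring

infixl 7 _over_
_over_ : ∀ ε {C} → 0ℚ < C → ℚ
_over_ ε {C} 0<C = ε * (1/ C) {{pos⇒nonZero C {{positive 0<C}}}}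

over-pos : ∀ {ε C} → 0ℚ < ε → (0<C : 0ℚ < C) → 0ℚ < ε over 0<C
over-pos {ε} {C} 0<ε 0<C = *-pos 0<ε (positive⁻¹ _ {{1/pos⇒pos C {{positive 0<C}}}})

over-* : ∀ ε {C} (0<C : 0ℚ < C) → C * (ε over 0<C) ≡ ε
over-* ε {C} 0<C = begin
  C * (ε * 1/C)   ≡⟨ lemma C ε 1/C ⟩
  ε * (C * 1/C)   ≡⟨ cong (ε *_) (*-inverseʳ C {{pos⇒nonZero C {{positive 0<C}}}}) ⟩
  ε * 1ℚ          ≡⟨ *-identityʳ ε ⟩
  ε               ∎
  where
  open ≡-Reasoning
  1/C : ℚ
  1/C = (1/ C) {{pos⇒nonZero C {{positive 0<C}}}}
  lemma : ∀ a b c → a * (b * c) ≡ b * (a * c)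
  lemma = solve-∀ ring

abstract

  *-cauchy : ∀ x y → IsCauchy (λ n → seq x n * seq y n)
  *-cauchy X@(mkℝ x xc) Y@(mkℝ y yc) ε 0<ε =
    let A , 0<A , K , xK = bounded X
        B , 0<B , L , yL = bounded Y
        0<B+A = +-mono-< 0<B 0<A
        η = ε over 0<B+A
        0<η = over-pos 0<ε 0<B+A
        M , xM = xc η 0<η
        N , yN = yc η 0<η
        P = (K ℕ.⊔ L) ℕ.⊔ (M ℕ.⊔ N)
        ≥K : ∀ {n} → P ℕ.≤ n → K ℕ.≤ n
        ≥K n≥ = ℕ.m⊔n≤o⇒m≤o K L (ℕ.m⊔n≤o⇒m≤o (K ℕ.⊔ L) (M ℕ.⊔ N) n≥)
        ≥L : ∀ {n} → P ℕ.≤ n → L ℕ.≤ n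
        ≥L n≥ = ℕ.m⊔n≤o⇒n≤o K L (ℕ.m⊔n≤o⇒m≤o (K ℕ.⊔ L) (M ℕ.⊔ N) n≥)
        ≥M : ∀ {n} → P ℕ.≤ n → M ℕ.≤ n
        ≥M n≥ = ℕ.m⊔n≤o⇒m≤o M N (ℕ.m⊔n≤o⇒n≤o (K ℕ.⊔ L) (M ℕ.⊔ N) n≥)
        ≥N : ∀ {n} → P ℕ.≤ n → N ℕ.≤ n
        ≥N n≥ = ℕ.m⊔n≤o⇒n≤o M N (ℕ.m⊔n≤o⇒n≤o (K ℕ.⊔ L) (M ℕ.⊔ N) n≥)
    in P , λ m n m≥ n≥ → begin
      ∣ x m * y m - x n * y n ∣
        ≡⟨ cong ∣_∣ (lemma (x m) (y m) (x n) (y n)) ⟩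
      ∣ y m * (x m - x n) + x n * (y m - y n) ∣
        ≤⟨ ∣p+q∣≤∣p∣+∣q∣ (y m * (x m - x n)) (x n * (y m - y n)) ⟩
      ∣ y m * (x m - x n) ∣ + ∣ x n * (y m - y n) ∣
        ≡⟨ cong₂ _+_ (∣p*q∣≡∣p∣*∣q∣ (y m) (x m - x n)) (∣p*q∣≡∣p∣*∣q∣ (x n) (y m - y n)) ⟩
      ∣ y m ∣ * ∣ x m - x n ∣ + ∣ x n ∣ * ∣ y m - y n ∣
        ≤⟨ +-mono-≤ (*-mono-≤ (0≤∣p∣ (y m)) (<⇒≤ 0<η) (yL m (≥L m≥)) (xM m n (≥M m≥) (≥M n≥)))
                    (*-mono-≤ (0≤∣p∣ (x n)) (<⇒≤ 0<η) (xK n (≥K n≥)) (yN m n (≥N m≥) (≥N n≥))) ⟩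
      B * η + A * η
        ≡⟨ *-distribʳ-+ η B A ⟨
      (B + A) * η
        ≡⟨ over-* ε 0<B+A ⟩
      ε ∎
    where
    open ≤-Reasoning
    lemma : ∀ a b c d → a * b - c * d ≡ b * (a - c) + c * (b - d)
    lemma = solve-∀ ring

_*ℝ_ : ℝ → ℝ → ℝ
x *ℝ y = mkℝ (λ n → seq x n * seq y n) (*-cauchy x y)

-- Reciprocal of a positive real; the value 0 at indices where the
-- approximation vanishes affects only finitely many terms.

recip : ℚ → ℚ
recip p with p ≟ 0ℚ
... | yes _  = 0ℚ
... | no p≢0 = (1/ p) {{≢-nonZero p≢0}}

recip-inverse : ∀ {p} → 0ℚ < p → p * recip p ≡ 1ℚ
recip-inverse {p} 0<p with p ≟ 0ℚ
... | yes refl = ⊥-elim (<-irrefl refl 0<p)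
... | no p≢0  = *-inverseʳ p {{≢-nonZero p≢0}}

recip-nonneg : ∀ {p} → 0ℚ < p → 0ℚ ≤ recip p
recip-nonneg {p} 0<p with 0ℚ ≤? recip p
... | yes 0≤r = 0≤r
... | no  0≰r = ⊥-elim (<-asym (positive⁻¹ 1ℚ) (subst₂ _<_ (recip-inverse 0<p) (*-zeroʳ p)
        (*-monoʳ-<-pos p {{positive 0<p}} (≰⇒> 0≰r))))

recip-≤ : ∀ {δ p} (0<δ : 0ℚ < δ) → δ ≤ p → recip p ≤ 1ℚ over 0<δ
recip-≤ {δ} {p} 0<δ δ≤p = *-cancelˡ-≤-pos δ {{positive 0<δ}} (begin
  δ * recip p         ≤⟨ *-monoʳ-≤-nonNeg (recip p) {{nonNegative (recip-nonneg 0<p)}} δ≤p ⟩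
  p * recip p         ≡⟨ recip-inverse 0<p ⟩
  1ℚ                  ≡⟨ over-* 1ℚ 0<δ ⟨
  δ * (1ℚ over 0<δ)   ∎)
  where
  open ≤-Reasoning
  0<p : 0ℚ < p
  0<p = <-≤-trans 0<δ δ≤p

abstract

  recip-cauchy : ∀ x → 0ℝ <ℝ x → IsCauchy (λ n → recip (seq x n))
  recip-cauchy (mkℝ x xc) (δ , 0<δ , K , xK) ε 0<ε =
    let η = δ * δ * ε
        M , xM = xc η (*-pos (*-pos 0<δ 0<δ) 0<ε)
        ≥δ : ∀ {n} → K ℕ.≤ n → δ ≤ x n
        ≥δ {n} n≥ = subst (_≤ x n) (+-identityˡ δ) (xK n n≥)
    in K ℕ.⊔ M , λ m n m≥ n≥ →
      let xm≥δ = ≥δ (ℕ.m⊔n≤o⇒m≤o K M m≥)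
          xn≥δ = ≥δ (ℕ.m⊔n≤o⇒m≤o K M n≥)
          0<xm = <-≤-trans 0<δ xm≥δ
          0<xn = <-≤-trans 0<δ xn≥δ
          r = recip (x m)
          s = recip (x n)
          Δ = 1ℚ over 0<δ
          0≤Δ = <⇒≤ (over-pos (positive⁻¹ 1ℚ) 0<δ)
      in begin
        ∣ r - s ∣
          ≡⟨ cong ∣_∣ (difference (x m) (x n) r s (recip-inverse 0<xm) (recip-inverse 0<xn)) ⟩
        ∣ (r * s) * (x n - x m) ∣
          ≡⟨ ∣p*q∣≡∣p∣*∣q∣ (r * s) (x n - x m) ⟩
        ∣ r * s ∣ * ∣ x n - x m ∣
          ≡⟨ cong (_* ∣ x n - x m ∣) (0≤p⇒∣p∣≡p (*-nonneg (recip-nonneg 0<xm) (recip-nonneg 0<xn))) ⟩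
        (r * s) * ∣ x n - x m ∣
          ≤⟨ *-mono-≤ (*-nonneg (recip-nonneg 0<xm) (recip-nonneg 0<xn)) (<⇒≤ (*-pos (*-pos 0<δ 0<δ) 0<ε))
               (*-mono-≤ (recip-nonneg 0<xm) 0≤Δ (recip-≤ 0<δ xm≥δ) (recip-≤ 0<δ xn≥δ))
               (xM n m (ℕ.m⊔n≤o⇒n≤o K M n≥) (ℕ.m⊔n≤o⇒n≤o K M m≥)) ⟩
        (Δ * Δ) * (δ * δ * ε)
          ≡⟨ regroup Δ δ ε ⟩
        (δ * Δ) * ((δ * Δ) * ε)
          ≡⟨ cong₂ (λ a b → a * (b * ε)) (over-* 1ℚ 0<δ) (over-* 1ℚ 0<δ) ⟩
        1ℚ * (1ℚ * ε)
          ≡⟨ trans (*-identityˡ (1ℚ * ε)) (*-identityˡ ε) ⟩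
        ε ∎
    where
    open ≤-Reasoning
    expand : ∀ a b r s → (r * s) * (b - a) ≡ r * (b * s) - (a * r) * s
    expand = solve-∀ ring
    regroup : ∀ a b e → (a * a) * (b * b * e) ≡ (b * a) * ((b * a) * e)
    regroup = solve-∀ ring
    difference : ∀ a b r s → a * r ≡ 1ℚ → b * s ≡ 1ℚ → r - s ≡ (r * s) * (b - a)
    difference a b r s ar bs = sym (trans (expand a b r s)
      (trans (cong₂ (λ u v → r * u - v * s) bs ar) (cong₂ _-_ (*-identityʳ r) (*-identityˡ s))))

invℝ : (x : ℝ) → 0ℝ <ℝ x → ℝ
invℝ x 0<x = mkℝ (λ n → recip (seq x n)) (recip-cauchy x 0<x)

fromℚᵘ-* : ∀ p q → fromℚᵘ p * fromℚᵘ q ≡ fromℚᵘ (p ℚᵘ.* q)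
fromℚᵘ-* p q = toℚᵘ-injective (ℚᵘ.≃-trans (toℚᵘ-homo-* (fromℚᵘ p) (fromℚᵘ q))
  (ℚᵘ.≃-trans (ℚᵘ.*-cong (toℚᵘ-fromℚᵘ p) (toℚᵘ-fromℚᵘ q)) (ℚᵘ.≃-sym (toℚᵘ-fromℚᵘ (p ℚᵘ.* q)))))

fromℚᵘ-+ : ∀ p q → fromℚᵘ p + fromℚᵘ q ≡ fromℚᵘ (p ℚᵘ.+ q)
fromℚᵘ-+ p q = toℚᵘ-injective (ℚᵘ.≃-trans (toℚᵘ-homo-+ (fromℚᵘ p) (fromℚᵘ q))
  (ℚᵘ.≃-trans (ℚᵘ.+-cong (toℚᵘ-fromℚᵘ p) (toℚᵘ-fromℚᵘ q)) (ℚᵘ.≃-sym (toℚᵘ-fromℚᵘ (p ℚᵘ.+ q)))))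

fromℚᵘ-mono-≤ : ∀ {p q} → p ℚᵘ.≤ q → fromℚᵘ p ≤ fromℚᵘ q
fromℚᵘ-mono-≤ {p} {q} p≤q = toℚᵘ-cancel-≤
  (ℚᵘ.≤-respˡ-≃ (ℚᵘ.≃-sym (toℚᵘ-fromℚᵘ p)) (ℚᵘ.≤-respʳ-≃ (ℚᵘ.≃-sym (toℚᵘ-fromℚᵘ q)) p≤q))

/-≡ : ∀ a m b n → a ℤ.* + suc n ≡ b ℤ.* + suc m → a / suc m ≡ b / suc n
/-≡ a m b n eq = fromℚᵘ-cong {ℚᵘ.mkℚᵘ a m} {ℚᵘ.mkℚᵘ b n} (ℚᵘ.*≡* eq)

/-≤ : ∀ a m b n → a ℤ.* + suc n ℤ.≤ b ℤ.* + suc m → a / suc m ≤ b / suc n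
/-≤ a m b n le = fromℚᵘ-mono-≤ {ℚᵘ.mkℚᵘ a m} {ℚᵘ.mkℚᵘ b n} (ℚᵘ.*≤* le)

cast-suc : ∀ n → + suc n / 1 ≡ + n / 1 + 1ℚ
cast-suc n = sym (trans (fromℚᵘ-+ (ℚᵘ.mkℚᵘ (+ n) 0) ℚᵘ.1ℚᵘ) (/-≡ (+ n ℤ.* + 1 ℤ.+ + 1 ℤ.* + 1) 0 (+ suc n) 0 (cong (ℤ._* + 1) (lemma n))))
  where
  lemma : ∀ n → + n ℤ.* + 1 ℤ.+ + 1 ℤ.* + 1 ≡ + suc n
  lemma n = trans (cong (ℤ._+ + 1) (ℤ.*-identityʳ (+ n))) (cong +_ (ℕ.+-comm n 1))

cast-mono : ∀ {m n} → m ℕ.≤ n → + m / 1 ≤ + n / 1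
cast-mono {m} {n} m≤n = /-≤ (+ m) 0 (+ n) 0 (ℤ.*-monoʳ-≤-nonNeg (+ 1) (ℤ.+≤+ m≤n))

cast-pos : ∀ n → 0ℚ < + suc n / 1
cast-pos n = positive⁻¹ (+ suc n / 1) {{normalize-pos (suc n) 1}}

/-antimono : ∀ a {m n} → m ℕ.≤ n → + a / suc n ≤ + a / suc m
/-antimono a {m} {n} m≤n = /-≤ (+ a) n (+ a) m (ℤ.*-monoˡ-≤-nonNeg (+ a) (ℤ.+≤+ (ℕ.s≤s m≤n)))

/-cast : ∀ a n → (+ a / suc n) * (+ suc n / 1) ≡ + a / 1
/-cast a n = trans (fromℚᵘ-* (ℚᵘ.mkℚᵘ (+ a) n) (ℚᵘ.mkℚᵘ (+ suc n) 0)) (/-≡ (+ a ℤ.* + suc n) (n ℕ.* 1) (+ a) 0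
  (trans (ℤ.*-identityʳ (+ a ℤ.* + suc n)) (cong (λ z → + a ℤ.* + z) (sym (ℕ.*-identityʳ (suc n))))))

/-nonneg : ∀ a n → 0ℚ ≤ + a / suc n
/-nonneg a n = nonNegative⁻¹ (+ a / suc n) {{normalize-nonNeg a (suc n)}}

1/-* : ∀ m n .{{_ : ℕ.NonZero m}} .{{_ : ℕ.NonZero n}} .{{_ : ℕ.NonZero (m ℕ.* n)}} →
       (+ 1 / m) * (+ 1 / n) ≡ + 1 / (m ℕ.* n)
1/-* (suc m) (suc n) = fromℚᵘ-* (ℚᵘ.mkℚᵘ (+ 1) m) (ℚᵘ.mkℚᵘ (+ 1) n)

archimedean : ∀ p → ∃ λ N → p ≤ + N / 1
archimedean p@(mkℚ i d _) = ℤ.∣ i ∣ , toℚᵘ-cancel-≤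
  (ℚᵘ.≤-respʳ-≃ (ℚᵘ.≃-sym (toℚᵘ-fromℚᵘ (ℚᵘ.mkℚᵘ (+ ℤ.∣ i ∣) 0))) (ℚᵘ.*≤* (lemma i)))
  where
  lemma : ∀ i → i ℤ.* + 1 ℤ.≤ + ℤ.∣ i ∣ ℤ.* + suc d
  lemma (+ k) = subst₂ ℤ._≤_ (ℤ.pos-* k 1) (ℤ.pos-* k (suc d)) (ℤ.+≤+ (ℕ.*-monoʳ-≤ k (ℕ.s≤s ℕ.z≤n)))
  lemma (-[1+ k ]) = ℤ.-≤+

eventually-small : ∀ a {ε} → 0ℚ < ε → Eventually λ n → + a / suc n ≤ ε
eventually-small a {ε} 0<ε =
  let N , N≥ = archimedean ((+ a / 1) over 0<ε)
  in N , λ n n≥ → *-cancelʳ-≤-pos (+ suc n / 1) {{positive (cast-pos n)}} (begin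
    (+ a / suc n) * (+ suc n / 1)     ≡⟨ /-cast a n ⟩
    + a / 1                           ≡⟨ over-* (+ a / 1) 0<ε ⟨
    ε * ((+ a / 1) over 0<ε)          ≤⟨ *-monoˡ-≤-nonNeg ε {{nonNegative (<⇒≤ 0<ε)}} N≥ ⟩
    ε * (+ N / 1)                     ≤⟨ *-monoˡ-≤-nonNeg ε {{nonNegative (<⇒≤ 0<ε)}} (cast-mono (ℕ.m≤n⇒m≤1+n n≥)) ⟩
    ε * (+ suc n / 1)                 ∎)
  where open ≤-Reasoning

-- π = 4 − 4/3 + 4/5 − 4/7 + ⋯

leibniz-sign : ℕ → ℚ
leibniz-sign zero    = 1ℚ
leibniz-sign (suc n) = - leibniz-sign n

leibniz : ℕ → ℚ
leibniz zero    = 0ℚ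
leibniz (suc n) = leibniz n + leibniz-sign n * (+ 4 / suc (2 ℕ.* n))

∣sign∣ : ∀ n → ∣ leibniz-sign n ∣ ≡ 1ℚ
∣sign∣ zero    = refl
∣sign∣ (suc n) = trans (∣-p∣≡∣p∣ (leibniz-sign n)) (∣sign∣ n)

alternating : ℕ → ℕ → ℚ
alternating m zero    = 0ℚ
alternating m (suc l) = + 4 / suc (2 ℕ.* m) - alternating (suc m) l

alternating-bounds : ∀ m l → 0ℚ ≤ alternating m l × alternating m l ≤ + 4 / suc (2 ℕ.* m)
alternating-bounds m zero    = ≤-refl , /-nonneg 4 (2 ℕ.* m)
alternating-bounds m (suc l) =
  let 0≤t , t≤ = alternating-bounds (suc m) l
      a = + 4 / suc (2 ℕ.* m)
      t = alternating (suc m) l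
      t≤a = ≤-trans t≤ (/-antimono 4 (ℕ.*-monoʳ-≤ 2 (ℕ.n≤1+n m)))
  in subst (_≤ a - t) (+-inverseʳ t) (+-monoˡ-≤ (- t) t≤a) ,
     subst (a - t ≤_) (+-identityʳ a) (+-monoʳ-≤ a (neg-antimono-≤ 0≤t))

leibniz-+ : ∀ l m → leibniz (l ℕ.+ m) ≡ leibniz m + leibniz-sign m * alternating m l
leibniz-+ zero    m = sym (trans (cong (λ t → leibniz m + t) (*-zeroʳ (leibniz-sign m))) (+-identityʳ (leibniz m)))
leibniz-+ (suc l) m = trans (cong leibniz (sym (ℕ.+-suc l m))) (trans (leibniz-+ l (suc m))
  (lemma (leibniz m) (leibniz-sign m) (+ 4 / suc (2 ℕ.* m)) (alternating (suc m) l)))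
  where
  lemma : ∀ x s a t → (x + s * a) + (- s) * t ≡ x + s * (a - t)
  lemma = solve-∀ ring

leibniz-near : ∀ m n → m ℕ.≤ n → ∣ leibniz n - leibniz m ∣ ≤ + 4 / suc (2 ℕ.* m)
leibniz-near m n m≤n = begin
  ∣ leibniz n - leibniz m ∣
    ≡⟨ cong (λ k → ∣ leibniz k - leibniz m ∣) (sym (ℕ.m∸n+n≡m m≤n)) ⟩
  ∣ leibniz ((n ℕ.∸ m) ℕ.+ m) - leibniz m ∣
    ≡⟨ cong (λ x → ∣ x - leibniz m ∣) (leibniz-+ (n ℕ.∸ m) m) ⟩
  ∣ leibniz m + leibniz-sign m * t - leibniz m ∣
    ≡⟨ cong ∣_∣ (lemma (leibniz m) (leibniz-sign m * t)) ⟩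
  ∣ leibniz-sign m * t ∣
    ≡⟨ ∣p*q∣≡∣p∣*∣q∣ (leibniz-sign m) t ⟩
  ∣ leibniz-sign m ∣ * ∣ t ∣
    ≡⟨ cong₂ _*_ (∣sign∣ m) (0≤p⇒∣p∣≡p (proj₁ (alternating-bounds m (n ℕ.∸ m)))) ⟩
  1ℚ * t
    ≡⟨ *-identityˡ t ⟩
  t
    ≤⟨ proj₂ (alternating-bounds m (n ℕ.∸ m)) ⟩
  + 4 / suc (2 ℕ.* m) ∎
  where
  open ≤-Reasoning
  t : ℚ
  t = alternating m (n ℕ.∸ m)
  lemma : ∀ a b → a + b - a ≡ b
  lemma = solve-∀ ring

abstract

  leibniz-cauchy : IsCauchy leibniz
  leibniz-cauchy ε 0<ε =
    let N , N≥ = eventually-small 4 (half-pos 0<ε)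
        near = λ n n≥ → ≤-trans (leibniz-near N n n≥) (N≥ (2 ℕ.* N) (ℕ.m≤n*m N 2))
    in N , λ m n m≥ n≥ → begin
      ∣ leibniz m - leibniz n ∣                             ≤⟨ ∣-∣-triangle (leibniz m) (leibniz N) (leibniz n) ⟩
      ∣ leibniz m - leibniz N ∣ + ∣ leibniz N - leibniz n ∣ ≡⟨ cong (λ t → ∣ leibniz m - leibniz N ∣ + t) (∣-∣-swap (leibniz N) (leibniz n)) ⟩
      ∣ leibniz m - leibniz N ∣ + ∣ leibniz n - leibniz N ∣ ≤⟨ +-mono-≤ (near m m≥) (near n n≥) ⟩
      ε * ½ + ε * ½                                         ≡⟨ halves ε ⟩
      ε                                                     ∎
    where open ≤-Reasoning

π : ℝ
π = mkℝ leibniz leibniz-cauchy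

infix 4 _≈ℂ_
infixl 6 _+ℂ_ _-ℂ_
infixl 7 _*ℂ_
infix  8 -ℂ_
infixr 9 _^ℕ_

record ℂ : Set where
  constructor _+i_
  field
    re im : ℝ

open ℂ public

_≈ℂ_ : ℂ → ℂ → Set
z ≈ℂ w = re z ≈ℝ re w × im z ≈ℝ im w

ℝ⇒ℂ : ℝ → ℂ
ℝ⇒ℂ x = x +i 0ℝ

0ℂ 1ℂ i : ℂ
0ℂ = ℝ⇒ℂ 0ℝ
1ℂ = ℝ⇒ℂ 1ℝ
i  = 0ℝ +i 1ℝ

_+ℂ_ : ℂ → ℂ → ℂ
(a +i b) +ℂ (c +i d) = (a +ℝ c) +i (b +ℝ d)

-ℂ_ : ℂ → ℂ
-ℂ_ (a +i b) = (-ℝ a) +i (-ℝ b)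

_-ℂ_ : ℂ → ℂ → ℂ
z -ℂ w = z +ℂ (-ℂ w)

_*ℂ_ : ℂ → ℂ → ℂ
(a +i b) *ℂ (c +i d) = (a *ℝ c +ℝ -ℝ (b *ℝ d)) +i (a *ℝ d +ℝ b *ℝ c)

_^ℕ_ : ℂ → ℕ → ℂ
z ^ℕ zero  = 1ℂ
z ^ℕ suc k = z *ℂ z ^ℕ k

∣_∣² : ℂ → ℝ
∣ a +i b ∣² = a *ℝ a +ℝ b *ℝ b

-- Nonzero in the positive sense 0 < |z|², which is what constructive
-- division needs; classically it is z ≉ 0.
_≠0 : ℂ → Set
z ≠0 = 0ℝ <ℝ ∣ z ∣²

inv : (z : ℂ) → z ≠0 → ℂ
inv z@(a +i b) z≠0 = (a *ℝ r) +i (-ℝ b *ℝ r)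
  where
  r : ℝ
  r = invℝ ∣ z ∣² z≠0

pow : (z : ℂ) → z ≠0 → ℤ → ℂ
pow z z≠0 (+ m)      = z ^ℕ m
pow z z≠0 (-[1+ m ]) = inv z z≠0 ^ℕ suc m

∑[_] : {I : Set} → List I → (I → ℂ) → ℂ
∑[ F ] f = foldr (λ k s → f k +ℂ s) 0ℂ F

-- s is the unconditional sum of the family f: the limit of its partial sums
-- over the finite sets of indices (duplicate-free lists F), directed by
-- inclusion.  The displayed inequality is |∑[ F ] f − s| < ε, squared.
HasSum : {I : Set} → (I → ℂ) → ℂ → Set
HasSum {I} f s = ∀ ε → 0ℚ < ε → ∃ λ (F₀ : List I) →
  ∀ (F : List I) → Unique F → F₀ ⊆ F → ∣ ∑[ F ] f -ℂ s ∣² <ℝ ℚ⇒ℝ (ε * ε)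

record Summable {I : Set} (f : I → ℂ) : Set where
  field
    value : ℂ
    sums  : HasSum f value

∑ : {I : Set} {f : I → ℂ} → Summable f → ℂ
∑ = Summable.value

exp-term : ℂ → ℕ → ℂ
exp-term z k = ℝ⇒ℂ (ℚ⇒ℝ ((+ 1 / (k !)) {{k ℕ.!≢0}})) *ℂ z ^ℕ k

∑ℚ : {I : Set} → List I → (I → ℚ) → ℚ
∑ℚ F g = foldr (λ k s → g k + s) 0ℚ F

partial : (ℕ → ℚ) → ℕ → ℚ
partial g zero    = 0ℚ
partial g (suc n) = partial g n + g n

Removed : ℕ → List ℕ → List ℕ → Set
Removed k F F′ = Unique F′
               × (∀ {j} → j ∈ F′ → j ∈ F × k ≢ j)
               × (∀ {j} → j ∈ F → k ≢ j → j ∈ F′)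
               × (∀ g → ∑ℚ F g ≡ g k + ∑ℚ F′ g)

remove : ∀ {k F} → Unique F → k ∈ F → ∃ (Removed k F)
remove {F = _ ∷ F} (k∉ ∷ uF) (here refl) = F , uF , (λ j∈ → there j∈ , All.lookup k∉ j∈) , to , λ _ → refl
  where
  to : ∀ {j} → j ∈ _ ∷ F → _ ≢ j → j ∈ F
  to (here refl) k≢j = ⊥-elim (k≢j refl)
  to (there j∈)  _   = j∈
remove {k} {x ∷ F} (x∉ ∷ uF) (there k∈) with remove uF k∈
... | F′ , uF′ , from , to , eq = x ∷ F′ , All.tabulate (λ j∈ → All.lookup x∉ (proj₁ (from j∈))) ∷ uF′ , from′ , to′ ,
        λ g → trans (cong (λ s → g x + s) (eq g)) (lemma (g x) (g k) (∑ℚ F′ g))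
  where
  from′ : ∀ {j} → j ∈ x ∷ F′ → j ∈ x ∷ F × k ≢ j
  from′ (here refl) = here refl , λ k≡x → All.lookup x∉ k∈ (sym k≡x)
  from′ (there j∈)  = there (proj₁ (from j∈)) , proj₂ (from j∈)
  to′ : ∀ {j} → j ∈ x ∷ F → k ≢ j → j ∈ x ∷ F′
  to′ (here refl) _   = here refl
  to′ (there j∈)  k≢j = there (to j∈ k≢j)
  lemma : ∀ a b c → a + (b + c) ≡ b + (a + c)
  lemma = solve-∀ ring

peel : ∀ N {F} → Unique F → (∀ {k} → k ℕ.< N → k ∈ F) → ∃ λ F′ → Unique F′
     × (∀ {k} → k ∈ F′ → N ℕ.≤ k) × (∀ {k} → k ∈ F → N ℕ.≤ k → k ∈ F′)
     × (∀ g → ∑ℚ F g ≡ partial g N + ∑ℚ F′ g)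
peel zero    {F} uF _  = F , uF , (λ _ → ℕ.z≤n) , (λ k∈ _ → k∈) , λ g → sym (+-identityˡ (∑ℚ F g))
peel (suc N) {F} uF ⊇ with peel N uF (λ k<N → ⊇ (ℕ.m<n⇒m<1+n k<N))
... | G , uG , ≥N , toG , eqG with remove uG (toG (⊇ ℕ.≤-refl) ℕ.≤-refl)
... | H , uH , fromH , toH , eqH = H , uH ,
  (λ k∈ → ℕ.≤∧≢⇒< (≥N (proj₁ (fromH k∈))) (proj₂ (fromH k∈))) ,
  (λ k∈ N<k → toH (toG k∈ (ℕ.<⇒≤ N<k)) (ℕ.<⇒≢ N<k)) ,
  λ g → trans (eqG g) (trans (cong (λ s → partial g N + s) (eqH g)) (sym (+-assoc (partial g N) (g N) (∑ℚ H g))))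

∑ℚ-abs : ∀ {g c : ℕ → ℚ} → (∀ k → ∣ g k ∣ ≤ c k) → ∀ F → ∣ ∑ℚ F g ∣ ≤ ∑ℚ F c
∑ℚ-abs         g≤c []      = ≤-refl
∑ℚ-abs {g} {c} g≤c (k ∷ F) = ≤-trans (∣p+q∣≤∣p∣+∣q∣ (g k) (∑ℚ F g)) (+-mono-≤ (g≤c k) (∑ℚ-abs g≤c F))

upper : (F : List ℕ) → ∃ λ M → ∀ {k} → k ∈ F → k ℕ.< M
upper []      = 0 , λ ()
upper (x ∷ F) with upper F
... | M , <M = suc x ℕ.⊔ M , bound
  where
  bound : ∀ {k} → k ∈ x ∷ F → k ℕ.< suc x ℕ.⊔ M
  bound (here refl) = ℕ.m≤m⊔n (suc x) M
  bound (there k∈)  = ℕ.≤-trans (<M k∈) (ℕ.m≤n⊔m (suc x) M)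

-- Series dominated by a nonnegative sequence c with c (k+1) ≤ c k / 2 for k ≥ K.
module Dominated (c : ℕ → ℚ) (0≤c : ∀ k → 0ℚ ≤ c k) (K : ℕ)
                 (halving : ∀ k → K ℕ.≤ k → c (suc k) + c (suc k) ≤ c k) where

  open ≤-Reasoning

  decreasing : ∀ k → K ℕ.≤ k → c (suc k) ≤ c k
  decreasing k K≤k = ≤-trans (≤-+ʳ (0≤c (suc k))) (halving k K≤k)

  list-tail : ∀ l {N F} → K ℕ.≤ N → Unique F → (∀ {k} → k ∈ F → N ℕ.≤ k) → (∀ {k} → k ∈ F → k ℕ.< l ℕ.+ N) →
              ∑ℚ F c ≤ c N + c N
  list-tail zero {N} {[]}    _ _ _  _  = +-nonneg (0≤c N) (0≤c N)
  list-tail zero {N} {x ∷ F} _ _ ≥N <N = ⊥-elim (ℕ.<-irrefl refl (ℕ.≤-trans (<N (here refl)) (≥N (here refl))))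
  list-tail (suc l) {N} {F} K≤N uF ≥N <l+N with DecMembership._∈?_ ℕ._≟_ N F
  ... | no N∉F = begin
        ∑ℚ F c                  ≤⟨ list-tail l (ℕ.m≤n⇒m≤1+n K≤N) uF
                                     (λ k∈ → ℕ.≤∧≢⇒< (≥N k∈) λ { refl → N∉F k∈ })
                                     (λ {k} k∈ → subst (k ℕ.<_) (sym (ℕ.+-suc l N)) (<l+N k∈)) ⟩
        c (suc N) + c (suc N)   ≤⟨ +-mono-≤ (decreasing N K≤N) (decreasing N K≤N) ⟩
        c N + c N               ∎
  ... | yes N∈F with remove uF N∈F
  ...   | F′ , uF′ , from , _ , eq = begin
        ∑ℚ F c                          ≡⟨ eq c ⟩
        c N + ∑ℚ F′ c                   ≤⟨ +-monoʳ-≤ (c N) (list-tail l (ℕ.m≤n⇒m≤1+n K≤N) uF′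
                                             (λ k∈ → ℕ.≤∧≢⇒< (≥N (proj₁ (from k∈))) (proj₂ (from k∈)))
                                             (λ {k} k∈ → subst (k ℕ.<_) (sym (ℕ.+-suc l N)) (<l+N (proj₁ (from k∈))))) ⟩
        c N + (c (suc N) + c (suc N))   ≤⟨ +-monoʳ-≤ (c N) (halving N K≤N) ⟩
        c N + c N                       ∎

  partial-tail : ∀ {g} → (∀ k → ∣ g k ∣ ≤ c k) → ∀ l N → K ℕ.≤ N →
                 ∣ partial g (l ℕ.+ N) - partial g N ∣ + (c (l ℕ.+ N) + c (l ℕ.+ N)) ≤ c N + c N
  partial-tail {g} g≤c zero    N K≤N = ≤-reflexive (trans (cong (λ p → ∣ p ∣ + (c N + c N)) (+-inverseʳ (partial g N)))
                                                         (+-identityˡ (c N + c N)))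
  partial-tail {g} g≤c (suc l) N K≤N = begin
    ∣ P + g M - partial g N ∣ + (c (suc M) + c (suc M))
      ≤⟨ +-mono-≤ (≤-trans (≤-reflexive (cong ∣_∣ (shuffle P (g M) (partial g N)))) (∣p+q∣≤∣p∣+∣q∣ (P - partial g N) (g M)))
                  (halving M (ℕ.m≤n⇒m≤o+n l K≤N)) ⟩
    (∣ P - partial g N ∣ + ∣ g M ∣) + c M
      ≤⟨ +-monoˡ-≤ (c M) (+-monoʳ-≤ ∣ P - partial g N ∣ (g≤c M)) ⟩
    (∣ P - partial g N ∣ + c M) + c M
      ≡⟨ +-assoc ∣ P - partial g N ∣ (c M) (c M) ⟩
    ∣ P - partial g N ∣ + (c M + c M)
      ≤⟨ partial-tail g≤c l N K≤N ⟩
    c N + c N ∎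
    where
    M : ℕ
    M = l ℕ.+ N
    P : ℚ
    P = partial g M
    shuffle : ∀ a b c → a + b - c ≡ (a - c) + b
    shuffle = solve-∀ ring

  partial-near : ∀ {g} → (∀ k → ∣ g k ∣ ≤ c k) → ∀ {N n} → K ℕ.≤ N → N ℕ.≤ n → ∣ partial g n - partial g N ∣ ≤ c N + c N
  partial-near {g} g≤c {N} {n} K≤N N≤n = ≤-trans (≤-+ʳ (+-nonneg (0≤c M) (0≤c M)))
    (subst (λ k → ∣ partial g k - partial g N ∣ + (c M + c M) ≤ c N + c N) (ℕ.m∸n+n≡m N≤n) (partial-tail g≤c (n ℕ.∸ N) N K≤N))
    where
    M : ℕ
    M = n ℕ.∸ N ℕ.+ N

  list-near : ∀ {g} → (∀ k → ∣ g k ∣ ≤ c k) → ∀ {N F} → K ℕ.≤ N → Unique F → (∀ {k} → k ℕ.< N → k ∈ F) →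
              ∣ ∑ℚ F g - partial g N ∣ ≤ c N + c N
  list-near {g} g≤c {N} {F} K≤N uF ⊇ with peel N uF ⊇
  ... | F′ , uF′ , ≥N , _ , eq with upper F′
  ...   | M , <M = begin
    ∣ ∑ℚ F g - partial g N ∣                     ≡⟨ cong (λ s → ∣ s - partial g N ∣) (eq g) ⟩
    ∣ partial g N + ∑ℚ F′ g - partial g N ∣      ≡⟨ cong ∣_∣ (cancel (partial g N) (∑ℚ F′ g)) ⟩
    ∣ ∑ℚ F′ g ∣                                  ≤⟨ ∑ℚ-abs g≤c F′ ⟩
    ∑ℚ F′ c                                      ≤⟨ list-tail M K≤N uF′ ≥N (λ k∈ → ℕ.≤-trans (<M k∈) (ℕ.m≤m+n M N)) ⟩
    c N + c N                                    ∎
    where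
    cancel : ∀ a b → a + b - a ≡ b
    cancel = solve-∀ ring

  decay : ∀ j → c (j ℕ.+ K) * (+ suc j / 1) ≤ c K
  decay zero    = ≤-reflexive (*-identityʳ (c K))
  decay (suc j) = begin
    a * (+ suc (suc j) / 1)   ≡⟨ cong (a *_) (cast-suc (suc j)) ⟩
    a * (J + 1ℚ)              ≤⟨ *-monoˡ-≤-nonNeg a {{nonNegative (0≤c (suc (j ℕ.+ K)))}} (+-monoʳ-≤ J (cast-mono {1} {suc j} (ℕ.s≤s ℕ.z≤n))) ⟩
    a * (J + J)               ≡⟨ regroup a J ⟩
    (a + a) * J               ≤⟨ *-monoʳ-≤-nonNeg J {{nonNegative (<⇒≤ (cast-pos j))}} (halving (j ℕ.+ K) (ℕ.m≤n+m K j)) ⟩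
    c (j ℕ.+ K) * J           ≤⟨ decay j ⟩
    c K                       ∎
    where
    a J : ℚ
    a = c (suc (j ℕ.+ K))
    J = + suc j / 1
    regroup : ∀ a b → a * (b + b) ≡ (a + a) * b
    regroup = solve-∀ ring

  small : ∀ {ε} → 0ℚ < ε → ∃ λ N → K ℕ.≤ N × c N ≤ ε
  small {ε} 0<ε =
    let j , j≥ = archimedean (c K over 0<ε)
    in j ℕ.+ K , ℕ.m≤n+m K j , *-cancelʳ-≤-pos (+ suc j / 1) {{positive (cast-pos j)}} (begin
      c (j ℕ.+ K) * (+ suc j / 1)   ≤⟨ decay j ⟩
      c K                           ≡⟨ over-* (c K) 0<ε ⟨
      ε * (c K over 0<ε)            ≤⟨ *-monoˡ-≤-nonNeg ε {{nonNegative (<⇒≤ 0<ε)}} (≤-trans j≥ (cast-mono (ℕ.n≤1+n j))) ⟩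
      ε * (+ suc j / 1)             ∎)

  partialℝ : (ℕ → ℝ) → ℕ → ℝ
  partialℝ u zero    = 0ℝ
  partialℝ u (suc n) = partialℝ u n +ℝ u n

  seq-partialℝ : ∀ u N n → seq (partialℝ u N) n ≡ partial (λ k → seq (u k) n) N
  seq-partialℝ u zero    n = refl
  seq-partialℝ u (suc N) n = cong (_+ seq (u N) n) (seq-partialℝ u N n)

  -- The limit of the series ∑ u is represented by its diagonal.
  module Limit (u : ℕ → ℝ) (n₀ : ℕ) (u≤c : ∀ n → n₀ ℕ.≤ n → ∀ k → ∣ seq (u k) n ∣ ≤ c k) where

    at : ℕ → ℕ → ℚ
    at n k = seq (u k) n

    diagonal : ℕ → ℚ
    diagonal n = partial (at n) n

    diagonal-cauchy : IsCauchy diagonal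
    diagonal-cauchy ε 0<ε =
      let η = ε * ½ * ½ * ½
          0<η = half-pos (half-pos (half-pos 0<ε))
          N , K≤N , cN≤η = small 0<η
          M , M≥ = cauchy (partialℝ u N) (ε * ½) (half-pos 0<ε)
          Q = n₀ ℕ.⊔ N ℕ.⊔ M
          ≥n₀ : ∀ {n} → Q ℕ.≤ n → n₀ ℕ.≤ n
          ≥n₀ q = ℕ.m⊔n≤o⇒m≤o n₀ N (ℕ.m⊔n≤o⇒m≤o (n₀ ℕ.⊔ N) M q)
          ≥N : ∀ {n} → Q ℕ.≤ n → N ℕ.≤ n
          ≥N q = ℕ.m⊔n≤o⇒n≤o n₀ N (ℕ.m⊔n≤o⇒m≤o (n₀ ℕ.⊔ N) M q)
          ≥M : ∀ {n} → Q ℕ.≤ n → M ℕ.≤ n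
          ≥M q = ℕ.m⊔n≤o⇒n≤o (n₀ ℕ.⊔ N) M q
          near : ∀ {n} → Q ℕ.≤ n → ∣ diagonal n - partial (at n) N ∣ ≤ η + η
          near {n} q = ≤-trans (partial-near (u≤c n (≥n₀ q)) K≤N (≥N q)) (+-mono-≤ cN≤η cN≤η)
      in Q , λ m n m≥ n≥ → let A = partial (at m) N ; B = partial (at n) N in begin
        ∣ diagonal m - diagonal n ∣
          ≤⟨ ∣-∣-triangle (diagonal m) A (diagonal n) ⟩
        ∣ diagonal m - A ∣ + ∣ A - diagonal n ∣
          ≤⟨ +-monoʳ-≤ ∣ diagonal m - A ∣ (∣-∣-triangle A B (diagonal n)) ⟩
        ∣ diagonal m - A ∣ + (∣ A - B ∣ + ∣ B - diagonal n ∣)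
          ≤⟨ +-mono-≤ (near m≥) (+-mono-≤
               (subst₂ (λ a b → ∣ a - b ∣ ≤ ε * ½) (seq-partialℝ u N m) (seq-partialℝ u N n) (M≥ m n (≥M m≥) (≥M n≥)))
               (subst (_≤ η + η) (∣-∣-swap (diagonal n) B) (near n≥))) ⟩
        (η + η) + (ε * ½ + (η + η))
          ≡⟨ collect ε ⟩
        ε ∎
      where
      collect : ∀ e → (e * ½ * ½ * ½ + e * ½ * ½ * ½) + (e * ½ + (e * ½ * ½ * ½ + e * ½ * ½ * ½)) ≡ e
      collect = solve-∀ ring

    limit : ℝ
    limit = mkℝ diagonal diagonal-cauchy

    limit-near : ∀ {ε N} → K ℕ.≤ N → c N ≤ ε * ½ * ½ * ½ → ∀ {F} → Unique F → (∀ {k} → k ℕ.< N → k ∈ F) →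
                 ∀ {n} → n₀ ℕ.≤ n → N ℕ.≤ n → ∣ ∑ℚ F (at n) - seq limit n ∣ ≤ ε * ½
    limit-near {ε} {N} K≤N cN≤η {F} uF ⊇ {n} n≥n₀ n≥N = begin
      ∣ ∑ℚ F (at n) - diagonal n ∣
        ≤⟨ ∣-∣-triangle (∑ℚ F (at n)) A (diagonal n) ⟩
      ∣ ∑ℚ F (at n) - A ∣ + ∣ A - diagonal n ∣
        ≡⟨ cong (λ d → ∣ ∑ℚ F (at n) - A ∣ + d) (∣-∣-swap A (diagonal n)) ⟩
      ∣ ∑ℚ F (at n) - A ∣ + ∣ diagonal n - A ∣
        ≤⟨ +-mono-≤ (list-near (u≤c n n≥n₀) K≤N uF ⊇) (partial-near (u≤c n n≥n₀) K≤N n≥N) ⟩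
      (c N + c N) + (c N + c N)
        ≤⟨ +-mono-≤ (+-mono-≤ cN≤η cN≤η) (+-mono-≤ cN≤η cN≤η) ⟩
      (η + η) + (η + η)
        ≡⟨ collect ε ⟩
      ε * ½ ∎
      where
      A η : ℚ
      A = partial (at n) N
      η = ε * ½ * ½ * ½
      collect : ∀ e → (e * ½ * ½ * ½ + e * ½ * ½ * ½) + (e * ½ * ½ * ½ + e * ½ * ½ * ½) ≡ e * ½
      collect = solve-∀ ring

-- |re z| + |im z| at stage n of the approximation
norm : ℂ → ℕ → ℚ
norm z n = ∣ seq (re z) n ∣ + ∣ seq (im z) n ∣

norm-nonneg : ∀ z n → 0ℚ ≤ norm z n
norm-nonneg z n = +-nonneg (0≤∣p∣ (seq (re z) n)) (0≤∣p∣ (seq (im z) n))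

norm-* : ∀ z w n → norm (z *ℂ w) n ≤ norm z n * norm w n
norm-* (x +i y) (u +i v) n = begin
  ∣ a * c - b * d ∣ + ∣ a * d + b * c ∣
    ≤⟨ +-mono-≤ (∣p-q∣≤∣p∣+∣q∣ (a * c) (b * d)) (∣p+q∣≤∣p∣+∣q∣ (a * d) (b * c)) ⟩
  (∣ a * c ∣ + ∣ b * d ∣) + (∣ a * d ∣ + ∣ b * c ∣)
    ≡⟨ cong₂ _+_ (cong₂ _+_ (∣p*q∣≡∣p∣*∣q∣ a c) (∣p*q∣≡∣p∣*∣q∣ b d)) (cong₂ _+_ (∣p*q∣≡∣p∣*∣q∣ a d) (∣p*q∣≡∣p∣*∣q∣ b c)) ⟩
  (∣ a ∣ * ∣ c ∣ + ∣ b ∣ * ∣ d ∣) + (∣ a ∣ * ∣ d ∣ + ∣ b ∣ * ∣ c ∣)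
    ≡⟨ factor (∣ a ∣) (∣ b ∣) (∣ c ∣) (∣ d ∣) ⟩
  (∣ a ∣ + ∣ b ∣) * (∣ c ∣ + ∣ d ∣) ∎
  where
  open ≤-Reasoning
  a b c d : ℚ
  a = seq x n
  b = seq y n
  c = seq u n
  d = seq v n
  factor : ∀ a b c d → (a * c + b * d) + (a * d + b * c) ≡ (a + b) * (c + d)
  factor = solve-∀ ring

seq-re-∑ : ∀ {I : Set} (f : I → ℂ) F n → seq (re (∑[ F ] f)) n ≡ ∑ℚ F (λ k → seq (re (f k)) n)
seq-re-∑ f []      n = refl
seq-re-∑ f (k ∷ F) n = cong (λ s → seq (re (f k)) n + s) (seq-re-∑ f F n)

seq-im-∑ : ∀ {I : Set} (f : I → ℂ) F n → seq (im (∑[ F ] f)) n ≡ ∑ℚ F (λ k → seq (im (f k)) n)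
seq-im-∑ f []      n = refl
seq-im-∑ f (k ∷ F) n = cong (λ s → seq (im (f k)) n + s) (seq-im-∑ f F n)

-- the terms Cᵏ/k! dominating the exponential series
invfact : ℕ → ℚ
invfact k = (+ 1 / (k !)) {{k ℕ.!≢0}}

invfact-suc : ∀ k → invfact (suc k) ≡ (+ 1 / suc k) * invfact k
invfact-suc k = sym (1/-* (suc k) (k !) {{_}} {{k ℕ.!≢0}} {{suc k ℕ.!≢0}})

invfact-nonneg : ∀ k → 0ℚ ≤ invfact k
invfact-nonneg k = nonNegative⁻¹ (invfact k) {{normalize-nonNeg 1 (k !) {{k ℕ.!≢0}}}}

module Exponential (z : ℂ) where

  open ≤-Reasoning

  reBound : ∃ λ B → 0ℚ < B × Eventually λ n → ∣ seq (re z) n ∣ ≤ B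
  reBound = bounded (re z)

  imBound : ∃ λ B → 0ℚ < B × Eventually λ n → ∣ seq (im z) n ∣ ≤ B
  imBound = bounded (im z)

  C : ℚ
  C = proj₁ reBound + proj₁ imBound

  0≤C : 0ℚ ≤ C
  0≤C = +-nonneg (<⇒≤ (proj₁ (proj₂ reBound))) (<⇒≤ (proj₁ (proj₂ imBound)))

  n₀ : ℕ
  n₀ = proj₁ (proj₂ (proj₂ reBound)) ℕ.⊔ proj₁ (proj₂ (proj₂ imBound))

  norm≤C : ∀ n → n₀ ℕ.≤ n → norm z n ≤ C
  norm≤C n n≥ = +-mono-≤
    (proj₂ (proj₂ (proj₂ reBound)) n (ℕ.≤-trans (ℕ.m≤m⊔n _ _) n≥))
    (proj₂ (proj₂ (proj₂ imBound)) n (ℕ.≤-trans (ℕ.m≤n⊔m (proj₁ (proj₂ (proj₂ reBound))) _) n≥))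

  C^ : ℕ → ℚ
  C^ zero    = 1ℚ
  C^ (suc k) = C * C^ k

  0≤C^ : ∀ k → 0ℚ ≤ C^ k
  0≤C^ zero    = nonNegative⁻¹ 1ℚ
  0≤C^ (suc k) = *-nonneg 0≤C (0≤C^ k)

  norm-power : ∀ n → n₀ ℕ.≤ n → ∀ k → norm (z ^ℕ k) n ≤ C^ k
  norm-power n n≥ zero    = ≤-refl
  norm-power n n≥ (suc k) = ≤-trans (norm-* z (z ^ℕ k) n)
    (*-mono-≤ (norm-nonneg z n) (0≤C^ k) (norm≤C n n≥) (norm-power n n≥ k))

  c : ℕ → ℚ
  c k = invfact k * C^ k

  0≤c : ∀ k → 0ℚ ≤ c k
  0≤c k = *-nonneg (invfact-nonneg k) (0≤C^ k)

  norm-term : ∀ n → n₀ ℕ.≤ n → ∀ k → norm (exp-term z k) n ≤ c k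
  norm-term n n≥ k = begin
    norm (exp-term z k) n                  ≤⟨ norm-* (ℝ⇒ℂ (ℚ⇒ℝ (invfact k))) (z ^ℕ k) n ⟩
    (∣ invfact k ∣ + 0ℚ) * norm (z ^ℕ k) n ≡⟨ cong (_* norm (z ^ℕ k) n)
                                                (trans (+-identityʳ ∣ invfact k ∣) (0≤p⇒∣p∣≡p (invfact-nonneg k))) ⟩
    invfact k * norm (z ^ℕ k) n            ≤⟨ *-monoˡ-≤-nonNeg (invfact k) {{nonNegative (invfact-nonneg k)}} (norm-power n n≥ k) ⟩
    invfact k * C^ k                       ∎

  K : ℕ
  K = proj₁ (archimedean (C + C))

  halving : ∀ k → K ℕ.≤ k → c (suc k) + c (suc k) ≤ c k
  halving k k≥ = begin
    c (suc k) + c (suc k)                          ≡⟨ cong (λ v → v * C^ (suc k) + v * C^ (suc k)) (invfact-suc k) ⟩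
    r * f * (C * C^ k) + r * f * (C * C^ k)        ≡⟨ regroup r f C (C^ k) ⟩
    (r * (C + C)) * (f * C^ k)                     ≤⟨ *-monoʳ-≤-nonNeg (c k) {{nonNegative (0≤c k)}}
                                                        (*-monoˡ-≤-nonNeg r {{nonNegative (/-nonneg 1 k)}}
                                                          (≤-trans (proj₂ (archimedean (C + C))) (cast-mono (ℕ.m≤n⇒m≤1+n k≥)))) ⟩
    (r * (+ suc k / 1)) * (f * C^ k)               ≡⟨ cong (_* (f * C^ k)) (/-cast 1 k) ⟩
    1ℚ * (f * C^ k)                                ≡⟨ *-identityˡ (f * C^ k) ⟩
    c k                                            ∎
    where
    r f : ℚ
    r = + 1 / suc k
    f = invfact k
    regroup : ∀ r f C D → r * f * (C * D) + r * f * (C * D) ≡ (r * (C + C)) * (f * D)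
    regroup = solve-∀ ring

  open Dominated c 0≤c K halving using (small; module Limit)

  re-term im-term : ℕ → ℝ
  re-term k = re (exp-term z k)
  im-term k = im (exp-term z k)

  re≤c : ∀ n → n₀ ℕ.≤ n → ∀ k → ∣ seq (re-term k) n ∣ ≤ c k
  re≤c n n≥ k = ≤-trans (≤-+ʳ (0≤∣p∣ (seq (im-term k) n))) (norm-term n n≥ k)

  im≤c : ∀ n → n₀ ℕ.≤ n → ∀ k → ∣ seq (im-term k) n ∣ ≤ c k
  im≤c n n≥ k = ≤-trans
    (subst (∣ seq (im-term k) n ∣ ≤_) (+-comm ∣ seq (im-term k) n ∣ ∣ seq (re-term k) n ∣) (≤-+ʳ (0≤∣p∣ (seq (re-term k) n))))
    (norm-term n n≥ k)

  module Re = Limit re-term n₀ re≤c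
  module Im = Limit im-term n₀ im≤c

  value : ℂ
  value = Re.limit +i Im.limit

  square-≤ : ∀ {p ε} → 0ℚ ≤ ε → ∣ p ∣ ≤ ε → p * p ≤ ε * ε
  square-≤ {p} {ε} 0≤ε p≤ε = begin
    p * p           ≤⟨ p≤∣p∣ (p * p) ⟩
    ∣ p * p ∣       ≡⟨ ∣p*q∣≡∣p∣*∣q∣ p p ⟩
    ∣ p ∣ * ∣ p ∣   ≤⟨ *-mono-≤ (0≤∣p∣ p) 0≤ε p≤ε p≤ε ⟩
    ε * ε           ∎

  value-sum : HasSum (exp-term z) value
  value-sum ε 0<ε =
    let N , K≤N , cN≤η = small (half-pos (half-pos (half-pos 0<ε)))
        0≤ε/2 = <⇒≤ (half-pos 0<ε)
    in upTo N , λ F uF ⊇ →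
      let ⊇N : ∀ {k} → k ℕ.< N → k ∈ F
          ⊇N k<N = ⊇ (∈-upTo⁺ k<N)
      in ε * ½ * ε , *-pos (half-pos 0<ε) 0<ε , n₀ ℕ.⊔ N , λ n n≥ →
        let n≥n₀ = ℕ.m⊔n≤o⇒m≤o n₀ N n≥
            n≥N = ℕ.m⊔n≤o⇒n≤o n₀ N n≥
            p = seq (re (∑[ F ] (exp-term z))) n - seq (re value) n
            q = seq (im (∑[ F ] (exp-term z))) n - seq (im value) n
            p≤ = subst (λ s → ∣ s - seq (re value) n ∣ ≤ ε * ½) (sym (seq-re-∑ (exp-term z) F n)) (Re.limit-near {ε} K≤N cN≤η uF ⊇N n≥n₀ n≥N)
            q≤ = subst (λ s → ∣ s - seq (im value) n ∣ ≤ ε * ½) (sym (seq-im-∑ (exp-term z) F n)) (Im.limit-near {ε} K≤N cN≤η uF ⊇N n≥n₀ n≥N)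
        in begin
          (p * p + q * q) + ε * ½ * ε                          ≤⟨ +-monoˡ-≤ (ε * ½ * ε) (+-mono-≤ (square-≤ 0≤ε/2 p≤) (square-≤ 0≤ε/2 q≤)) ⟩
          (ε * ½ * (ε * ½) + ε * ½ * (ε * ½)) + ε * ½ * ε      ≡⟨ collect ε ⟩
          ε * ε                                                ∎
    where
    collect : ∀ e → (e * ½ * (e * ½) + e * ½ * (e * ½)) + e * ½ * e ≡ e * e
    collect = solve-∀ ring

abstract

  exp-summable : (z : ℂ) → Summable (exp-term z)
  exp-summable z = record { value = Exponential.value z ; sums = Exponential.value-sum z }

exp : ℂ → ℂ
exp z = ∑ (exp-summable z)

-- qʳ = e^{πirτ} for real r, where q = e^{πiτ}.
qPow : ℂ → ℝ → ℂ
qPow τ r = exp (ℝ⇒ℂ (π *ℝ r) *ℂ (i *ℂ τ))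

-- z^{m+1/2} = zᵐ z^{1/2} for the chosen square root √z.
pow½ : (z : ℂ) → z ≠0 → (√z : ℂ) → ℤ → ℂ
pow½ z z≠0 √z m = pow z z≠0 m *ℂ √z

-1≠0 : (-ℂ 1ℂ) ≠0
-1≠0 = 1ℚ , positive⁻¹ 1ℚ , 0 , λ _ _ → ≤-refl

[-1]^_ : ℤ → ℂ
[-1]^ k = pow (-ℂ 1ℂ) -1≠0 k

_+0 _+½ : ℤ → ℚ
m +0 = m / 1
m +½ = m / 1 + ½

form : ℤ → ℤ → ℚ → ℚ → ℝ
form b d u v = ℚ⇒ℝ ((d / 1) * (u * u) + (b / 1) * (u * v) + (d / 1) * (v * v))

{-# OPTIONS --safe #-}
-- With u = m + n and v = m − n the form d m² + b m n + d n² becomes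
-- ((2d + b) u² + (2d − b) v²) / 4, so over a class of pairs of fixed parity of v
-- each double series is a product of two one-dimensional theta series.  Let e₁, o₁
-- be the series in u over even and odd integers, and e₂, o₂ those in v.  The
-- integer pairs contribute E = e₁ e₂ and O = x o₁ o₂, the half-integer pairs
-- H₀ = s o₁ e₂ and H₁ = s y⁻¹ e₁ o₂ with s = √x √y.  The four double sums are
-- E ± O and H₀ ± H₁, and the theorem reduces to E O = H₀ H₁, i.e. to s² y⁻¹ = x.
--
-- Convergence comes from |q| < 1, which follows from |exp ζ|² exp (−2 re ζ) = 1
-- and the lower bound exp t ≥ 1 + t/2 for real t > 0.
module Submission where

open import Algebra.Bundles using (CommutativeRing)
import Algebra.Properties.AbelianGroup as AbelianGroupProperties
open import Data.Empty using (⊥-elim)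
open import Data.Integer.Base as ℤ using (ℤ; +_; -[1+_])
import Data.Integer.Properties as ℤ
import Data.Integer.Tactic.RingSolver as ℤSolver
open import Data.List.Base using (List; [_]; []; _∷_; _++_; map; foldr; filter; cartesianProduct; deduplicate; upTo)
import Data.List.Membership.DecPropositional as DecMembership
open import Data.List.Membership.Propositional using (_∈_; _∉_)
open import Data.List.Membership.Propositional.Properties using (∈-∃++; ∈-++⁺ˡ; ∈-++⁺ʳ; ∈-++⁻; ∈-map⁺; ∈-map⁻; ∈-filter⁻; ∈-cartesianProduct⁺; ∈-deduplicate⁺; ∈-deduplicate⁻; ∈-upTo⁺; ∈-upTo⁻)
open import Data.List.Properties using (map-++; map-∘; upTo-∷ʳ)
open import Data.List.Relation.Binary.Permutation.Propositional as Perm using (_↭_; prep; swap; ↭-refl; ↭-trans; ↭⇒↭ₛ)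
open import Data.List.Relation.Binary.Permutation.Propositional.Properties using (shift)
import Data.List.Relation.Binary.Permutation.Setoid.Properties as Permutationₛ
open import Data.List.Relation.Binary.Subset.Propositional using (_⊆_)
open import Data.List.Relation.Unary.All as All using (All; []; _∷_)
open import Data.List.Relation.Unary.AllPairs using ([]; _∷_)
open import Data.List.Relation.Unary.Any using (here; there)
open import Data.List.Relation.Unary.Unique.Propositional using (Unique)
import Data.List.Relation.Unary.Unique.DecPropositional.Properties as UniqueDec
import Data.List.Relation.Unary.Unique.Propositional.Properties as Unique
open import Data.Nat.Base as ℕ using (ℕ; zero; suc)
import Data.Nat.Properties as ℕ
import Data.Nat.Tactic.RingSolver as ℕSolver
open import Data.Product.Base using (∃; ∃₂; Σ-syntax; _×_; _,_; proj₁; proj₂)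
open import Data.Rational.Base hiding (truncate)
open import Data.Rational.Properties
import Data.Rational.Unnormalised.Base as ℚᵘ
open import Data.Sum.Base using (_⊎_; inj₁; inj₂; [_,_]′)
open import Data.Unit.Base using (⊤; tt)
open import Defs
open import Level using (0ℓ)
open import Relation.Binary.Bundles using (Setoid)
open import Relation.Binary.Definitions using (DecidableEquality)
open import Relation.Binary.PropositionalEquality using (_≡_; _≢_; refl; sym; trans; cong; cong₂; subst; isEquivalence; setoid; module ≡-Reasoning)
import Relation.Binary.Reasoning.Setoid as SetoidReasoning
open import Relation.Nullary.Decidable using (Dec; yes; no; ¬?; dec⇒maybe)
open import Relation.Nullary.Negation using (¬_)
open import Tactic.RingSolver using (solve-∀)
open import Tactic.RingSolver.Core.AlmostCommutativeRing using (AlmostCommutativeRing; fromCommutativeRing)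
open import Algebra.Properties.Semiring.Exp (CommutativeRing.semiring +-*-commutativeRing) using (_^_; ^-homo-*)

-- `exp` is opaque: it is the value of an abstract `Summable`, so all that is known about it comes
-- from `HasSum`, through the uniqueness of unconditional sums along cofinal finite sets. To
-- multiply two sums one needs control of all finite sets disjoint from a given one; `AbsSum`
-- therefore carries a rational majorant with small tails. A majorant is an exact bound, so `AbsSum`
-- follows a family only along stagewise equality `_≐_`. Two sizes of a complex number are in use:
-- |re| + |im|, which is rational at each stage, subadditive and submultiplicative, and the squared
-- modulus `N²`, because |q| < 1 does not make |re q| + |im q| smaller than 1. The parity classes
-- also dispose of the sign: (-1)^(n-m) is constant on each of them.

private module ℤGroup = AbelianGroupProperties ℤ.+-0-abelianGroup


-- Approximation by Gaussian rationals

infixl 6 _⊕_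
infixl 7 _⊗_
infix  8 ⊖_

record ℚ[i] : Set where
  constructor _⊹_
  field
    real imag : ℚ

open ℚ[i]

0ᵢ 1ᵢ : ℚ[i]
0ᵢ = 0ℚ ⊹ 0ℚ
1ᵢ = 1ℚ ⊹ 0ℚ

_⊕_ _⊗_ : ℚ[i] → ℚ[i] → ℚ[i]
(a ⊹ b) ⊕ (c ⊹ d) = (a + c) ⊹ (b + d)
(a ⊹ b) ⊗ (c ⊹ d) = (a * c + - (b * d)) ⊹ (a * d + b * c)

⊖_ : ℚ[i] → ℚ[i]
⊖ (a ⊹ b) = (- a) ⊹ (- b)

⊗-assoc : ∀ x y z → (x ⊗ y) ⊗ z ≡ x ⊗ (y ⊗ z)
⊗-assoc (a ⊹ b) (c ⊹ d) (e ⊹ f) = cong₂ _⊹_ (l₁ a b c d e f) (l₂ a b c d e f)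
  where
  l₁ : ∀ a b c d e f → (a * c + - (b * d)) * e + - ((a * d + b * c) * f) ≡ a * (c * e + - (d * f)) + - (b * (c * f + d * e))
  l₁ = solve-∀ ring
  l₂ : ∀ a b c d e f → (a * c + - (b * d)) * f + (a * d + b * c) * e ≡ a * (c * f + d * e) + b * (c * e + - (d * f))
  l₂ = solve-∀ ring

⊗-comm : ∀ x y → x ⊗ y ≡ y ⊗ x
⊗-comm (a ⊹ b) (c ⊹ d) = cong₂ _⊹_ (l₁ a b c d) (l₂ a b c d)
  where
  l₁ : ∀ a b c d → a * c + - (b * d) ≡ c * a + - (d * b)
  l₁ = solve-∀ ring
  l₂ : ∀ a b c d → a * d + b * c ≡ c * b + d * a
  l₂ = solve-∀ ring

⊗-identityˡ : ∀ x → 1ᵢ ⊗ x ≡ x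
⊗-identityˡ (a ⊹ b) = cong₂ _⊹_ (l₁ a b) (l₂ a b)
  where
  l₁ : ∀ a b → 1ℚ * a + - (0ℚ * b) ≡ a
  l₁ = solve-∀ ring
  l₂ : ∀ a b → 1ℚ * b + 0ℚ * a ≡ b
  l₂ = solve-∀ ring

⊗-distribˡ-⊕ : ∀ x y z → x ⊗ (y ⊕ z) ≡ x ⊗ y ⊕ x ⊗ z
⊗-distribˡ-⊕ (a ⊹ b) (c ⊹ d) (e ⊹ f) = cong₂ _⊹_ (l₁ a b c d e f) (l₂ a b c d e f)
  where
  l₁ : ∀ a b c d e f → a * (c + e) + - (b * (d + f)) ≡ (a * c + - (b * d)) + (a * e + - (b * f))
  l₁ = solve-∀ ring
  l₂ : ∀ a b c d e f → a * (d + f) + b * (c + e) ≡ (a * d + b * c) + (a * f + b * e)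
  l₂ = solve-∀ ring

⊕-⊗-commutativeRing : CommutativeRing 0ℓ 0ℓ
⊕-⊗-commutativeRing = record
  { Carrier = ℚ[i] ; _≈_ = _≡_ ; _+_ = _⊕_ ; _*_ = _⊗_ ; -_ = ⊖_ ; 0# = 0ᵢ ; 1# = 1ᵢ
  ; isCommutativeRing = record
    { isRing = record
      { +-isAbelianGroup = record
        { isGroup = record
          { isMonoid = record
            { isSemigroup = record
              { isMagma = record { isEquivalence = isEquivalence ; ∙-cong = cong₂ _⊕_ }
              ; assoc = λ x y z → cong₂ _⊹_ (+-assoc (real x) (real y) (real z)) (+-assoc (imag x) (imag y) (imag z))
              }
            ; identity = (λ x → cong₂ _⊹_ (+-identityˡ (real x)) (+-identityˡ (imag x)))
                       , (λ x → cong₂ _⊹_ (+-identityʳ (real x)) (+-identityʳ (imag x)))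
            }
          ; inverse = (λ x → cong₂ _⊹_ (+-inverseˡ (real x)) (+-inverseˡ (imag x)))
                    , (λ x → cong₂ _⊹_ (+-inverseʳ (real x)) (+-inverseʳ (imag x)))
          ; ⁻¹-cong = cong ⊖_
          }
        ; comm = λ x y → cong₂ _⊹_ (+-comm (real x) (real y)) (+-comm (imag x) (imag y))
        }
      ; *-cong = cong₂ _⊗_
      ; *-assoc = ⊗-assoc
      ; *-identity = ⊗-identityˡ , λ x → trans (⊗-comm x 1ᵢ) (⊗-identityˡ x)
      ; distrib = ⊗-distribˡ-⊕
                , λ x y z → trans (⊗-comm (y ⊕ z) x) (trans (⊗-distribˡ-⊕ x y z) (cong₂ _⊕_ (⊗-comm x y) (⊗-comm x z)))
      }
    ; *-comm = ⊗-comm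
    }
  }

_≟ᵢ_ : DecidableEquality ℚ[i]
(a ⊹ b) ≟ᵢ (c ⊹ d) with a ≟ c | b ≟ d
... | yes refl | yes refl = yes refl
... | no a≢c   | _        = no λ eq → a≢c (cong real eq)
... | yes _    | no b≢d   = no λ eq → b≢d (cong imag eq)

gauss : AlmostCommutativeRing 0ℓ 0ℓ
gauss = fromCommutativeRing ⊕-⊗-commutativeRing (λ x → dec⇒maybe (0ᵢ ≟ᵢ x))

-- The operations of `ℂ` reduce under `at` to `_⊕_`, `_⊗_` and `⊖_` by computation, so an identity
-- proved by the `gauss` solver is already a proof at every stage.
at : ℂ → ℕ → ℚ[i]
at z n = seq (re z) n ⊹ seq (im z) n

infix 4 _≐_ _≋_ ∥_∥≤_

-- Equality of the approximations at every stage: ring identities transfer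
-- from ℚ[i] to ℂ along it.
record _≐_ (z w : ℂ) : Set where
  constructor stagewise
  field at-≡ : ∀ n → at z n ≡ at w n

open _≐_

-- A rational bound demanded only from some stage on takes the place of a real-valued modulus: early
-- approximations are uncontrolled, and no square root has to be constructed.
record ∥_∥≤_ (z : ℂ) (r : ℚ) : Set where
  constructor bound
  field eventually-≤ : Eventually λ n → norm z n ≤ r

open ∥_∥≤_

-- The relation _≈ℂ_, as a record so that its arguments can be inferred.
record _≋_ (z w : ℂ) : Set where
  constructor close
  field close-to : ∀ ε → 0ℚ < ε → ∥ z -ℂ w ∥≤ ε

open _≋_

≐-sym : ∀ {z w} → z ≐ w → w ≐ z
≐-sym (stagewise e) = stagewise λ n → sym (e n)

≐-trans : ∀ {z w u} → z ≐ w → w ≐ u → z ≐ u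
≐-trans (stagewise e) (stagewise f) = stagewise λ n → trans (e n) (f n)

+-≐ : ∀ {z z′ w w′} → z ≐ z′ → w ≐ w′ → z +ℂ w ≐ z′ +ℂ w′
+-≐ (stagewise e) (stagewise f) = stagewise λ n → cong₂ _⊕_ (e n) (f n)

*-≐ : ∀ {z z′ w w′} → z ≐ z′ → w ≐ w′ → z *ℂ w ≐ z′ *ℂ w′
*-≐ (stagewise e) (stagewise f) = stagewise λ n → cong₂ _⊗_ (e n) (f n)

norm-≐ : ∀ {z w} → z ≐ w → ∀ n → norm z n ≡ norm w n
norm-≐ (stagewise e) n = cong (λ g → ∣ real g ∣ + ∣ imag g ∣) (e n)

map-eventually : ∀ {P Q : ℕ → Set} → (∀ n → P n → Q n) → Eventually P → Eventually Q
map-eventually f (N , p) = N , λ n n≥ → f n (p n n≥)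

zip-eventually : ∀ {P Q R : ℕ → Set} → (∀ n → P n → Q n → R n) → Eventually P → Eventually Q → Eventually R
zip-eventually f (M , p) (N , q) = M ℕ.⊔ N , λ n n≥ → f n (p n (ℕ.m⊔n≤o⇒m≤o M N n≥)) (q n (ℕ.m⊔n≤o⇒n≤o M N n≥))

eventually-∃ : ∀ {P : ℕ → Set} → Eventually P → ∃ P
eventually-∃ (N , p) = N , p N ℕ.≤-refl

∥∥-mono : ∀ {z r s} → r ≤ s → ∥ z ∥≤ r → ∥ z ∥≤ s
∥∥-mono r≤s (bound b) = bound (map-eventually (λ _ z≤r → ≤-trans z≤r r≤s) b)

∥∥-≐ : ∀ {z w r} → z ≐ w → ∥ z ∥≤ r → ∥ w ∥≤ r
∥∥-≐ {r = r} e (bound b) = bound (map-eventually (λ n → subst (_≤ r) (norm-≐ e n)) b)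

norm-+ : ∀ z w n → norm (z +ℂ w) n ≤ norm z n + norm w n
norm-+ (x +i y) (u +i v) n = begin
  ∣ a + c ∣ + ∣ b + d ∣                   ≤⟨ +-mono-≤ (∣p+q∣≤∣p∣+∣q∣ a c) (∣p+q∣≤∣p∣+∣q∣ b d) ⟩
  (∣ a ∣ + ∣ c ∣) + (∣ b ∣ + ∣ d ∣)       ≡⟨ lemma (∣ a ∣) (∣ c ∣) (∣ b ∣) (∣ d ∣) ⟩
  (∣ a ∣ + ∣ b ∣) + (∣ c ∣ + ∣ d ∣)       ∎
  where
  open ≤-Reasoning
  a b c d : ℚ
  a = seq x n
  b = seq y n
  c = seq u n
  d = seq v n
  lemma : ∀ a c b d → (a + c) + (b + d) ≡ (a + b) + (c + d)
  lemma = solve-∀ ring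

∥∥-+ : ∀ {z w r s} → ∥ z ∥≤ r → ∥ w ∥≤ s → ∥ z +ℂ w ∥≤ r + s
∥∥-+ {z} {w} (bound b) (bound c) = bound (zip-eventually (λ n p q → ≤-trans (norm-+ z w n) (+-mono-≤ p q)) b c)

∥∥-nonneg : ∀ {z r} → ∥ z ∥≤ r → 0ℚ ≤ r
∥∥-nonneg {z} (bound b) = let n , p = eventually-∃ b in ≤-trans (norm-nonneg z n) p

∥∥-* : ∀ {z w r s} → ∥ z ∥≤ r → ∥ w ∥≤ s → ∥ z *ℂ w ∥≤ r * s
∥∥-* {z} {w} (bound b) w≤@(bound c) = bound (zip-eventually
  (λ n p q → ≤-trans (norm-* z w n) (*-mono-≤ (norm-nonneg z n) (∥∥-nonneg w≤) p q)) b c)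

∥∥-bounded : ∀ z → ∃ λ B → 0ℚ < B × ∥ z ∥≤ B
∥∥-bounded z =
  let A , 0<A , a = bounded (re z)
      B , 0<B , b = bounded (im z)
  in A + B , +-mono-< 0<A 0<B , bound (zip-eventually (λ _ → +-mono-≤) a b)

∥∥-neg : ∀ {z r} → ∥ z ∥≤ r → ∥ -ℂ z ∥≤ r
∥∥-neg {z} {r} (bound b) = bound (map-eventually
  (λ n → subst (_≤ r) (sym (cong₂ _+_ (∣-p∣≡∣p∣ (seq (re z) n)) (∣-p∣≡∣p∣ (seq (im z) n))))) b)

≤-+ˡ : ∀ {p q} → 0ℚ ≤ q → p ≤ q + p
≤-+ˡ {p} {q} 0≤q = subst (p ≤_) (+-comm p q) (≤-+ʳ 0≤q)

∣re∣≤norm : ∀ z n → ∣ seq (re z) n ∣ ≤ norm z n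
∣re∣≤norm z n = ≤-+ʳ (0≤∣p∣ (seq (im z) n))

∣im∣≤norm : ∀ z n → ∣ seq (im z) n ∣ ≤ norm z n
∣im∣≤norm z n = ≤-+ˡ (0≤∣p∣ (seq (re z) n))

≋⇒≈ : ∀ {z w} → z ≋ w → z ≈ℂ w
≋⇒≈ {z} {w} (close e) =
  (λ ε 0<ε → map-eventually (λ n → ≤-trans (∣re∣≤norm (z -ℂ w) n)) (eventually-≤ (e ε 0<ε))) ,
  (λ ε 0<ε → map-eventually (λ n → ≤-trans (∣im∣≤norm (z -ℂ w) n)) (eventually-≤ (e ε 0<ε)))

≈⇒≋ : ∀ {z w} → z ≈ℂ w → z ≋ w
≈⇒≋ {z} {w} (e , f) = close λ ε 0<ε → bound (zip-eventually
  (λ n p q → ≤-trans (+-mono-≤ {∣ seq (re z) n - seq (re w) n ∣} p q) (≤-reflexive (halves ε)))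
  (e (ε * ½) (half-pos 0<ε)) (f (ε * ½) (half-pos 0<ε)))

≐⇒≋ : ∀ {z w} → z ≐ w → z ≋ w
≐⇒≋ {z} {w} (stagewise e) = close λ ε 0<ε → bound (0 , λ n _ → subst (_≤ ε)
  (sym (cong (λ g → ∣ real g ∣ + ∣ imag g ∣) (trans (cong (λ g → g ⊕ ⊖ at w n) (e n)) (lemma (at w n))))) (<⇒≤ 0<ε))
  where
  lemma : ∀ g → g ⊕ ⊖ g ≡ 0ᵢ
  lemma = solve-∀ gauss

≋-refl : ∀ {z} → z ≋ z
≋-refl = ≐⇒≋ (stagewise λ _ → refl)

≋-sym : ∀ {z w} → z ≋ w → w ≋ z
≋-sym {z} {w} (close e) = close λ ε 0<ε → ∥∥-≐ (stagewise λ n → lemma (at z n) (at w n)) (∥∥-neg (e ε 0<ε))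
  where
  lemma : ∀ a b → ⊖ (a ⊕ ⊖ b) ≡ b ⊕ ⊖ a
  lemma = solve-∀ gauss

≋-trans : ∀ {z w u} → z ≋ w → w ≋ u → z ≋ u
≋-trans {z} {w} {u} (close e) (close f) = close λ ε 0<ε →
  ∥∥-≐ (stagewise λ n → lemma (at z n) (at w n) (at u n))
    (∥∥-mono (≤-reflexive (halves ε)) (∥∥-+ (e (ε * ½) (half-pos 0<ε)) (f (ε * ½) (half-pos 0<ε))))
  where
  lemma : ∀ a b c → (a ⊕ ⊖ b) ⊕ (b ⊕ ⊖ c) ≡ a ⊕ ⊖ c
  lemma = solve-∀ gauss

+-≋ : ∀ {z z′ w w′} → z ≋ z′ → w ≋ w′ → z +ℂ w ≋ z′ +ℂ w′
+-≋ {z} {z′} {w} {w′} (close e) (close f) = close λ ε 0<ε →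
  ∥∥-≐ (stagewise λ n → lemma (at z n) (at z′ n) (at w n) (at w′ n))
    (∥∥-mono (≤-reflexive (halves ε)) (∥∥-+ (e (ε * ½) (half-pos 0<ε)) (f (ε * ½) (half-pos 0<ε))))
  where
  lemma : ∀ a a′ b b′ → (a ⊕ ⊖ a′) ⊕ (b ⊕ ⊖ b′) ≡ (a ⊕ b) ⊕ ⊖ (a′ ⊕ b′)
  lemma = solve-∀ gauss

neg-≋ : ∀ {z w} → z ≋ w → -ℂ z ≋ -ℂ w
neg-≋ {z} {w} (close e) = close λ ε 0<ε → ∥∥-≐ (stagewise λ n → lemma (at z n) (at w n)) (∥∥-neg (e ε 0<ε))
  where
  lemma : ∀ a b → ⊖ (a ⊕ ⊖ b) ≡ ⊖ a ⊕ ⊖ ⊖ b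
  lemma = solve-∀ gauss

*-≋ˡ : ∀ z {w w′} → w ≋ w′ → z *ℂ w ≋ z *ℂ w′
*-≋ˡ z {w} {w′} (close e) = close λ ε 0<ε →
  let B , 0<B , z≤B = ∥∥-bounded z
  in ∥∥-≐ (stagewise λ n → lemma (at z n) (at w n) (at w′ n))
    (∥∥-mono (≤-reflexive (over-* ε 0<B)) (∥∥-* z≤B (e (ε over 0<B) (over-pos 0<ε 0<B))))
  where
  lemma : ∀ a b b′ → a ⊗ (b ⊕ ⊖ b′) ≡ a ⊗ b ⊕ ⊖ (a ⊗ b′)
  lemma = solve-∀ gauss

*-≋-comm : ∀ z w → z *ℂ w ≋ w *ℂ z
*-≋-comm z w = ≐⇒≋ (stagewise λ n → ⊗-comm (at z n) (at w n))

*-≋ : ∀ {z z′ w w′} → z ≋ z′ → w ≋ w′ → z *ℂ w ≋ z′ *ℂ w′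
*-≋ {z} {z′} {w} {w′} e f =
  ≋-trans (*-≋ˡ z f) (≋-trans (*-≋-comm z w′) (≋-trans (*-≋ˡ w′ e) (*-≋-comm w′ z′)))

^-≋ : ∀ {z w} → z ≋ w → ∀ k → z ^ℕ k ≋ w ^ℕ k
^-≋ e zero    = ≋-refl
^-≋ e (suc k) = *-≋ e (^-≋ e k)

≋-setoid : Setoid 0ℓ 0ℓ
≋-setoid = record { _≈_ = _≋_ ; isEquivalence = record { refl = ≋-refl ; sym = ≋-sym ; trans = ≋-trans } }

module ≋-Reasoning = SetoidReasoning ≋-setoid

≐-commutativeRing : CommutativeRing 0ℓ 0ℓ
≐-commutativeRing = record
  { Carrier = ℂ ; _≈_ = _≐_ ; _+_ = _+ℂ_ ; _*_ = _*ℂ_ ; -_ = -ℂ_ ; 0# = 0ℂ ; 1# = 1ℂ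
  ; isCommutativeRing = record
    { isRing = record
      { +-isAbelianGroup = record
        { isGroup = record
          { isMonoid = record
            { isSemigroup = record
              { isMagma = record
                { isEquivalence = record { refl = stagewise λ _ → refl ; sym = ≐-sym ; trans = ≐-trans }
                ; ∙-cong = +-≐
                }
              ; assoc = λ z w u → stagewise λ n → G.+-assoc (at z n) (at w n) (at u n)
              }
            ; identity = (λ z → stagewise λ n → G.+-identityˡ (at z n)) , (λ z → stagewise λ n → G.+-identityʳ (at z n))
            }
          ; inverse = (λ z → stagewise λ n → G.-‿inverseˡ (at z n)) , (λ z → stagewise λ n → G.-‿inverseʳ (at z n))
          ; ⁻¹-cong = λ (stagewise e) → stagewise λ n → cong ⊖_ (e n)
          }
        ; comm = λ z w → stagewise λ n → G.+-comm (at z n) (at w n)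
        }
      ; *-cong = *-≐
      ; *-assoc = λ z w u → stagewise λ n → ⊗-assoc (at z n) (at w n) (at u n)
      ; *-identity = (λ z → stagewise λ n → G.*-identityˡ (at z n)) , (λ z → stagewise λ n → G.*-identityʳ (at z n))
      ; distrib = (λ z w u → stagewise λ n → G.distribˡ (at z n) (at w n) (at u n))
                , (λ z w u → stagewise λ n → G.distribʳ (at z n) (at w n) (at u n))
      }
    ; *-comm = λ z w → stagewise λ n → ⊗-comm (at z n) (at w n)
    }
  }
  where module G = CommutativeRing ⊕-⊗-commutativeRing

-- Finite sums and absolutely convergent families

private variable
  I J : Set

-- Serves three rings: `ℂ` up to `_≐_` for partial sums, `ℚ` for majorants, `ℚ[i]` for the binomial
-- convolution. Its `foldr` unfolds to the same term as `∑[_]` and `∑ℚ`.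
module FiniteSum (R : CommutativeRing 0ℓ 0ℓ) where

  private module R = CommutativeRing R

  sum : List I → (I → R.Carrier) → R.Carrier
  sum F f = foldr (λ k s → f k R.+ s) R.0# F

  sum-cong : ∀ {f g : I → R.Carrier} → (∀ i → f i R.≈ g i) → ∀ F → sum F f R.≈ sum F g
  sum-cong e []      = R.refl
  sum-cong e (i ∷ F) = R.+-cong (e i) (sum-cong e F)

  sum-++ : ∀ (f : I → R.Carrier) F G → sum (F ++ G) f R.≈ sum F f R.+ sum G f
  sum-++ f []      G = R.sym (R.+-identityˡ (sum G f))
  sum-++ f (i ∷ F) G = R.trans (R.+-congˡ (sum-++ f F G)) (R.sym (R.+-assoc (f i) (sum F f) (sum G f)))

  sum-↭ : ∀ (f : I → R.Carrier) {F G} → F ↭ G → sum F f R.≈ sum G f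
  sum-↭ f Perm.refl        = R.refl
  sum-↭ f (prep i p)  = R.+-congˡ (sum-↭ f p)
  sum-↭ f {G = _ ∷ _ ∷ G} (swap i j p) = R.trans (R.+-congˡ (R.+-congˡ (sum-↭ f p))) (R.trans (R.sym (R.+-assoc (f i) (f j) (sum G f)))
    (R.trans (R.+-cong (R.+-comm (f i) (f j)) R.refl) (R.+-assoc (f j) (f i) (sum G f))))
  sum-↭ f (Perm.trans p q) = R.trans (sum-↭ f p) (sum-↭ f q)

  sum-map : ∀ (f : J → R.Carrier) (h : I → J) F → sum (map h F) f R.≈ sum F (λ i → f (h i))
  sum-map f h []      = R.refl
  sum-map f h (i ∷ F) = R.+-congˡ (sum-map f h F)

  sum-*ˡ : ∀ c (f : I → R.Carrier) F → sum F (λ i → c R.* f i) R.≈ c R.* sum F f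
  sum-*ˡ c f []      = R.sym (R.zeroʳ c)
  sum-*ˡ c f (i ∷ F) = R.trans (R.+-congˡ (sum-*ˡ c f F)) (R.sym (R.distribˡ c (f i) (sum F f)))

  sum-× : ∀ (f : I → R.Carrier) (g : J → R.Carrier) F G →
          sum (cartesianProduct F G) (λ (i , j) → f i R.* g j) R.≈ sum F f R.* sum G g
  sum-× f g []      G = R.sym (R.zeroˡ (sum G g))
  sum-× f g (i ∷ F) G = R.trans (sum-++ _ (map (i ,_) G) (cartesianProduct F G))
    (R.trans (R.+-cong (R.trans (sum-map _ (i ,_) G) (sum-*ˡ (f i) g G)) (sum-× f g F G))
      (R.sym (R.distribʳ (sum G g) (f i) (sum F f))))

module ∑ℂ = FiniteSum ≐-commutativeRing
module ∑ℚ = FiniteSum +-*-commutativeRing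

-- Turns the inclusion in `HasSum` into a core plus a remainder `R`, to which a tail estimate
-- applies.
⊆⇒↭ : ∀ {F₀ F : List I} → Unique F₀ → F₀ ⊆ F → ∃ λ R → F ↭ F₀ ++ R
⊆⇒↭ {F₀ = []}     {F} _         _  = F , ↭-refl
⊆⇒↭ {F₀ = i ∷ F₀} {F} (i∉ ∷ uF) F₀⊆ with ∈-∃++ (F₀⊆ (here refl))
... | ys , zs , refl = let R , p = ⊆⇒↭ uF rest in R , ↭-trans (shift i ys zs) (prep i p)
  where
  rest : F₀ ⊆ ys ++ zs
  rest j∈ with ∈-++⁻ ys (F₀⊆ (there j∈))
  ... | inj₁ j∈ys         = ∈-++⁺ˡ j∈ys
  ... | inj₂ (here refl)  = ⊥-elim (All.lookup i∉ j∈ refl)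
  ... | inj₂ (there j∈zs) = ∈-++⁺ʳ ys j∈zs

Unique-↭ : ∀ {F G : List I} → F ↭ G → Unique F → Unique G
Unique-↭ p = Permutationₛ.Unique-resp-↭ (setoid _) (↭⇒↭ₛ p)

Unique-++ʳ : ∀ (F : List I) {R} → Unique (F ++ R) → Unique R × All (_∉ F) R
Unique-++ʳ []      uR       = uR , All.tabulate λ _ ()
Unique-++ʳ (i ∷ F) (i∉ ∷ u) =
  let uR , R∉ = Unique-++ʳ F u
  in uR , All.tabulate λ { j∈ (here refl)  → All.lookup i∉ (∈-++⁺ʳ F j∈) refl
                         ; j∈ (there j∈F) → All.lookup R∉ j∈ j∈F }

∑ℚ-nonneg : ∀ {w : I → ℚ} → (∀ i → 0ℚ ≤ w i) → ∀ F → 0ℚ ≤ ∑ℚ F w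
∑ℚ-nonneg 0≤w []      = ≤-refl
∑ℚ-nonneg 0≤w (i ∷ F) = +-nonneg (0≤w i) (∑ℚ-nonneg 0≤w F)

∑ℚ-⊆ : ∀ {w : I → ℚ} → (∀ i → 0ℚ ≤ w i) → ∀ {G F} → Unique G → G ⊆ F → ∑ℚ G w ≤ ∑ℚ F w
∑ℚ-⊆ {w = w} 0≤w {G} {F} uG G⊆F = let R , p = ⊆⇒↭ uG G⊆F in begin
  ∑ℚ G w              ≤⟨ ≤-+ʳ (∑ℚ-nonneg 0≤w R) ⟩
  ∑ℚ G w + ∑ℚ R w     ≡⟨ ∑ℚ.sum-++ w G R ⟨
  ∑ℚ (G ++ R) w       ≡⟨ ∑ℚ.sum-↭ w p ⟨
  ∑ℚ F w              ∎
  where open ≤-Reasoning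

∑ℚ-filter : ∀ (w : I → ℚ) {P : I → Set} (P? : ∀ i → Dec (P i)) F →
            ∑ℚ F w ≡ ∑ℚ (filter P? F) w + ∑ℚ (filter (λ i → ¬? (P? i)) F) w
∑ℚ-filter w P? []      = refl
∑ℚ-filter w P? (i ∷ F) with P? i
... | yes _ = trans (cong (λ s → w i + s) (∑ℚ-filter w P? F)) (sym (+-assoc (w i) _ _))
... | no  _ = trans (cong (λ s → w i + s) (∑ℚ-filter w P? F)) (lemma (w i) (∑ℚ (filter P? F) w) (∑ℚ (filter (λ i → ¬? (P? i)) F) w))
  where
  lemma : ∀ a b c → a + (b + c) ≡ b + (a + c)
  lemma = solve-∀ ring

TailBelow : (I → ℚ) → List I → ℚ → Set
TailBelow w F ε = ∀ G → Unique G → All (_∉ F) G → ∑ℚ G w ≤ ε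

-- An absolutely convergent family: the rational majorant controls all sums
-- over finite sets disjoint from F.
record AbsSum (f : I → ℂ) (s : ℂ) : Set where
  field
    majorant        : I → ℚ
    majorant-nonneg : ∀ i → 0ℚ ≤ majorant i
    majorizes       : ∀ i → ∥ f i ∥≤ majorant i
    approximation   : ∀ ε → 0ℚ < ε → ∃ λ F → Unique F × TailBelow majorant F ε × ∥ ∑[ F ] f -ℂ s ∥≤ ε

  ∑-majorized : ∀ F → ∥ ∑[ F ] f ∥≤ ∑ℚ F majorant
  ∑-majorized []      = bound (0 , λ _ _ → ≤-refl)
  ∑-majorized (i ∷ F) = ∥∥-+ (majorizes i) (∑-majorized F)

  -- With `F` the approximating set for tolerance 1, any finite set is a part inside `F` and a part
  -- outside, whose total is at most 1.
  majorant-summable : DecidableEquality I → ∃ λ B → 0ℚ < B × ∀ G → Unique G → ∑ℚ G majorant ≤ B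
  majorant-summable _≟ᴵ_ with approximation 1ℚ (positive⁻¹ 1ℚ)
  ... | F , uF , tail , _ = ∑ℚ F majorant + 1ℚ , +-mono-≤-< (∑ℚ-nonneg majorant-nonneg F) (positive⁻¹ 1ℚ) , λ G uG → begin
    ∑ℚ G majorant
      ≡⟨ ∑ℚ-filter majorant (_∈? F) G ⟩
    ∑ℚ (filter (_∈? F) G) majorant + ∑ℚ (filter (λ i → ¬? (i ∈? F)) G) majorant
      ≤⟨ +-mono-≤ (∑ℚ-⊆ majorant-nonneg (Unique.filter⁺ (_∈? F) uG) (λ i∈ → proj₂ (∈-filter⁻ (_∈? F) {xs = G} i∈)))
                  (tail _ (Unique.filter⁺ (λ i → ¬? (i ∈? F)) uG)
                    (All.tabulate λ i∈ → proj₂ (∈-filter⁻ (λ i → ¬? (i ∈? F)) {xs = G} i∈))) ⟩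
    ∑ℚ F majorant + 1ℚ ∎
    where
    open ≤-Reasoning
    open DecMembership _≟ᴵ_ using (_∈?_)

square-nonneg : ∀ p → 0ℚ ≤ p * p
square-nonneg p with ≤-total 0ℚ p
... | inj₁ 0≤p = *-nonneg 0≤p 0≤p
... | inj₂ p≤0 = subst (0ℚ ≤_) (neg-square p) (*-nonneg (neg-antimono-≤ p≤0) (neg-antimono-≤ p≤0))
  where
  neg-square : ∀ p → (- p) * (- p) ≡ p * p
  neg-square = solve-∀ ring

square-∣∣ : ∀ p → p * p ≡ ∣ p ∣ * ∣ p ∣
square-∣∣ p = trans (sym (0≤p⇒∣p∣≡p (square-nonneg p))) (∣p*q∣≡∣p∣*∣q∣ p p)

norm-square : ∀ z n {r} → 0ℚ ≤ r → norm z n ≤ r → seq ∣ z ∣² n ≤ r * r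
norm-square z n {r} 0≤r z≤r = begin
  a * a + b * b                           ≡⟨ cong₂ _+_ (square-∣∣ a) (square-∣∣ b) ⟩
  A * A + B * B                           ≤⟨ ≤-+ʳ (+-nonneg (*-nonneg (0≤∣p∣ a) (0≤∣p∣ b)) (*-nonneg (0≤∣p∣ a) (0≤∣p∣ b))) ⟩
  (A * A + B * B) + (A * B + A * B)       ≡⟨ expand A B ⟩
  (A + B) * (A + B)                       ≤⟨ *-mono-≤ (norm-nonneg z n) 0≤r z≤r z≤r ⟩
  r * r                                   ∎
  where
  open ≤-Reasoning
  a b A B : ℚ
  a = seq (re z) n
  b = seq (im z) n
  A = ∣ a ∣
  B = ∣ b ∣
  expand : ∀ A B → (A * A + B * B) + (A * B + A * B) ≡ (A + B) * (A + B)
  expand = solve-∀ ring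

square-cancel : ∀ {p r} → 0ℚ ≤ r → p * p ≤ r * r → ∣ p ∣ ≤ r
square-cancel {p} {r} 0≤r pp≤rr with ∣ p ∣ ≤? r
... | yes p≤r = p≤r
... | no  p≰r = ⊥-elim (<-irrefl refl (begin-strict
  p * p           ≤⟨ pp≤rr ⟩
  r * r           ≤⟨ *-mono-≤ 0≤r (0≤∣p∣ p) ≤-refl (<⇒≤ r<p) ⟩
  r * ∣ p ∣       <⟨ *-monoˡ-<-pos ∣ p ∣ {{positive (≤-<-trans 0≤r r<p)}} r<p ⟩
  ∣ p ∣ * ∣ p ∣   ≡⟨ square-∣∣ p ⟨
  p * p           ∎))
  where
  open ≤-Reasoning
  r<p : r < ∣ p ∣
  r<p = ≰⇒> p≰r

-- `_<ℝ_` asks for a positive gap; the halved bound leaves ε² - (ε/2)², written as a sum of visibly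
-- positive products.
∥∥⇒<ℝ : ∀ {z ε} → 0ℚ < ε → ∥ z ∥≤ ε * ½ → ∣ z ∣² <ℝ ℚ⇒ℝ (ε * ε)
∥∥⇒<ℝ {z} {ε} 0<ε (bound b) = ε * ½ * (ε * ½) + ε * ½ * ε
  , +-mono-< (*-pos (half-pos 0<ε) (half-pos 0<ε)) (*-pos (half-pos 0<ε) 0<ε)
  , map-eventually (λ n z≤ → ≤-trans (+-monoˡ-≤ _ (norm-square z n (<⇒≤ (half-pos 0<ε)) z≤)) (≤-reflexive (lemma ε))) b
  where
  lemma : ∀ e → e * ½ * (e * ½) + (e * ½ * (e * ½) + e * ½ * e) ≡ e * e
  lemma = solve-∀ ring

-- The squared modulus bounds each coordinate by ε, and adding the coordinates doubles the bound.
-- This factor 2 accounts for extra halvings in later estimates.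
<ℝ⇒∥∥ : ∀ {z ε} → 0ℚ < ε → ∣ z ∣² <ℝ ℚ⇒ℝ (ε * ε) → ∥ z ∥≤ ε + ε
<ℝ⇒∥∥ {z} {ε} 0<ε (δ , 0<δ , b) = bound (map-eventually (λ n z< →
  let a = seq (re z) n
      c = seq (im z) n
      z≤ = ≤-trans (≤-+ʳ (<⇒≤ 0<δ)) z<
  in +-mono-≤ (square-cancel {a} (<⇒≤ 0<ε) (≤-trans (≤-+ʳ (square-nonneg c)) z≤))
              (square-cancel {c} (<⇒≤ 0<ε) (≤-trans (≤-+ˡ (square-nonneg a)) z≤))) b)

∑-≋ : ∀ {f g : I → ℂ} → (∀ i → f i ≋ g i) → ∀ F → ∑[ F ] f ≋ ∑[ F ] g
∑-≋ e []      = ≋-refl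
∑-≋ e (i ∷ F) = +-≋ (e i) (∑-≋ e F)

-- A finite set above `F₀` differs from it by a remainder that the majorant makes small. Replacing
-- `f` by `g` belongs here: `f i ≋ g i` bounds `g i` only by the majorant plus every positive error,
-- so `g` need not have the same majorant, while a finite sum tolerates the change.
AbsSum⇒HasSum : ∀ {f g : I → ℂ} {s} → AbsSum f s → (∀ i → f i ≋ g i) → HasSum g s
AbsSum⇒HasSum {f = f} {g} {s} S f≋g ε 0<ε =
  let open AbsSum S
      η = ε * ½ * ½
      0<η = half-pos (half-pos 0<ε)
      0<η/2 = half-pos 0<η
      F₀ , uF₀ , tail , near = approximation (η * ½) 0<η/2
  in F₀ , λ F uF F₀⊆F →
    let R , p = ⊆⇒↭ uF₀ F₀⊆F
        uR , R∉ = Unique-++ʳ F₀ (Unique-↭ p uF)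
        ∑F = ∑[ F ] f
        ∑F₀ = ∑[ F₀ ] f
        ∑R = ∑[ R ] f
        F≐ : ∑F ≐ ∑F₀ +ℂ ∑R
        F≐ = ≐-trans (∑ℂ.sum-↭ f p) (∑ℂ.sum-++ f F₀ R)
    in ∥∥⇒<ℝ {∑[ F ] g -ℂ s} 0<ε (∥∥-mono (≤-reflexive (lemma ε))
        (∥∥-≐ (stagewise λ n → trans
                (cong (λ t → at (∑[ F ] g) n ⊕ ⊖ t ⊕ (at ∑F₀ n ⊕ ⊖ at s n ⊕ at ∑R n)) (at-≡ F≐ n))
                (regroup (at (∑[ F ] g) n) (at ∑F₀ n) (at ∑R n) (at s n)))
          (∥∥-+ (close-to (∑-≋ (λ i → ≋-sym (f≋g i)) F) η 0<η) (∥∥-+ near (∥∥-mono (tail R uR R∉) (∑-majorized R))))))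
  where
  lemma : ∀ e → e * ½ * ½ + (e * ½ * ½ * ½ + e * ½ * ½ * ½) ≡ e * ½
  lemma = solve-∀ ring
  regroup : ∀ G F₀ R s → (G ⊕ ⊖ (F₀ ⊕ R)) ⊕ ((F₀ ⊕ ⊖ s) ⊕ R) ≡ G ⊕ ⊖ s
  regroup = solve-∀ gauss

-- Products, disjoint unions and reindexing of absolutely convergent families

module _ (_≟ᴵ_ : DecidableEquality I) (_≟ᴶ_ : DecidableEquality J) where

  private
    module I = DecMembership _≟ᴵ_

  -- A finite set of pairs lies in the rectangle spanned by its deduplicated projections.
  -- Nonnegative weights allow the enlargement, and over a rectangle the sum factors.
  rectangle-bound : ∀ {w : I → ℚ} {v : J → ℚ} {P : I → Set} {Q : J → Set} {α β} →
    (∀ i → 0ℚ ≤ w i) → (∀ j → 0ℚ ≤ v j) →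
    (∀ F → Unique F → All P F → ∑ℚ F w ≤ α) → (∀ G → Unique G → All Q G → ∑ℚ G v ≤ β) →
    ∀ H → Unique H → All (λ (i , j) → P i × Q j) H → ∑ℚ H (λ (i , j) → w i * v j) ≤ α * β
  rectangle-bound {w} {v} {P} {Q} {α} {β} 0≤w 0≤v w≤α v≤β H uH PQ = begin
    ∑ℚ H (λ (i , j) → w i * v j)
      ≤⟨ ∑ℚ-⊆ (λ (i , j) → *-nonneg (0≤w i) (0≤v j)) uH H⊆ ⟩
    ∑ℚ (cartesianProduct F G) (λ (i , j) → w i * v j)
      ≡⟨ ∑ℚ.sum-× w v F G ⟩
    ∑ℚ F w * ∑ℚ G v
      -- The bound on the empty list supplies `0ℚ ≤ β`.
      ≤⟨ *-mono-≤ (∑ℚ-nonneg 0≤w F) (v≤β [] [] []) (w≤α F (UniqueDec.deduplicate-! _≟ᴵ_ _) PF) (v≤β G (UniqueDec.deduplicate-! _≟ᴶ_ _) QG) ⟩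
    α * β ∎
    where
    open ≤-Reasoning
    F : List I
    F = deduplicate _≟ᴵ_ (map proj₁ H)
    G : List J
    G = deduplicate _≟ᴶ_ (map proj₂ H)
    H⊆ : H ⊆ cartesianProduct F G
    H⊆ h∈ = ∈-cartesianProduct⁺ (∈-deduplicate⁺ _≟ᴵ_ (∈-map⁺ proj₁ h∈)) (∈-deduplicate⁺ _≟ᴶ_ (∈-map⁺ proj₂ h∈))
    PF : All P F
    PF = All.tabulate λ i∈ → let h , h∈ , eq = ∈-map⁻ proj₁ (∈-deduplicate⁻ _≟ᴵ_ (map proj₁ H) i∈)
                             in subst P (sym eq) (proj₁ (All.lookup PQ h∈))
    QG : All Q G
    QG = All.tabulate λ j∈ → let h , h∈ , eq = ∈-map⁻ proj₂ (∈-deduplicate⁻ _≟ᴶ_ (map proj₂ H) j∈)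
                             in subst Q (sym eq) (proj₂ (All.lookup PQ h∈))

  -- A pair outside the rectangle F × G either has its first entry in F, and then its second outside
  -- G, or has its first entry outside F; each half of the tail is small in one factor and bounded
  -- in the other. The value follows from FG - st = F(G - t) + (F - s)t.
  AbsSum-× : ∀ {f : I → ℂ} {g : J → ℂ} {s t} → AbsSum f s → AbsSum g t → AbsSum (λ (i , j) → f i *ℂ g j) (s *ℂ t)
  AbsSum-× {f} {g} {s} {t} S T = record
    { majorant        = λ (i , j) → S.majorant i * T.majorant j
    ; majorant-nonneg = λ (i , j) → *-nonneg (S.majorant-nonneg i) (T.majorant-nonneg j)
    ; majorizes       = λ (i , j) → ∥∥-* (S.majorizes i) (T.majorizes j)
    ; approximation   = approximation
    }
    where
    module S = AbsSum S
    module T = AbsSum T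
    Bₛ Bₜ Cₜ : ℚ
    Bₛ = proj₁ (S.majorant-summable _≟ᴵ_)
    Bₜ = proj₁ (T.majorant-summable _≟ᴶ_)
    Cₜ = proj₁ (∥∥-bounded t)
    S≤ : ∀ G → Unique G → ∑ℚ G S.majorant ≤ Bₛ
    S≤ = proj₂ (proj₂ (S.majorant-summable _≟ᴵ_))
    T≤ : ∀ G → Unique G → ∑ℚ G T.majorant ≤ Bₜ
    T≤ = proj₂ (proj₂ (T.majorant-summable _≟ᴶ_))
    0<Bₛ : 0ℚ < Bₛ
    0<Bₛ = proj₁ (proj₂ (S.majorant-summable _≟ᴵ_))
    0<Bₜ : 0ℚ < Bₜ
    0<Bₜ = proj₁ (proj₂ (T.majorant-summable _≟ᴶ_))
    0<Cₜ : 0ℚ < Cₜ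
    0<Cₜ = proj₁ (proj₂ (∥∥-bounded t))
    -- The tail estimate uses `Bₛ` and `Bₜ`, the estimate of the value `Bₛ` and `Cₜ`; dividing ε by
    -- the sum of all three serves both.
    B : ℚ
    B = Bₛ + (Bₜ + Cₜ)
    0<B : 0ℚ < B
    0<B = +-mono-< 0<Bₛ (+-mono-< 0<Bₜ 0<Cₜ)

    h : I × J → ℂ
    h (i , j) = f i *ℂ g j
    w : I × J → ℚ
    w (i , j) = S.majorant i * T.majorant j

    approximation : ∀ ε → 0ℚ < ε → ∃ λ F → Unique F × TailBelow w F ε × ∥ ∑[ F ] h -ℂ s *ℂ t ∥≤ ε
    approximation ε 0<ε = cartesianProduct F G , Unique.cartesianProduct⁺ (proj₁ (proj₂ Fₛ)) (proj₁ (proj₂ Gₜ)) , tail , near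
      where
      η : ℚ
      η = ε over 0<B
      0<η : 0ℚ < η
      0<η = over-pos 0<ε 0<B
      Fₛ : ∃ λ F → Unique F × TailBelow S.majorant F η × ∥ ∑[ F ] f -ℂ s ∥≤ η
      Fₛ = S.approximation η 0<η
      Gₜ : ∃ λ G → Unique G × TailBelow T.majorant G η × ∥ ∑[ G ] g -ℂ t ∥≤ η
      Gₜ = T.approximation η 0<η
      F : List I
      F = proj₁ Fₛ
      G : List J
      G = proj₁ Gₜ
      tailₛ : TailBelow S.majorant F η
      tailₛ = proj₁ (proj₂ (proj₂ Fₛ))
      tailₜ : TailBelow T.majorant G η
      tailₜ = proj₁ (proj₂ (proj₂ Gₜ))

      inside? : ∀ (k : I × J) → Dec (proj₁ k ∈ F)
      inside? k = proj₁ k I.∈? F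

      open ≤-Reasoning

      tail : TailBelow w (cartesianProduct F G) ε
      tail H uH H∉ = begin
        ∑ℚ H w
          ≡⟨ ∑ℚ-filter w inside? H ⟩
        ∑ℚ (filter inside? H) w + ∑ℚ (filter (λ k → ¬? (inside? k)) H) w
          ≤⟨ +-mono-≤
               (rectangle-bound {P = λ _ → ⊤} {Q = _∉ G} S.majorant-nonneg T.majorant-nonneg (λ F uF _ → S≤ F uF) tailₜ
                 (filter inside? H) (Unique.filter⁺ inside? uH)
                 (All.tabulate λ k∈ → let k∈H , i∈ = ∈-filter⁻ inside? {xs = H} k∈
                   in tt , λ j∈ → All.lookup H∉ k∈H (∈-cartesianProduct⁺ i∈ j∈)))
               (rectangle-bound {P = _∉ F} {Q = λ _ → ⊤} S.majorant-nonneg T.majorant-nonneg tailₛ (λ G uG _ → T≤ G uG)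
                 (filter (λ k → ¬? (inside? k)) H) (Unique.filter⁺ (λ k → ¬? (inside? k)) uH)
                 (All.tabulate λ k∈ → proj₂ (∈-filter⁻ (λ k → ¬? (inside? k)) {xs = H} k∈) , tt)) ⟩
        Bₛ * η + η * Bₜ
          ≤⟨ ≤-+ʳ (*-nonneg (<⇒≤ 0<η) (<⇒≤ 0<Cₜ)) ⟩
        Bₛ * η + η * Bₜ + η * Cₜ
          ≡⟨ collect Bₛ Bₜ Cₜ η ⟩
        B * η
          ≡⟨ over-* ε 0<B ⟩
        ε ∎
        where
        collect : ∀ a b c η → a * η + η * b + η * c ≡ (a + (b + c)) * η
        collect = solve-∀ ring

      near : ∥ ∑[ cartesianProduct F G ] h -ℂ s *ℂ t ∥≤ ε
      near = ∥∥-≐ (stagewise λ n → trans (split (at (∑[ F ] f) n) (at (∑[ G ] g) n) (at s n) (at t n))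
                     (cong (λ p → p ⊕ ⊖ (at s n ⊗ at t n)) (sym (at-≡ (∑ℂ.sum-× f g F G) n))))
        (∥∥-mono bounds (∥∥-+
          (∥∥-* (∥∥-mono (S≤ F (proj₁ (proj₂ Fₛ))) (S.∑-majorized F)) (proj₂ (proj₂ (proj₂ Gₜ))))
          (∥∥-* (proj₂ (proj₂ (proj₂ Fₛ))) (proj₂ (proj₂ (∥∥-bounded t))))))
        where
        split : ∀ F G s t → F ⊗ (G ⊕ ⊖ t) ⊕ (F ⊕ ⊖ s) ⊗ t ≡ F ⊗ G ⊕ ⊖ (s ⊗ t)
        split = solve-∀ gauss
        collect : ∀ a b c η → a * η + η * c + η * b ≡ (a + (b + c)) * η
        collect = solve-∀ ring
        bounds : Bₛ * η + η * Cₜ ≤ ε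
        bounds = begin
          Bₛ * η + η * Cₜ             ≤⟨ ≤-+ʳ (*-nonneg (<⇒≤ 0<η) (<⇒≤ 0<Bₜ)) ⟩
          Bₛ * η + η * Cₜ + η * Bₜ    ≡⟨ collect Bₛ Bₜ Cₜ η ⟩
          B * η                       ≡⟨ over-* ε 0<B ⟩
          ε                           ∎

lefts : List (I ⊎ J) → List I
lefts []           = []
lefts (inj₁ i ∷ H) = i ∷ lefts H
lefts (inj₂ j ∷ H) = lefts H

rights : List (I ⊎ J) → List J
rights []           = []
rights (inj₁ i ∷ H) = rights H
rights (inj₂ j ∷ H) = j ∷ rights H

∈-lefts : ∀ (H : List (I ⊎ J)) {i} → i ∈ lefts H → inj₁ i ∈ H
∈-lefts (inj₁ _ ∷ H) (here refl) = here refl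
∈-lefts (inj₁ _ ∷ H) (there i∈)  = there (∈-lefts H i∈)
∈-lefts (inj₂ _ ∷ H) i∈          = there (∈-lefts H i∈)

∈-rights : ∀ (H : List (I ⊎ J)) {j} → j ∈ rights H → inj₂ j ∈ H
∈-rights (inj₂ _ ∷ H) (here refl) = here refl
∈-rights (inj₂ _ ∷ H) (there j∈)  = there (∈-rights H j∈)
∈-rights (inj₁ _ ∷ H) j∈          = there (∈-rights H j∈)

Unique-lefts : ∀ {H : List (I ⊎ J)} → Unique H → Unique (lefts H)
Unique-lefts {H = []}         []       = []
Unique-lefts {H = inj₁ i ∷ H} (i∉ ∷ u) = All.tabulate (λ j∈ → λ { refl → All.lookup i∉ (∈-lefts H j∈) refl }) ∷ Unique-lefts u
Unique-lefts {H = inj₂ _ ∷ H} (_ ∷ u)  = Unique-lefts u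

Unique-rights : ∀ {H : List (I ⊎ J)} → Unique H → Unique (rights H)
Unique-rights {H = []}         []       = []
Unique-rights {H = inj₁ _ ∷ H} (_ ∷ u)  = Unique-rights u
Unique-rights {H = inj₂ j ∷ H} (j∉ ∷ u) = All.tabulate (λ i∈ → λ { refl → All.lookup j∉ (∈-rights H i∈) refl }) ∷ Unique-rights u

∑ℚ-⊎ : ∀ (w : I → ℚ) (v : J → ℚ) H → ∑ℚ H [ w , v ]′ ≡ ∑ℚ (lefts H) w + ∑ℚ (rights H) v
∑ℚ-⊎ w v []           = refl
∑ℚ-⊎ w v (inj₁ i ∷ H) = trans (cong (λ s → w i + s) (∑ℚ-⊎ w v H)) (sym (+-assoc (w i) (∑ℚ (lefts H) w) (∑ℚ (rights H) v)))
∑ℚ-⊎ w v (inj₂ j ∷ H) = trans (cong (λ s → v j + s) (∑ℚ-⊎ w v H)) (lemma (v j) (∑ℚ (lefts H) w) (∑ℚ (rights H) v))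
  where
  lemma : ∀ a b c → a + (b + c) ≡ b + (a + c)
  lemma = solve-∀ ring

-- Used twice: to join the two halves of ℤ and to join the two parity classes of ℤ².
AbsSum-⊎ : ∀ {f : I → ℂ} {g : J → ℂ} {s t} → AbsSum f s → AbsSum g t → AbsSum [ f , g ]′ (s +ℂ t)
AbsSum-⊎ {f = f} {g} {s} {t} S T = record
  { majorant        = [ S.majorant , T.majorant ]′
  ; majorant-nonneg = λ { (inj₁ i) → S.majorant-nonneg i ; (inj₂ j) → T.majorant-nonneg j }
  ; majorizes       = λ { (inj₁ i) → S.majorizes i ; (inj₂ j) → T.majorizes j }
  ; approximation   = λ ε 0<ε →
      let F , uF , tailₛ , nearₛ = S.approximation (ε * ½) (half-pos 0<ε)
          G , uG , tailₜ , nearₜ = T.approximation (ε * ½) (half-pos 0<ε)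
      in map inj₁ F ++ map inj₂ G
       , Unique.++⁺ (Unique.map⁺ (λ { refl → refl }) uF) (Unique.map⁺ (λ { refl → refl }) uG) (disjoint F G)
       , (λ H uH H∉ → ≤-trans (≤-reflexive (∑ℚ-⊎ S.majorant T.majorant H)) (≤-trans
           (+-mono-≤ (tailₛ (lefts H) (Unique-lefts uH)
                       (All.tabulate λ i∈ i∈F → All.lookup H∉ (∈-lefts H i∈) (∈-++⁺ˡ (∈-map⁺ inj₁ i∈F))))
                     (tailₜ (rights H) (Unique-rights uH)
                       (All.tabulate λ j∈ j∈G → All.lookup H∉ (∈-rights H j∈) (∈-++⁺ʳ (map inj₁ F) (∈-map⁺ inj₂ j∈G)))))
           (≤-reflexive (halves ε))))
       , ∥∥-≐ (stagewise λ n → trans (regroup (at (∑[ F ] f) n) (at (∑[ G ] g) n) (at s n) (at t n))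
                 (cong (λ u → u ⊕ ⊖ (at s n ⊕ at t n)) (sym (at-≡ (∑-⊎ F G) n))))
           (∥∥-mono (≤-reflexive (halves ε)) (∥∥-+ nearₛ nearₜ))
  }
  where
  module S = AbsSum S
  module T = AbsSum T
  regroup : ∀ F G s t → (F ⊕ ⊖ s) ⊕ (G ⊕ ⊖ t) ≡ F ⊕ G ⊕ ⊖ (s ⊕ t)
  regroup = solve-∀ gauss
  disjoint : ∀ F G {k} → ¬ (k ∈ map inj₁ F × k ∈ map inj₂ G)
  disjoint F G (k∈F , k∈G) with ∈-map⁻ inj₁ k∈F | ∈-map⁻ inj₂ k∈G
  ... | _ , _ , refl | _ , _ , ()
  ∑-⊎ : ∀ F G → ∑[ map inj₁ F ++ map inj₂ G ] [ f , g ]′ ≐ ∑[ F ] f +ℂ ∑[ G ] g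
  ∑-⊎ F G = ≐-trans (∑ℂ.sum-++ [ f , g ]′ (map inj₁ F) (map inj₂ G))
    (+-≐ (∑ℂ.sum-map [ f , g ]′ inj₁ F) (∑ℂ.sum-map [ f , g ]′ inj₂ G))

AbsSum-reindex : ∀ {f : I → ℂ} {g : J → ℂ} {s} (φ : I → J) → (∀ {i j} → φ i ≡ φ j → i ≡ j) → (∀ j → ∃ λ i → φ i ≡ j) →
                 (∀ i → f i ≐ g (φ i)) → AbsSum f s → AbsSum g s
AbsSum-reindex {I} {J} {f} {g} {s} φ injective surjective f≐g S = record
  { majorant        = λ j → majorant (ψ j)
  ; majorant-nonneg = λ j → majorant-nonneg (ψ j)
  ; majorizes       = λ j → subst (λ k → ∥ g k ∥≤ majorant (ψ j)) (φψ j) (∥∥-≐ (f≐g (ψ j)) (majorizes (ψ j)))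
  ; approximation   = λ ε 0<ε →
      let F , uF , tail , near = approximation ε 0<ε
      in map φ F , Unique.map⁺ injective uF
       , (λ H uH H∉ → ≤-trans (≤-reflexive (sym (∑ℚ.sum-map majorant ψ H)))
           (tail (map ψ H) (Unique.map⁺ ψ-injective uH) (All.tabulate λ i∈ i∈F →
             let j , j∈ , eq = ∈-map⁻ ψ i∈
             in All.lookup H∉ j∈ (subst (_∈ map φ F) (trans (cong φ eq) (φψ j)) (∈-map⁺ φ i∈F)))))
       , ∥∥-≐ (+-≐ (≐-sym (≐-trans (∑ℂ.sum-map g φ F) (∑ℂ.sum-cong (λ i → ≐-sym (f≐g i)) F))) (stagewise λ _ → refl)) near
  }
  where
  open AbsSum S
  ψ : J → I
  ψ j = proj₁ (surjective j)
  φψ : ∀ j → φ (ψ j) ≡ j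
  φψ j = proj₂ (surjective j)
  ψ-injective : ∀ {j k} → ψ j ≡ ψ k → j ≡ k
  ψ-injective {j} {k} eq = trans (sym (φψ j)) (trans (cong φ eq) (φψ k))

AbsSum-*ˡ : ∀ c {f : I → ℂ} {s} → AbsSum f s → AbsSum (λ i → c *ℂ f i) (c *ℂ s)
AbsSum-*ˡ c {f} {s} S =
  let B , 0<B , c≤B = ∥∥-bounded c
  in record
  { majorant        = λ i → B * majorant i
  ; majorant-nonneg = λ i → *-nonneg (<⇒≤ 0<B) (majorant-nonneg i)
  ; majorizes       = λ i → ∥∥-* c≤B (majorizes i)
  ; approximation   = λ ε 0<ε →
      let F , uF , tail , near = approximation (ε over 0<B) (over-pos 0<ε 0<B)
      in F , uF
       , (λ H uH H∉ → ≤-trans (≤-reflexive (∑ℚ.sum-*ˡ B majorant H)) (≤-trans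
           (*-monoˡ-≤-nonNeg B {{nonNegative (<⇒≤ 0<B)}} (tail H uH H∉)) (≤-reflexive (over-* ε 0<B))))
       , ∥∥-≐ (stagewise λ n → trans (distrib (at c n) (at (∑[ F ] f) n) (at s n))
                 (cong (λ u → u ⊕ ⊖ (at c n ⊗ at s n)) (sym (at-≡ (∑ℂ.sum-*ˡ c f F) n))))
           (∥∥-mono (≤-reflexive (over-* ε 0<B)) (∥∥-* c≤B near))
  }
  where
  open AbsSum S
  distrib : ∀ c F s → c ⊗ (F ⊕ ⊖ s) ≡ c ⊗ F ⊕ ⊖ (c ⊗ s)
  distrib = solve-∀ gauss

module _ (c : ℕ → ℚ) (0≤c : ∀ k → 0ℚ ≤ c k) (K : ℕ) (halving : ∀ k → K ℕ.≤ k → c (suc k) + c (suc k) ≤ c k)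
         (u : ℕ → ℂ) (n₀ : ℕ) (u≤c : ∀ n → n₀ ℕ.≤ n → ∀ k → norm (u k) n ≤ c k) where

  private
    open Dominated c 0≤c K halving
    module Re = Limit (λ k → re (u k)) n₀ (λ n n≥ k → ≤-trans (∣re∣≤norm (u k) n) (u≤c n n≥ k))
    module Im = Limit (λ k → im (u k)) n₀ (λ n n≥ k → ≤-trans (∣im∣≤norm (u k) n) (u≤c n n≥ k))

  -- A ratio test: once `c` halves at each step, its tail from N on is at most 2 c(N).
  AbsSum-dominated : AbsSum u (Re.limit +i Im.limit)
  AbsSum-dominated = record
    { majorant        = c
    ; majorant-nonneg = 0≤c
    ; majorizes       = λ k → bound (n₀ , λ n n≥ → u≤c n n≥ k)
    ; approximation   = λ ε 0<ε →
        -- `limit-near` turns c(N) ≤ ε/8 into an error ε/2 for each coordinate.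
        let N , K≤N , cN≤ = small (half-pos (half-pos (half-pos 0<ε)))
        in upTo N , Unique.upTo⁺ N
         , (λ G uG G∉ → let M , <M = upper G in begin
             ∑ℚ G c                            ≤⟨ list-tail M K≤N uG (λ k∈ → ℕ.≮⇒≥ λ k<N → All.lookup G∉ k∈ (∈-upTo⁺ k<N))
                                                    (λ k∈ → ℕ.≤-trans (<M k∈) (ℕ.m≤m+n M N)) ⟩
             c N + c N                         ≤⟨ +-mono-≤ cN≤ cN≤ ⟩
             ε * ½ * ½ * ½ + ε * ½ * ½ * ½     ≤⟨ ≤-+ʳ (<⇒≤ (+-mono-< (half-pos 0<ε) (half-pos (half-pos 0<ε)))) ⟩
             ε * ½ * ½ * ½ + ε * ½ * ½ * ½ + (ε * ½ + ε * ½ * ½)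
                                               ≡⟨ collect ε ⟩
             ε                                 ∎)
         , bound (n₀ ℕ.⊔ N , λ n n≥ →
             let n≥n₀ = ℕ.m⊔n≤o⇒m≤o n₀ N n≥
                 n≥N = ℕ.m⊔n≤o⇒n≤o n₀ N n≥
             in ≤-trans (+-mono-≤
                  (subst (λ s → ∣ s - seq Re.limit n ∣ ≤ ε * ½) (sym (seq-re-∑ u (upTo N) n))
                    (Re.limit-near {ε} K≤N cN≤ (Unique.upTo⁺ N) ∈-upTo⁺ n≥n₀ n≥N))
                  (subst (λ s → ∣ s - seq Im.limit n ∣ ≤ ε * ½) (sym (seq-im-∑ u (upTo N) n))
                    (Im.limit-near {ε} K≤N cN≤ (Unique.upTo⁺ N) ∈-upTo⁺ n≥n₀ n≥N)))
                (≤-reflexive (halves ε)))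
    }
    where
    open ≤-Reasoning
    collect : ∀ e → e * ½ * ½ * ½ + e * ½ * ½ * ½ + (e * ½ + e * ½ * ½) ≡ e
    collect = solve-∀ ring

-- The index sets may differ: it is enough that beyond any given finite sets there are two with
-- equal partial sums. The Cauchy product compares triangles in ℕ × ℕ with initial segments of ℕ in
-- this way.
HasSum-unique : ∀ {f : I → ℂ} {g : J → ℂ} {s t} → HasSum f s → HasSum g t →
  (∀ F₀ G₀ → ∃₂ λ F G → Unique F × F₀ ⊆ F × Unique G × G₀ ⊆ G × ∑[ F ] f ≋ ∑[ G ] g) → s ≋ t
HasSum-unique {f = f} {g} {s} {t} S T cofinal = close λ ε 0<ε →
  let η = ε * ½ * ½ * ½
      0<η = half-pos (half-pos (half-pos 0<ε))
      F₀ , near-s = S η 0<η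
      G₀ , near-t = T η 0<η
      F , G , uF , F₀⊆ , uG , G₀⊆ , F≋G = cofinal F₀ G₀
      ∑F = ∑[ F ] f
      ∑G = ∑[ G ] g
  in ∥∥-≐ (stagewise λ n → regroup (at s n) (at t n) (at ∑F n) (at ∑G n))
       (∥∥-mono (≤-reflexive (collect ε))
         (∥∥-+ (∥∥-neg (<ℝ⇒∥∥ {∑F -ℂ s} 0<η (near-s F uF F₀⊆)))
           (∥∥-+ (<ℝ⇒∥∥ {∑G -ℂ t} 0<η (near-t G uG G₀⊆)) (close-to F≋G (ε * ½) (half-pos 0<ε)))))
  where
  collect : ∀ e → (e * ½ * ½ * ½ + e * ½ * ½ * ½) + ((e * ½ * ½ * ½ + e * ½ * ½ * ½) + e * ½) ≡ e
  collect = solve-∀ ring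
  regroup : ∀ s t F G → ⊖ (F ⊕ ⊖ s) ⊕ ((G ⊕ ⊖ t) ⊕ (F ⊕ ⊖ G)) ≡ s ⊕ ⊖ t
  regroup = solve-∀ gauss

-- The exponential function


HasSum-limit : ∀ {f : I → ℂ} {s c} → HasSum f s → (∀ F₀ → ∃ λ F → Unique F × F₀ ⊆ F × ∑[ F ] f ≋ c) → s ≋ c
HasSum-limit {f = f} {s} {c} S cofinal = close λ ε 0<ε →
  let η = ε * ½ * ½
      0<η = half-pos (half-pos 0<ε)
      F₀ , near = S η 0<η
      F , uF , F₀⊆ , F≋c = cofinal F₀
      ∑F = ∑[ F ] f
  in ∥∥-≐ (stagewise λ n → regroup (at s n) (at c n) (at ∑F n))
       (∥∥-mono (≤-reflexive (collect ε))
         (∥∥-+ (∥∥-neg (<ℝ⇒∥∥ {∑F -ℂ s} 0<η (near F uF F₀⊆))) (close-to F≋c (ε * ½) (half-pos 0<ε))))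
  where
  collect : ∀ e → (e * ½ * ½ + e * ½ * ½) + e * ½ ≡ e
  collect = solve-∀ ring
  regroup : ∀ s c F → ⊖ (F ⊕ ⊖ s) ⊕ (F ⊕ ⊖ c) ≡ s ⊕ ⊖ c
  regroup = solve-∀ gauss

⊆-upTo : ∀ F → F ⊆ upTo (proj₁ (upper F))
⊆-upTo F i∈ = ∈-upTo⁺ (proj₂ (upper F) i∈)

upTo-⊆ : ∀ {M N} → M ℕ.≤ N → upTo M ⊆ upTo N
upTo-⊆ M≤N i∈ = ∈-upTo⁺ (ℕ.<-≤-trans (∈-upTo⁻ i∈) M≤N)

HasSum-ℕ-unique : ∀ {f g : ℕ → ℂ} {s t} → (∀ k → f k ≋ g k) → HasSum f s → HasSum g t → s ≋ t
HasSum-ℕ-unique f≋g S T = HasSum-unique S T λ F₀ G₀ →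
  let M = proj₁ (upper F₀)
      N = proj₁ (upper G₀)
  in upTo (M ℕ.⊔ N) , upTo (M ℕ.⊔ N)
   , Unique.upTo⁺ _ , (λ i∈ → upTo-⊆ (ℕ.m≤m⊔n M N) (⊆-upTo F₀ i∈))
   , Unique.upTo⁺ _ , (λ i∈ → upTo-⊆ (ℕ.m≤n⊔m M N) (⊆-upTo G₀ i∈))
   , ∑-≋ f≋g (upTo (M ℕ.⊔ N))

AbsSum-≋ : ∀ {f : I → ℂ} {s t} → s ≋ t → AbsSum f s → AbsSum f t
AbsSum-≋ {f = f} {s} {t} s≋t S = record
  { majorant        = majorant
  ; majorant-nonneg = majorant-nonneg
  ; majorizes       = majorizes
  ; approximation   = λ ε 0<ε →
      let F , uF , tail , near = approximation (ε * ½) (half-pos 0<ε)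
      in F , uF
       , (λ G uG G∉ → ≤-trans (tail G uG G∉) (≤-trans (≤-+ʳ (<⇒≤ (half-pos 0<ε))) (≤-reflexive (halves ε))))
       , ∥∥-≐ (stagewise λ n → regroup (at (∑[ F ] f) n) (at s n) (at t n))
           (∥∥-mono (≤-reflexive (halves ε)) (∥∥-+ near (close-to s≋t (ε * ½) (half-pos 0<ε))))
  }
  where
  open AbsSum S
  regroup : ∀ F s t → (F ⊕ ⊖ s) ⊕ (s ⊕ ⊖ t) ≡ F ⊕ ⊖ t
  regroup = solve-∀ gauss

exp-≋ : ∀ {z w} → z ≋ w → exp z ≋ exp w
exp-≋ {z} {w} z≋w = HasSum-ℕ-unique (λ k → *-≋ˡ (ℝ⇒ℂ (ℚ⇒ℝ (invfact k))) (^-≋ z≋w k)) (Summable.sums (exp-summable z)) (Summable.sums (exp-summable w))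

-- The limit built from the majorant is not visibly `exp z`, whose value is abstract; both are sums
-- of one family, so uniqueness identifies them.
exp-AbsSum : ∀ z → AbsSum (exp-term z) (exp z)
exp-AbsSum z = AbsSum-≋ (HasSum-ℕ-unique {f = exp-term z} (λ _ → ≋-refl) (AbsSum⇒HasSum S (λ _ → ≋-refl)) (Summable.sums (exp-summable z))) S
  where
  open Exponential z using (c; 0≤c; K; halving; n₀; norm-term)
  S = AbsSum-dominated c 0≤c K halving (exp-term z) n₀ norm-term

∑-upTo-suc : ∀ (f : ℕ → ℂ) N → ∑[ upTo (suc N) ] f ≐ ∑[ upTo N ] f +ℂ f N
∑-upTo-suc f N = ≐-trans (stagewise λ n → cong (λ F → at (∑[ F ] f) n) (sym (upTo-∷ʳ N)))
  (≐-trans (∑ℂ.sum-++ f (upTo N) [ N ]) (+-≐ (stagewise λ _ → refl) (stagewise λ n → C.+-identityʳ (at (f N) n))))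
  where module C = CommutativeRing ⊕-⊗-commutativeRing

-- The functional equation of the exponential, by antidiagonals

sucˡ sucʳ : ℕ × ℕ → ℕ × ℕ
sucˡ (k , l) = suc k , l
sucʳ (k , l) = k , suc l

total : ℕ × ℕ → ℕ
total (k , l) = k ℕ.+ l

antidiagonal : ℕ → List (ℕ × ℕ)
antidiagonal zero    = [ 0 , 0 ]
antidiagonal (suc m) = (0 , suc m) ∷ map sucˡ (antidiagonal m)

-- The defining recursion splits off the pair that the weight k annihilates; this mirror image
-- splits off the pair that the weight l annihilates.
antidiagonal-∷ʳ : ∀ m → antidiagonal (suc m) ≡ map sucʳ (antidiagonal m) ++ [ suc m , 0 ]
antidiagonal-∷ʳ zero    = refl
antidiagonal-∷ʳ (suc m) = cong ((0 , suc (suc m)) ∷_) (begin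
  map sucˡ (antidiagonal (suc m))
    ≡⟨ cong (map sucˡ) (antidiagonal-∷ʳ m) ⟩
  map sucˡ (map sucʳ (antidiagonal m) ++ [ suc m , 0 ])
    ≡⟨ map-++ sucˡ (map sucʳ (antidiagonal m)) [ suc m , 0 ] ⟩
  map sucˡ (map sucʳ (antidiagonal m)) ++ [ suc (suc m) , 0 ]
    ≡⟨ cong (_++ [ suc (suc m) , 0 ]) (trans (sym (map-∘ (antidiagonal m))) (map-∘ (antidiagonal m))) ⟩
  map sucʳ (map sucˡ (antidiagonal m)) ++ [ suc (suc m) , 0 ] ∎)
  where open ≡-Reasoning

∈-antidiagonal⁻ : ∀ m {k l} → (k , l) ∈ antidiagonal m → k ℕ.+ l ≡ m
∈-antidiagonal⁻ zero    (here refl) = refl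
∈-antidiagonal⁻ (suc m) (here refl) = refl
∈-antidiagonal⁻ (suc m) (there kl∈) with ∈-map⁻ sucˡ kl∈
... | _ , k′l∈ , refl = cong suc (∈-antidiagonal⁻ m k′l∈)

∈-antidiagonal⁺ : ∀ k l → (k , l) ∈ antidiagonal (k ℕ.+ l)
∈-antidiagonal⁺ zero    zero    = here refl
∈-antidiagonal⁺ zero    (suc l) = here refl
∈-antidiagonal⁺ (suc k) l       = there (∈-map⁺ sucˡ (∈-antidiagonal⁺ k l))

Unique-antidiagonal : ∀ m → Unique (antidiagonal m)
Unique-antidiagonal zero    = [] ∷ []
Unique-antidiagonal (suc m) = All.tabulate (λ kl∈ → λ { refl → case-map kl∈ }) ∷ Unique.map⁺ (λ { refl → refl }) (Unique-antidiagonal m)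
  where
  case-map : ∀ {l} → ¬ ((0 , l) ∈ map sucˡ (antidiagonal m))
  case-map kl∈ with ∈-map⁻ sucˡ kl∈
  ... | _ , _ , ()

triangle : ℕ → List (ℕ × ℕ)
triangle zero    = []
triangle (suc N) = triangle N ++ antidiagonal N

∈-triangle⁻ : ∀ N {k l} → (k , l) ∈ triangle N → k ℕ.+ l ℕ.< N
∈-triangle⁻ (suc N) kl∈ with ∈-++⁻ (triangle N) kl∈
... | inj₁ kl∈N = ℕ.m<n⇒m<1+n (∈-triangle⁻ N kl∈N)
... | inj₂ kl∈m = ℕ.≤-reflexive (cong suc (∈-antidiagonal⁻ N kl∈m))

∈-triangle⁺ : ∀ N {k l} → k ℕ.+ l ℕ.< N → (k , l) ∈ triangle N
∈-triangle⁺ (suc N) {k} {l} k+l<N with k ℕ.+ l ℕ.≟ N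
... | yes refl = ∈-++⁺ʳ (triangle N) (∈-antidiagonal⁺ k l)
... | no  k+l≢ = ∈-++⁺ˡ (∈-triangle⁺ N (ℕ.≤∧≢⇒< (ℕ.s≤s⁻¹ k+l<N) k+l≢))

Unique-triangle : ∀ N → Unique (triangle N)
Unique-triangle zero    = []
Unique-triangle (suc N) = Unique.++⁺ (Unique-triangle N) (Unique-antidiagonal N)
  λ (∈t , ∈a) → ℕ.<-irrefl (∈-antidiagonal⁻ N ∈a) (∈-triangle⁻ N ∈t)

∑-triangle : ∀ (h : ℕ × ℕ → ℂ) (g : ℕ → ℂ) → (∀ m → ∑[ antidiagonal m ] h ≐ g m) → ∀ N → ∑[ triangle N ] h ≐ ∑[ upTo N ] g
∑-triangle h g e zero    = stagewise λ _ → refl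
∑-triangle h g e (suc N) = ≐-trans (∑ℂ.sum-++ h (triangle N) (antidiagonal N))
  (≐-trans (+-≐ (∑-triangle h g e N) (e N)) (≐-sym (∑-upTo-suc g N)))

module ∑ᵢ = FiniteSum ⊕-⊗-commutativeRing

at-∑ : ∀ (f : I → ℂ) F n → at (∑[ F ] f) n ≡ ∑ᵢ.sum F (λ k → at (f k) n)
at-∑ f []      n = refl
at-∑ f (k ∷ F) n = cong (at (f k) n ⊕_) (at-∑ f F n)

natᵢ : ℕ → ℚ[i]
natᵢ m = (+ m / 1) ⊹ 0ℚ

natᵢ-suc : ∀ m → natᵢ (suc m) ≡ natᵢ m ⊕ 1ᵢ
natᵢ-suc m = cong₂ _⊹_ (cast-suc m) refl

natᵢ-+ : ∀ k l → natᵢ (k ℕ.+ l) ≡ natᵢ k ⊕ natᵢ l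
natᵢ-+ zero    l = sym (cong₂ _⊹_ (+-identityˡ (+ l / 1)) refl)
natᵢ-+ (suc k) l = begin
  natᵢ (suc (k ℕ.+ l))        ≡⟨ natᵢ-suc (k ℕ.+ l) ⟩
  natᵢ (k ℕ.+ l) ⊕ 1ᵢ         ≡⟨ cong (_⊕ 1ᵢ) (natᵢ-+ k l) ⟩
  natᵢ k ⊕ natᵢ l ⊕ 1ᵢ        ≡⟨ lemma (natᵢ k) (natᵢ l) 1ᵢ ⟩
  natᵢ k ⊕ 1ᵢ ⊕ natᵢ l        ≡⟨ cong (_⊕ natᵢ l) (natᵢ-suc k) ⟨
  natᵢ (suc k) ⊕ natᵢ l       ∎
  where
  open ≡-Reasoning
  lemma : ∀ a b c → a ⊕ b ⊕ c ≡ a ⊕ c ⊕ b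
  lemma = solve-∀ gauss

natᵢ-cancel : ∀ m {x y} → natᵢ (suc m) ⊗ x ≡ natᵢ (suc m) ⊗ y → x ≡ y
natᵢ-cancel m {x} {y} eq = trans (sym (undo x)) (trans (cong (r ⊗_) eq) (undo y))
  where
  r : ℚ[i]
  r = (+ 1 / suc m) ⊹ 0ℚ
  lemma : ∀ a b x y → a * b ≡ 1ℚ → (a ⊹ 0ℚ) ⊗ ((b ⊹ 0ℚ) ⊗ (x ⊹ y)) ≡ x ⊹ y
  lemma a b x y ab = cong₂ _⊹_
    (trans (l₁ a b x y) (trans (cong (_* x) ab) (*-identityˡ x)))
    (trans (l₂ a b x y) (trans (cong (_* y) ab) (*-identityˡ y)))
    where
    l₁ : ∀ a b x y → a * (b * x + - (0ℚ * y)) + - (0ℚ * (b * y + 0ℚ * x)) ≡ a * b * x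
    l₁ = solve-∀ ring
    l₂ : ∀ a b x y → a * (b * y + 0ℚ * x) + 0ℚ * (b * x + - (0ℚ * y)) ≡ a * b * y
    l₂ = solve-∀ ring
  undo : ∀ x → r ⊗ (natᵢ (suc m) ⊗ x) ≡ x
  undo (x ⊹ y) = lemma (+ 1 / suc m) (+ suc m / 1) x y (/-cast 1 m)

-- The recursion (k+1) eₖ₊₁ = a eₖ characterises eₖ = aᵏ/k!; for the
-- convolution it follows by writing m+1 = k + l.
module Convolution (a b : ℚ[i]) (e f : ℕ → ℚ[i])
                   (e-suc : ∀ k → natᵢ (suc k) ⊗ e (suc k) ≡ a ⊗ e k)
                   (f-suc : ∀ l → natᵢ (suc l) ⊗ f (suc l) ≡ b ⊗ f l) where

  open ≡-Reasoning

  h : ℕ × ℕ → ℚ[i]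
  h (k , l) = e k ⊗ f l

  hˡ hʳ : ℕ × ℕ → ℚ[i]
  hˡ (k , l) = natᵢ k ⊗ h (k , l)
  hʳ (k , l) = natᵢ l ⊗ h (k , l)

  conv : ℕ → ℚ[i]
  conv m = ∑ᵢ.sum (antidiagonal m) h

  conv-first : ∀ m → ∑ᵢ.sum (antidiagonal (suc m)) hˡ ≡ a ⊗ conv m
  conv-first m = begin
    natᵢ 0 ⊗ h (0 , suc m) ⊕ ∑ᵢ.sum (map sucˡ (antidiagonal m)) hˡ
      ≡⟨ cong₂ _⊕_ (vanish (h (0 , suc m))) (∑ᵢ.sum-map hˡ sucˡ (antidiagonal m)) ⟩
    0ᵢ ⊕ ∑ᵢ.sum (antidiagonal m) (λ (k , l) → natᵢ (suc k) ⊗ h (suc k , l))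
      ≡⟨ cong (0ᵢ ⊕_) (∑ᵢ.sum-cong {f = λ kl → hˡ (sucˡ kl)} {g = λ kl → a ⊗ h kl} (λ (k , l) → begin
           natᵢ (suc k) ⊗ (e (suc k) ⊗ f l)    ≡⟨ ⊗-assoc (natᵢ (suc k)) (e (suc k)) (f l) ⟨
           natᵢ (suc k) ⊗ e (suc k) ⊗ f l      ≡⟨ cong (_⊗ f l) (e-suc k) ⟩
           a ⊗ e k ⊗ f l                       ≡⟨ ⊗-assoc a (e k) (f l) ⟩
           a ⊗ (e k ⊗ f l)                     ∎) (antidiagonal m)) ⟩
    0ᵢ ⊕ ∑ᵢ.sum (antidiagonal m) (λ kl → a ⊗ h kl)
      ≡⟨ cong (0ᵢ ⊕_) (∑ᵢ.sum-*ˡ a h (antidiagonal m)) ⟩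
    0ᵢ ⊕ a ⊗ conv m
      ≡⟨ zeroˡ (a ⊗ conv m) ⟩
    a ⊗ conv m ∎
    where
    vanish : ∀ x → 0ᵢ ⊗ x ≡ 0ᵢ
    vanish = solve-∀ gauss
    zeroˡ : ∀ x → 0ᵢ ⊕ x ≡ x
    zeroˡ = solve-∀ gauss

  conv-second : ∀ m → ∑ᵢ.sum (antidiagonal (suc m)) hʳ ≡ b ⊗ conv m
  conv-second m = begin
    ∑ᵢ.sum (antidiagonal (suc m)) hʳ
      ≡⟨ cong (λ F → ∑ᵢ.sum F hʳ) (antidiagonal-∷ʳ m) ⟩
    ∑ᵢ.sum (map sucʳ (antidiagonal m) ++ [ suc m , 0 ]) hʳ
      ≡⟨ ∑ᵢ.sum-++ hʳ (map sucʳ (antidiagonal m)) [ suc m , 0 ] ⟩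
    ∑ᵢ.sum (map sucʳ (antidiagonal m)) hʳ ⊕ (natᵢ 0 ⊗ h (suc m , 0) ⊕ 0ᵢ)
      ≡⟨ cong₂ _⊕_ (∑ᵢ.sum-map hʳ sucʳ (antidiagonal m)) (vanish (h (suc m , 0))) ⟩
    ∑ᵢ.sum (antidiagonal m) (λ (k , l) → natᵢ (suc l) ⊗ h (k , suc l)) ⊕ 0ᵢ
      ≡⟨ cong (_⊕ 0ᵢ) (∑ᵢ.sum-cong {f = λ kl → hʳ (sucʳ kl)} {g = λ kl → b ⊗ h kl} (λ (k , l) → begin
           natᵢ (suc l) ⊗ (e k ⊗ f (suc l))    ≡⟨ exchange (natᵢ (suc l)) (e k) (f (suc l)) ⟩
           e k ⊗ (natᵢ (suc l) ⊗ f (suc l))    ≡⟨ cong (e k ⊗_) (f-suc l) ⟩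
           e k ⊗ (b ⊗ f l)                     ≡⟨ exchange (e k) b (f l) ⟩
           b ⊗ (e k ⊗ f l)                     ∎) (antidiagonal m)) ⟩
    ∑ᵢ.sum (antidiagonal m) (λ kl → b ⊗ h kl) ⊕ 0ᵢ
      ≡⟨ cong (_⊕ 0ᵢ) (∑ᵢ.sum-*ˡ b h (antidiagonal m)) ⟩
    b ⊗ conv m ⊕ 0ᵢ
      ≡⟨ zeroʳ (b ⊗ conv m) ⟩
    b ⊗ conv m ∎
    where
    vanish : ∀ x → 0ᵢ ⊗ x ⊕ 0ᵢ ≡ 0ᵢ
    vanish = solve-∀ gauss
    zeroʳ : ∀ x → x ⊕ 0ᵢ ≡ x
    zeroʳ = solve-∀ gauss
    exchange : ∀ x y z → x ⊗ (y ⊗ z) ≡ y ⊗ (x ⊗ z)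
    exchange = solve-∀ gauss

  sum-⊕ : ∀ (f g : ℕ × ℕ → ℚ[i]) F → ∑ᵢ.sum F (λ x → f x ⊕ g x) ≡ ∑ᵢ.sum F f ⊕ ∑ᵢ.sum F g
  sum-⊕ f g []      = refl
  sum-⊕ f g (x ∷ F) = trans (cong (f x ⊕ g x ⊕_) (sum-⊕ f g F)) (regroup (f x) (g x) (∑ᵢ.sum F f) (∑ᵢ.sum F g))
    where
    regroup : ∀ a b c d → a ⊕ b ⊕ (c ⊕ d) ≡ a ⊕ c ⊕ (b ⊕ d)
    regroup = solve-∀ gauss

  -- Stated for any list of pairs with sum m, because the tail of an antidiagonal is no longer an
  -- antidiagonal and the induction runs over tails.
  sum-weights : ∀ {m} F → (∀ {kl} → kl ∈ F → proj₁ kl ℕ.+ proj₂ kl ≡ m) →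
                natᵢ m ⊗ ∑ᵢ.sum F h ≡ ∑ᵢ.sum F (λ kl → hˡ kl ⊕ hʳ kl)
  sum-weights {m} []            _  = annihilate (natᵢ m)
    where
    annihilate : ∀ x → x ⊗ 0ᵢ ≡ 0ᵢ
    annihilate = solve-∀ gauss
  sum-weights {m} ((k , l) ∷ F) eq = begin
    natᵢ m ⊗ (h (k , l) ⊕ ∑ᵢ.sum F h)
      ≡⟨ ⊗-distribˡ-⊕ (natᵢ m) (h (k , l)) (∑ᵢ.sum F h) ⟩
    natᵢ m ⊗ h (k , l) ⊕ natᵢ m ⊗ ∑ᵢ.sum F h
      ≡⟨ cong₂ _⊕_ (trans (cong (λ n → natᵢ n ⊗ h (k , l)) (sym (eq (here refl))))
                     (trans (cong (_⊗ h (k , l)) (natᵢ-+ k l)) (distribʳ (natᵢ k) (natᵢ l) (h (k , l)))))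
                   (sum-weights F (λ kl∈ → eq (there kl∈))) ⟩
    natᵢ k ⊗ h (k , l) ⊕ natᵢ l ⊗ h (k , l) ⊕ ∑ᵢ.sum F (λ kl → hˡ kl ⊕ hʳ kl) ∎
    where
    distribʳ : ∀ x y z → (x ⊕ y) ⊗ z ≡ x ⊗ z ⊕ y ⊗ z
    distribʳ = solve-∀ gauss

  conv-suc : ∀ m → natᵢ (suc m) ⊗ conv (suc m) ≡ (a ⊕ b) ⊗ conv m
  conv-suc m = begin
    natᵢ (suc m) ⊗ conv (suc m)
      ≡⟨ sum-weights (antidiagonal (suc m)) (∈-antidiagonal⁻ (suc m)) ⟩
    ∑ᵢ.sum (antidiagonal (suc m)) (λ kl → hˡ kl ⊕ hʳ kl)
      ≡⟨ sum-⊕ hˡ hʳ (antidiagonal (suc m)) ⟩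
    ∑ᵢ.sum (antidiagonal (suc m)) hˡ ⊕ ∑ᵢ.sum (antidiagonal (suc m)) hʳ
      ≡⟨ cong₂ _⊕_ (conv-first m) (conv-second m) ⟩
    a ⊗ conv m ⊕ b ⊗ conv m
      ≡⟨ distribʳ a b (conv m) ⟩
    (a ⊕ b) ⊗ conv m ∎
    where
    distribʳ : ∀ x y z → x ⊗ z ⊕ y ⊗ z ≡ (x ⊕ y) ⊗ z
    distribʳ = solve-∀ gauss

exp-term-suc : ∀ z n k → natᵢ (suc k) ⊗ at (exp-term z (suc k)) n ≡ at z n ⊗ at (exp-term z k) n
exp-term-suc z n k = begin
  natᵢ (suc k) ⊗ ((invfact (suc k) ⊹ 0ℚ) ⊗ (at z n ⊗ at (z ^ℕ k) n))
    ≡⟨ cong (λ r → natᵢ (suc k) ⊗ (r ⊗ (at z n ⊗ at (z ^ℕ k) n))) scalar ⟩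
  natᵢ (suc k) ⊗ ((((+ 1 / suc k) ⊹ 0ℚ) ⊗ (invfact k ⊹ 0ℚ)) ⊗ (at z n ⊗ at (z ^ℕ k) n))
    ≡⟨ regroup (natᵢ (suc k)) ((+ 1 / suc k) ⊹ 0ℚ) (invfact k ⊹ 0ℚ) (at z n) (at (z ^ℕ k) n) ⟩
  (((+ 1 / suc k) ⊹ 0ℚ) ⊗ natᵢ (suc k)) ⊗ (at z n ⊗ ((invfact k ⊹ 0ℚ) ⊗ at (z ^ℕ k) n))
    ≡⟨ cong (_⊗ (at z n ⊗ ((invfact k ⊹ 0ℚ) ⊗ at (z ^ℕ k) n)))
         (trans (real-* (+ 1 / suc k) (+ suc k / 1)) (cong (_⊹ 0ℚ) (/-cast 1 k))) ⟩
  1ᵢ ⊗ (at z n ⊗ ((invfact k ⊹ 0ℚ) ⊗ at (z ^ℕ k) n))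
    ≡⟨ ⊗-identityˡ _ ⟩
  at z n ⊗ ((invfact k ⊹ 0ℚ) ⊗ at (z ^ℕ k) n) ∎
  where
  open ≡-Reasoning
  real-* : ∀ p q → (p ⊹ 0ℚ) ⊗ (q ⊹ 0ℚ) ≡ (p * q) ⊹ 0ℚ
  real-* p q = cong₂ _⊹_ (l₁ p q) (l₂ p q)
    where
    l₁ : ∀ p q → p * q + - (0ℚ * 0ℚ) ≡ p * q
    l₁ = solve-∀ ring
    l₂ : ∀ p q → p * 0ℚ + 0ℚ * q ≡ 0ℚ
    l₂ = solve-∀ ring
  scalar : (invfact (suc k) ⊹ 0ℚ) ≡ ((+ 1 / suc k) ⊹ 0ℚ) ⊗ (invfact k ⊹ 0ℚ)
  scalar = trans (cong (_⊹ 0ℚ) (invfact-suc k)) (sym (real-* (+ 1 / suc k) (invfact k)))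
  regroup : ∀ n r f z p → n ⊗ ((r ⊗ f) ⊗ (z ⊗ p)) ≡ (r ⊗ n) ⊗ (z ⊗ (f ⊗ p))
  regroup = solve-∀ gauss

exp-product : ℂ → ℂ → ℕ × ℕ → ℂ
exp-product z w (k , l) = exp-term z k *ℂ exp-term w l

-- The binomial theorem without binomial coefficients: both sides start at 1 and obey the same
-- recursion, in which m + 1 can be cancelled.
exp-term-+ : ∀ z w m → ∑[ antidiagonal m ] (exp-product z w) ≐ exp-term (z +ℂ w) m
exp-term-+ z w m = stagewise λ n → trans (at-∑ (exp-product z w) (antidiagonal m) n) (binomial n m)
  where
  module C n = Convolution (at z n) (at w n) (λ k → at (exp-term z k) n) (λ k → at (exp-term w k) n)
                           (exp-term-suc z n) (exp-term-suc w n)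
  binomial : ∀ n m → C.conv n m ≡ at (exp-term (z +ℂ w) m) n
  binomial n zero    = refl
  binomial n (suc m) = natᵢ-cancel m (trans (C.conv-suc n m)
    (trans (cong ((at z n ⊕ at w n) ⊗_) (binomial n m)) (sym (exp-term-suc (z +ℂ w) n m))))

-- The product is an unconditional sum over ℕ × ℕ, so it may be evaluated along triangles, whose
-- partial sums are those of the series for `z +ℂ w`.
exp-+ : ∀ z w → exp (z +ℂ w) ≋ exp z *ℂ exp w
exp-+ z w = ≋-sym (HasSum-unique
  (AbsSum⇒HasSum (AbsSum-× ℕ._≟_ ℕ._≟_ (exp-AbsSum z) (exp-AbsSum w)) (λ _ → ≋-refl))
  (Summable.sums (exp-summable (z +ℂ w)))
  λ F₀ G₀ →
    let M = proj₁ (upper (map total F₀))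
        N = proj₁ (upper G₀)
    in triangle (M ℕ.⊔ N) , upTo (M ℕ.⊔ N)
     , Unique-triangle (M ℕ.⊔ N)
     , (λ kl∈ → ∈-triangle⁺ (M ℕ.⊔ N) (ℕ.<-≤-trans (proj₂ (upper (map total F₀)) (∈-map⁺ total kl∈)) (ℕ.m≤m⊔n M N)))
     , Unique.upTo⁺ _ , (λ i∈ → upTo-⊆ (ℕ.m≤n⊔m M N) (⊆-upTo G₀ i∈))
     , ≐⇒≋ (∑-triangle (exp-product z w) (exp-term (z +ℂ w)) (exp-term-+ z w) (M ℕ.⊔ N)))

exp-0 : exp 0ℂ ≋ 1ℂ
exp-0 = HasSum-limit (Summable.sums (exp-summable 0ℂ)) λ F₀ →
  let N = proj₁ (upper F₀)
  in upTo (suc N) , Unique.upTo⁺ (suc N) , (λ i∈ → upTo-⊆ (ℕ.n≤1+n N) (⊆-upTo F₀ i∈)) , ≐⇒≋ (partial-1 N)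
  where
  vanish : ∀ r p → r ⊗ (0ᵢ ⊗ p) ≡ 0ᵢ
  vanish = solve-∀ gauss
  partial-1 : ∀ N → ∑[ upTo (suc N) ] (exp-term 0ℂ) ≐ 1ℂ
  partial-1 zero    = stagewise λ _ → refl
  partial-1 (suc N) = ≐-trans (∑-upTo-suc (exp-term 0ℂ) (suc N))
    (≐-trans (+-≐ {w′ = 0ℂ} (partial-1 N) (stagewise λ n → vanish (invfact (suc N) ⊹ 0ℚ) (at (0ℂ ^ℕ N) n)))
      (stagewise λ _ → refl))

-- Conjugation and the modulus of the exponential

conj : ℂ → ℂ
conj (a +i b) = a +i (-ℝ b)

conjᵢ : ℚ[i] → ℚ[i]
conjᵢ (a ⊹ b) = a ⊹ (- b)

conjᵢ-* : ∀ x y → conjᵢ x ⊗ conjᵢ y ≡ conjᵢ (x ⊗ y)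
conjᵢ-* (a ⊹ b) (c ⊹ d) = cong₂ _⊹_ (l₁ a b c d) (l₂ a b c d)
  where
  l₁ : ∀ a b c d → a * c + - (- b * - d) ≡ a * c + - (b * d)
  l₁ = solve-∀ ring
  l₂ : ∀ a b c d → a * - d + - b * c ≡ - (a * d + b * c)
  l₂ = solve-∀ ring

exp-term-conj : ∀ z k → conj (exp-term z k) ≐ exp-term (conj z) k
exp-term-conj z k = stagewise λ n → trans (sym (conjᵢ-* (invfact k ⊹ 0ℚ) (at (z ^ℕ k) n)))
  (cong ((invfact k ⊹ 0ℚ) ⊗_) (power k n))
  where
  power : ∀ k n → conjᵢ (at (z ^ℕ k) n) ≡ at (conj z ^ℕ k) n
  power zero    n = refl
  power (suc k) n = trans (sym (conjᵢ-* (at z n) (at (z ^ℕ k) n))) (cong (at (conj z) n ⊗_) (power k n))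

-- Conjugation preserves the squared modulus at every stage, so the same finite set and the same gap
-- work.
HasSum-conj : ∀ {I : Set} {f : I → ℂ} {s} → HasSum f s → HasSum (λ i → conj (f i)) (conj s)
HasSum-conj {f = f} {s} S ε 0<ε =
  let F₀ , near = S ε 0<ε
  in F₀ , λ F uF F₀⊆ →
    let δ , 0<δ , b = near F uF F₀⊆
    in δ , 0<δ , map-eventually (λ n → subst (λ q → q + δ ≤ ε * ε) (∣conj∣² F n)) b
  where
  ∑-conj : ∀ F n → at (∑[ F ] (λ i → conj (f i)) -ℂ conj s) n ≡ conjᵢ (at (∑[ F ] f -ℂ s) n)
  ∑-conj F n = trans (cong (_⊕ ⊖ conjᵢ (at s n)) (sums F)) (difference (at (∑[ F ] f) n) (at s n))
    where
    neg-+ : ∀ a b → - a + - b ≡ - (a + b)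
    neg-+ = solve-∀ ring
    difference : ∀ x y → conjᵢ x ⊕ ⊖ conjᵢ y ≡ conjᵢ (x ⊕ ⊖ y)
    difference (a ⊹ b) (c ⊹ d) = cong₂ _⊹_ refl (neg-+ b (- d))
    sums : ∀ F → at (∑[ F ] (λ i → conj (f i))) n ≡ conjᵢ (at (∑[ F ] f) n)
    sums []      = refl
    sums (i ∷ F) = trans (cong (conjᵢ (at (f i) n) ⊕_) (sums F)) (cong₂ _⊹_ refl (neg-+ (seq (im (f i)) n) (seq (im (∑[ F ] f)) n)))
  ∣conj∣² : ∀ F n → seq ∣ ∑[ F ] f -ℂ s ∣² n ≡ seq ∣ ∑[ F ] (λ i → conj (f i)) -ℂ conj s ∣² n
  ∣conj∣² F n = trans (lemma (real u) (imag u)) (cong (λ g → real g * real g + imag g * imag g) (sym (∑-conj F n)))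
    where
    u : ℚ[i]
    u = at (∑[ F ] f -ℂ s) n
    lemma : ∀ a b → a * a + b * b ≡ a * a + - b * - b
    lemma = solve-∀ ring

exp-conj : ∀ z → exp (conj z) ≋ conj (exp z)
exp-conj z = HasSum-ℕ-unique (λ k → ≐⇒≋ (≐-sym (exp-term-conj z k)))
  (Summable.sums (exp-summable (conj z))) (HasSum-conj {f = exp-term z} {s = exp z} (Summable.sums (exp-summable z)))

-- At a stage where t ≥ 2δ all terms are nonnegative, so long partial sums are at least 1 + t ≥ 1 +
-- 2δ. One δ is then spent on the distance from the partial sum to `exp`.
exp-lower : ∀ t {δ} → 0ℚ < δ → (Eventually λ n → δ + δ ≤ seq t n) → Eventually λ n → 1ℚ + δ ≤ seq (re (exp (ℝ⇒ℂ t))) n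
exp-lower t {δ} 0<δ δ≤t =
  let F₀ , near = Summable.sums (exp-summable (ℝ⇒ℂ t)) (δ * ½) (half-pos 0<δ)
      N = proj₁ (upper F₀)
      -- The offset 2 guarantees the constant and the linear term, whatever `F₀` is.
      F = upTo (2 ℕ.+ N)
      bound e = <ℝ⇒∥∥ {∑[ F ] (exp-term (ℝ⇒ℂ t)) -ℂ exp (ℝ⇒ℂ t)} (half-pos 0<δ)
                  (near F (Unique.upTo⁺ (2 ℕ.+ N)) (λ i∈ → upTo-⊆ (ℕ.m≤n+m N 2) (⊆-upTo F₀ i∈)))
  in zip-eventually (λ n δ≤ e≤ → estimate n N δ≤ (≤-trans (∣re∣≤norm (∑[ F ] (exp-term (ℝ⇒ℂ t)) -ℂ exp (ℝ⇒ℂ t)) n) e≤)) δ≤t e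
  where
  open ≤-Reasoning
  module _ (n : ℕ) (δ≤ : δ + δ ≤ seq t n) where
    0≤t : 0ℚ ≤ seq t n
    0≤t = ≤-trans (+-nonneg (<⇒≤ 0<δ) (<⇒≤ 0<δ)) δ≤
    power-im : ∀ k → seq (im (ℝ⇒ℂ t ^ℕ k)) n ≡ 0ℚ
    power-im zero    = refl
    power-im (suc k) = trans (cong (λ p → seq t n * p + 0ℚ * seq (re (ℝ⇒ℂ t ^ℕ k)) n) (power-im k)) (lemma (seq t n) (seq (re (ℝ⇒ℂ t ^ℕ k)) n))
      where
      lemma : ∀ t r → t * 0ℚ + 0ℚ * r ≡ 0ℚ
      lemma = solve-∀ ring
    power-re : ∀ k → 0ℚ ≤ seq (re (ℝ⇒ℂ t ^ℕ k)) n
    power-re zero    = nonNegative⁻¹ 1ℚ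
    power-re (suc k) = subst (0ℚ ≤_) (lemma (seq t n) (seq (re (ℝ⇒ℂ t ^ℕ k)) n) (seq (im (ℝ⇒ℂ t ^ℕ k)) n)) (*-nonneg 0≤t (power-re k))
      where
      lemma : ∀ t r i → t * r ≡ t * r + - (0ℚ * i)
      lemma = solve-∀ ring
    term-re : ∀ k → 0ℚ ≤ seq (re (exp-term (ℝ⇒ℂ t) k)) n
    term-re k = subst (0ℚ ≤_) (lemma (invfact k) (seq (re (ℝ⇒ℂ t ^ℕ k)) n) (seq (im (ℝ⇒ℂ t ^ℕ k)) n)) (*-nonneg (invfact-nonneg k) (power-re k))
      where
      lemma : ∀ t r i → t * r ≡ t * r + - (0ℚ * i)
      lemma = solve-∀ ring
    partial-lower : ∀ N → 1ℚ + seq t n ≤ seq (re (∑[ upTo (2 ℕ.+ N) ] (exp-term (ℝ⇒ℂ t)))) n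
    partial-lower zero    = ≤-reflexive (lemma (seq t n))
      where
      lemma : ∀ t → 1ℚ + t ≡ (1ℚ * 1ℚ + - (0ℚ * 0ℚ)) + ((1ℚ * (t * 1ℚ + - (0ℚ * 0ℚ)) + - (0ℚ * (t * 0ℚ + 0ℚ * 1ℚ))) + 0ℚ)
      lemma = solve-∀ ring
    partial-lower (suc N) = begin
      1ℚ + seq t n
        ≤⟨ partial-lower N ⟩
      seq (re (∑[ upTo (2 ℕ.+ N) ] (exp-term (ℝ⇒ℂ t)))) n
        ≤⟨ ≤-+ʳ (term-re (2 ℕ.+ N)) ⟩
      seq (re (∑[ upTo (2 ℕ.+ N) ] (exp-term (ℝ⇒ℂ t)) +ℂ exp-term (ℝ⇒ℂ t) (2 ℕ.+ N))) n
        ≡⟨ cong real (at-≡ (∑-upTo-suc (exp-term (ℝ⇒ℂ t)) (2 ℕ.+ N)) n) ⟨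
      seq (re (∑[ upTo (3 ℕ.+ N) ] (exp-term (ℝ⇒ℂ t)))) n ∎
  estimate : ∀ n N → δ + δ ≤ seq t n →
    ∣ seq (re (∑[ upTo (2 ℕ.+ N) ] (exp-term (ℝ⇒ℂ t)))) n - seq (re (exp (ℝ⇒ℂ t))) n ∣ ≤ δ * ½ + δ * ½ →
    1ℚ + δ ≤ seq (re (exp (ℝ⇒ℂ t))) n
  estimate n N δ≤ near = begin
    1ℚ + δ                          ≡⟨ l₁ δ ⟩
    1ℚ + (δ + δ) - (δ * ½ + δ * ½)  ≤⟨ +-monoˡ-≤ (- (δ * ½ + δ * ½)) (≤-trans (+-monoʳ-≤ 1ℚ δ≤) (partial-lower n δ≤ N)) ⟩
    S - (δ * ½ + δ * ½)             ≤⟨ +-monoʳ-≤ S (neg-antimono-≤ (≤-trans (p≤∣p∣ (S - E)) near)) ⟩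
    S - (S - E)                     ≡⟨ l₂ S E ⟩
    E                               ∎
    where
    S E : ℚ
    S = seq (re (∑[ upTo (2 ℕ.+ N) ] (exp-term (ℝ⇒ℂ t)))) n
    E = seq (re (exp (ℝ⇒ℂ t))) n
    l₁ : ∀ d → 1ℚ + d ≡ 1ℚ + (d + d) - (d * ½ + d * ½)
    l₁ = solve-∀ ring
    l₂ : ∀ a b → a - (a - b) ≡ b
    l₂ = solve-∀ ring

-- |g|² in ℚ[i]; unlike the norm |re| + |im| it is multiplicative.
N² : ℚ[i] → ℚ
N² (a ⊹ b) = a * a + b * b

N²-* : ∀ x y → N² (x ⊗ y) ≡ N² x * N² y
N²-* (a ⊹ b) (c ⊹ d) = lemma a b c d
  where
  lemma : ∀ a b c d → (a * c + - (b * d)) * (a * c + - (b * d)) + (a * d + b * c) * (a * d + b * c) ≡ (a * a + b * b) * (c * c + d * d)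
  lemma = solve-∀ ring

N²-nonneg : ∀ x → 0ℚ ≤ N² x
N²-nonneg (a ⊹ b) = +-nonneg (square-nonneg a) (square-nonneg b)

-- |exp ζ|² exp (−2 re ζ) = exp ζ · exp ζ̄ · exp (−ζ − ζ̄) = 1, and exp (−2 re ζ) ≥ 1 + δ.
exp-decay : ∀ ζ {δ} → 0ℚ < δ → δ ≤ 1ℚ → (Eventually λ n → seq (re ζ) n ≤ - δ) →
            Eventually λ n → N² (at (exp ζ) n) ≤ (1ℚ - δ * ½ * ½ * ½) * (1ℚ - δ * ½ * ½ * ½)
exp-decay ζ {δ} 0<δ δ≤1 ζ≤ = zip-eventually estimate
  (exp-lower t 0<δ (map-eventually (λ n ζ≤ → ≤-trans (+-mono-≤ (flip ζ≤) (flip ζ≤)) (≤-reflexive (l₁ (seq (re ζ) n)))) ζ≤))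
  (eventually-≤ (close-to product η 0<η))
  where
  open ≤-Reasoning
  η : ℚ
  η = δ * ½ * ½
  0<η : 0ℚ < η
  0<η = half-pos (half-pos 0<δ)
  t : ℝ
  t = -ℝ (re ζ +ℝ re ζ)
  flip : ∀ {p} → p ≤ - δ → δ ≤ - p
  flip {p} p≤ = subst (_≤ - p) (neg-neg δ) (neg-antimono-≤ p≤)
    where
    neg-neg : ∀ p → - - p ≡ p
    neg-neg = solve-∀ ring
  l₁ : ∀ p → - p + - p ≡ - (p + p)
  l₁ = solve-∀ ring
  product : exp ζ *ℂ conj (exp ζ) *ℂ exp (ℝ⇒ℂ t) ≋ 1ℂ
  product =
    ≋-trans (*-≋ (≋-trans (*-≋ˡ (exp ζ) (≋-sym (exp-conj ζ))) (≋-sym (exp-+ ζ (conj ζ)))) ≋-refl)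
      (≋-trans (≋-sym (exp-+ (ζ +ℂ conj ζ) (ℝ⇒ℂ t))) (≋-trans (exp-≋ (≐⇒≋ (stagewise λ n → cancel (at ζ n)))) exp-0))
    where
    cancel : ∀ x → x ⊕ conjᵢ x ⊕ ((- (real x + real x)) ⊹ 0ℚ) ≡ 0ᵢ
    cancel (a ⊹ b) = cong₂ _⊹_ (c₁ a) (c₂ b)
      where
      c₁ : ∀ a → a + a + - (a + a) ≡ 0ℚ
      c₁ = solve-∀ ring
      c₂ : ∀ b → b + - b + 0ℚ ≡ 0ℚ
      c₂ = solve-∀ ring
  estimate : ∀ n → 1ℚ + δ ≤ seq (re (exp (ℝ⇒ℂ t))) n → norm (exp ζ *ℂ conj (exp ζ) *ℂ exp (ℝ⇒ℂ t) -ℂ 1ℂ) n ≤ η →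
             N² (at (exp ζ) n) ≤ (1ℚ - η * ½) * (1ℚ - η * ½)
  estimate n 1+δ≤ near = *-cancelˡ-≤-pos (1ℚ + δ) {{positive (+-mono-< (positive⁻¹ 1ℚ) 0<δ)}} (begin
    (1ℚ + δ) * M                                ≤⟨ *-monoʳ-≤-nonNeg M {{nonNegative (N²-nonneg (at (exp ζ) n))}} 1+δ≤ ⟩
    e * M                                       ≡⟨ real-part (seq (re (exp ζ)) n) (seq (im (exp ζ)) n) e (seq (im (exp (ℝ⇒ℂ t))) n) ⟩
    1ℚ + (P + - 1ℚ)                             ≤⟨ +-monoʳ-≤ 1ℚ (≤-trans (p≤∣p∣ (P + - 1ℚ)) (≤-trans (∣re∣≤norm (exp ζ *ℂ conj (exp ζ) *ℂ exp (ℝ⇒ℂ t) -ℂ 1ℂ) n) near)) ⟩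
    -- With η = δ/4, the surplus of (1 + δ)(1 - δ/8)² over 1 + δ/4 is δ/2 (1 - δ) + (1 + δ)(δ/8)² +
    -- (δ/2)²; its first summand is nonnegative by δ ≤ 1.
    1ℚ + η                                      ≤⟨ ≤-+ʳ (+-nonneg (*-nonneg (*-nonneg (<⇒≤ 0<δ) (nonNegative⁻¹ ½)) 0≤1-δ)
                                                     (*-nonneg (+-nonneg (nonNegative⁻¹ 1ℚ) (<⇒≤ 0<δ)) (square-nonneg (η * ½)))) ⟩
    1ℚ + η + (δ * ½ * (1ℚ - δ) + (1ℚ + δ) * (η * ½ * (η * ½)))
                                                ≤⟨ ≤-+ʳ (*-nonneg (*-nonneg (<⇒≤ 0<δ) (nonNegative⁻¹ ½)) (*-nonneg (<⇒≤ 0<δ) (nonNegative⁻¹ ½))) ⟩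
    1ℚ + η + (δ * ½ * (1ℚ - δ) + (1ℚ + δ) * (η * ½ * (η * ½))) + δ * ½ * (δ * ½)
                                                ≡⟨ expand δ ⟩
    (1ℚ + δ) * ((1ℚ - η * ½) * (1ℚ - η * ½))    ∎)
    where
    M e P : ℚ
    M = N² (at (exp ζ) n)
    e = seq (re (exp (ℝ⇒ℂ t))) n
    P = seq (re (exp ζ *ℂ conj (exp ζ) *ℂ exp (ℝ⇒ℂ t))) n
    0≤1-δ : 0ℚ ≤ 1ℚ - δ
    0≤1-δ = subst (_≤ 1ℚ - δ) (+-inverseʳ δ) (+-monoˡ-≤ (- δ) δ≤1)
    real-part : ∀ a b e f → e * (a * a + b * b) ≡ 1ℚ + ((a * a + - (b * - b)) * e + - ((a * - b + b * a) * f) + - 1ℚ)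
    real-part = solve-∀ ring
    expand : ∀ d → 1ℚ + d * ½ * ½ + (d * ½ * (1ℚ - d) + (1ℚ + d) * (d * ½ * ½ * ½ * (d * ½ * ½ * ½))) + d * ½ * (d * ½)
                 ≡ (1ℚ + d) * ((1ℚ - d * ½ * ½ * ½) * (1ℚ - d * ½ * ½ * ½))
    expand = solve-∀ ring

-- `leibniz 1` is 4, and by the alternating series bound all later partial sums stay within 4/3 of
-- it.
1≤π : Eventually λ n → 1ℚ ≤ seq π n
1≤π = 1 , λ n 1≤n → begin
  1ℚ                          ≤⟨ ≤ᵇ⇒≤ _ ⟩
  leibniz 1 - (+ 4 / 3)       ≤⟨ +-monoʳ-≤ (leibniz 1) (neg-antimono-≤ (≤-trans (p≤∣p∣ _)
                                   (subst (_≤ + 4 / 3) (∣-∣-swap (leibniz n) (leibniz 1)) (leibniz-near 1 n 1≤n)))) ⟩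
  leibniz 1 - (leibniz 1 - leibniz n) ≡⟨ lemma (leibniz 1) (leibniz n) ⟩
  leibniz n                   ∎
  where
  open ≤-Reasoning
  lemma : ∀ a b → a - (a - b) ≡ b
  lemma = solve-∀ ring

-- One-dimensional theta series

^-nonneg : ∀ {p} → 0ℚ ≤ p → ∀ k → 0ℚ ≤ p ^ k
^-nonneg 0≤p zero    = nonNegative⁻¹ 1ℚ
^-nonneg 0≤p (suc k) = *-nonneg 0≤p (^-nonneg 0≤p k)

-- Bernoulli's inequality for 1/σ, cleared of division. The induction rests on (1 + (k+1)x)(1 - x) =
-- 1 + kx - (k+1)x².
bernoulli : ∀ {σ x} → 0ℚ ≤ σ → 0ℚ ≤ x → σ ≤ 1ℚ - x → ∀ k → (1ℚ + (+ k / 1) * x) * σ ^ k ≤ 1ℚ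
bernoulli {σ} {x} 0≤σ 0≤x σ≤ zero    = ≤-reflexive (lemma x)
  where
  lemma : ∀ x → (1ℚ + 0ℚ * x) * 1ℚ ≡ 1ℚ
  lemma = solve-∀ ring
bernoulli {σ} {x} 0≤σ 0≤x σ≤ (suc k) = begin
  (1ℚ + (+ suc k / 1) * x) * (σ * σ ^ k)        ≡⟨ cong (λ c → (1ℚ + c * x) * (σ * σ ^ k)) (cast-suc k) ⟩
  (1ℚ + (κ + 1ℚ) * x) * (σ * σ ^ k)             ≡⟨ *-assoc (1ℚ + (κ + 1ℚ) * x) σ (σ ^ k) ⟨
  (1ℚ + (κ + 1ℚ) * x) * σ * σ ^ k               ≤⟨ *-monoʳ-≤-nonNeg (σ ^ k) {{nonNegative (^-nonneg 0≤σ k)}} step ⟩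
  (1ℚ + κ * x) * σ ^ k                          ≤⟨ bernoulli 0≤σ 0≤x σ≤ k ⟩
  1ℚ                                            ∎
  where
  open ≤-Reasoning
  κ : ℚ
  κ = + k / 1
  0≤κ : 0ℚ ≤ κ
  0≤κ = cast-mono {0} {k} ℕ.z≤n
  lemma : ∀ c x → (1ℚ + (c + 1ℚ) * x) * (1ℚ - x) + (c + 1ℚ) * (x * x) ≡ 1ℚ + c * x
  lemma = solve-∀ ring
  0≤κ+1 : 0ℚ ≤ κ + 1ℚ
  0≤κ+1 = +-nonneg 0≤κ (nonNegative⁻¹ 1ℚ)
  step : (1ℚ + (κ + 1ℚ) * x) * σ ≤ 1ℚ + κ * x
  step = begin
    (1ℚ + (κ + 1ℚ) * x) * σ
      ≤⟨ *-monoˡ-≤-nonNeg (1ℚ + (κ + 1ℚ) * x) {{nonNegative (+-nonneg (nonNegative⁻¹ 1ℚ) (*-nonneg 0≤κ+1 0≤x))}} σ≤ ⟩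
    (1ℚ + (κ + 1ℚ) * x) * (1ℚ - x)
      ≤⟨ ≤-+ʳ (*-nonneg 0≤κ+1 (*-nonneg 0≤x 0≤x)) ⟩
    (1ℚ + (κ + 1ℚ) * x) * (1ℚ - x) + (κ + 1ℚ) * (x * x)
      ≡⟨ lemma κ x ⟩
    1ℚ + κ * x ∎

N²-*-≤ : ∀ x y {c d} → N² x ≤ c * c → N² y ≤ d * d → N² (x ⊗ y) ≤ (c * d) * (c * d)
N²-*-≤ x y {c} {d} x≤c y≤d = begin
  N² (x ⊗ y)            ≡⟨ N²-* x y ⟩
  N² x * N² y           ≤⟨ *-mono-≤ (N²-nonneg x) (square-nonneg d) x≤c y≤d ⟩
  (c * c) * (d * d)     ≡⟨ lemma c d ⟩
  (c * d) * (c * d)     ∎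
  where
  open ≤-Reasoning
  lemma : ∀ c d → (c * c) * (d * d) ≡ (c * d) * (c * d)
  lemma = solve-∀ ring

N²-^-≤ : ∀ z n {c} → N² (at z n) ≤ c * c → ∀ k → N² (at (z ^ℕ k) n) ≤ c ^ k * c ^ k
N²-^-≤ z n z≤c zero    = ≤-refl
N²-^-≤ z n {c} z≤c (suc k) = N²-*-≤ (at z n) (at (z ^ℕ k) n) {c} {c ^ k} z≤c (N²-^-≤ z n z≤c k)

-- Returning to |re| + |im| costs a factor 2, paid once per term after all powers are taken; paid on
-- the base, it would be raised to the same power.
N²⇒norm : ∀ z n {c} → 0ℚ ≤ c → N² (at z n) ≤ c * c → norm z n ≤ c + c
N²⇒norm z n 0≤c z≤c = +-mono-≤
  (square-cancel {seq (re z) n} 0≤c (≤-trans (≤-+ʳ (square-nonneg (seq (im z) n))) z≤c))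
  (square-cancel {seq (im z) n} 0≤c (≤-trans (≤-+ˡ (square-nonneg (seq (re z) n))) z≤c))

-- |Q| < 1 with an explicit margin, as a bound on squares so that no root is taken.
record Contracting (Q : ℂ) : Set where
  field
    gap       : ℚ
    0<gap     : 0ℚ < gap
    gap≤1     : gap ≤ 1ℚ
    contracts : Eventually λ n → N² (at Q n) ≤ (1ℚ - gap) * (1ℚ - gap)

-- Covers the exponents k², (k+1)² and k(k+1) at once. Increments of at least k let the powers of Q
-- beat those of w, however large w is.
module _ {Q : ℂ} (contracting : Contracting Q) (w : ℂ) (a b inc : ℕ → ℕ)
         (a-suc : ∀ k → a (suc k) ≡ inc k ℕ.+ a k) (inc≥ : ∀ k → k ℕ.≤ inc k) (b-suc : ∀ k → b (suc k) ≡ suc (b k)) where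

  -- The ratio of consecutive majorants is (1 − gap)^(inc k) B, eventually below ½.
  AbsSum-gaussian : ∃ λ s → AbsSum (λ k → Q ^ℕ a k *ℂ w ^ℕ b k) s
  AbsSum-gaussian = _ , AbsSum-dominated c 0≤c K halving (λ k → Q ^ℕ a k *ℂ w ^ℕ b k)
    (proj₁ bounds) (λ n n≥ k → N²⇒norm (Q ^ℕ a k *ℂ w ^ℕ b k) n (0≤c₀ k) (N²≤ n (proj₂ bounds n n≥) k))
    where
    open Contracting contracting
    open ≤-Reasoning
    σ B : ℚ
    σ = 1ℚ - gap
    B = proj₁ (∥∥-bounded w)
    0≤σ : 0ℚ ≤ σ
    0≤σ = subst (_≤ σ) (+-inverseʳ gap) (+-monoˡ-≤ (- gap) gap≤1)
    0≤B : 0ℚ ≤ B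
    0≤B = <⇒≤ (proj₁ (proj₂ (∥∥-bounded w)))
    bounds : Eventually λ n → N² (at Q n) ≤ σ * σ × norm w n ≤ B
    bounds = zip-eventually (λ _ → _,_) contracts (eventually-≤ (proj₂ (proj₂ (∥∥-bounded w))))
    -- The doubling of `c₀` is the factor lost in `N²⇒norm`.
    c₀ c : ℕ → ℚ
    c₀ k = σ ^ a k * B ^ b k
    c k = c₀ k + c₀ k
    0≤c₀ : ∀ k → 0ℚ ≤ c₀ k
    0≤c₀ k = *-nonneg (^-nonneg 0≤σ (a k)) (^-nonneg 0≤B (b k))
    0≤c : ∀ k → 0ℚ ≤ c k
    0≤c k = +-nonneg (0≤c₀ k) (0≤c₀ k)
    N²≤ : ∀ n → N² (at Q n) ≤ σ * σ × norm w n ≤ B → ∀ k → N² (at (Q ^ℕ a k *ℂ w ^ℕ b k) n) ≤ c₀ k * c₀ k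
    N²≤ n (Q≤ , w≤) k = N²-*-≤ (at (Q ^ℕ a k) n) (at (w ^ℕ b k) n) {σ ^ a k} {B ^ b k}
      (N²-^-≤ Q n Q≤ (a k)) (N²-^-≤ w n (norm-square w n 0≤B w≤) (b k))
    -- From K ≥ 2B/gap on, `bernoulli` gives 2B σ^(inc k) ≤ 1.
    K : ℕ
    K = proj₁ (archimedean ((B + B) over 0<gap))
    c₀-suc : ∀ k → c₀ (suc k) ≡ (B * σ ^ inc k) * c₀ k
    c₀-suc k = trans (cong₂ (λ i j → σ ^ i * B ^ j) (a-suc k) (b-suc k))
      (trans (cong (_* B ^ suc (b k)) (^-homo-* σ (inc k) (a k))) (lemma (σ ^ inc k) (σ ^ a k) B (B ^ b k)))
      where
      lemma : ∀ p q r s → (p * q) * (r * s) ≡ (r * p) * (q * s)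
      lemma = solve-∀ ring
    ratio : ∀ k → K ℕ.≤ k → B * σ ^ inc k + B * σ ^ inc k ≤ 1ℚ
    ratio k K≤k = begin
      B * σ ^ inc k + B * σ ^ inc k               ≡⟨ *-distribʳ-+ (σ ^ inc k) B B ⟨
      (B + B) * σ ^ inc k                         ≡⟨ cong (_* σ ^ inc k) (over-* (B + B) 0<gap) ⟨
      gap * ((B + B) over 0<gap) * σ ^ inc k      ≤⟨ *-monoʳ-≤-nonNeg (σ ^ inc k) {{nonNegative (^-nonneg 0≤σ (inc k))}} (begin
          gap * ((B + B) over 0<gap)                ≤⟨ *-monoˡ-≤-nonNeg gap {{nonNegative (<⇒≤ 0<gap)}}
                                                         (≤-trans (proj₂ (archimedean ((B + B) over 0<gap))) (cast-mono (ℕ.≤-trans K≤k (inc≥ k)))) ⟩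
          gap * (+ inc k / 1)                       ≡⟨ *-comm gap (+ inc k / 1) ⟩
          (+ inc k / 1) * gap                       ≤⟨ ≤-+ˡ (nonNegative⁻¹ 1ℚ) ⟩
          1ℚ + (+ inc k / 1) * gap                  ∎) ⟩
      (1ℚ + (+ inc k / 1) * gap) * σ ^ inc k      ≤⟨ bernoulli 0≤σ (<⇒≤ 0<gap) ≤-refl (inc k) ⟩
      1ℚ                                          ∎
    halving : ∀ k → K ℕ.≤ k → c (suc k) + c (suc k) ≤ c k
    halving k K≤k = begin
      c (suc k) + c (suc k)                                   ≡⟨ cong (λ d → (d + d) + (d + d)) (c₀-suc k) ⟩
      (R * c₀ k + R * c₀ k) + (R * c₀ k + R * c₀ k)           ≡⟨ lemma R (c₀ k) ⟩
      (R + R) * (c₀ k + c₀ k)                                 ≤⟨ *-monoʳ-≤-nonNeg (c k) {{nonNegative (0≤c k)}} (ratio k K≤k) ⟩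
      1ℚ * c k                                                ≡⟨ *-identityˡ (c k) ⟩
      c k                                                     ∎
      where
      R : ℚ
      R = B * σ ^ inc k
      lemma : ∀ r s → (r * s + r * s) + (r * s + r * s) ≡ (r + r) * (s + s)
      lemma = solve-∀ ring

-- Integer powers of z when z′ is its inverse.
powℤ : ℂ → ℂ → ℤ → ℂ
powℤ z z′ (+ m)      = z ^ℕ m
powℤ z z′ (-[1+ m ]) = z′ ^ℕ suc m

-- The values k² and k(k+1) are natural for negative k too, so `_^ℕ_` suffices for the powers of Q.
-- The pronic numbers arise from (k + ½)² = k(k+1) + ¼.
square pronic : ℤ → ℕ
square (+ k)      = k ℕ.* k
square (-[1+ k ]) = suc k ℕ.* suc k
pronic (+ k)      = k ℕ.* suc k
pronic (-[1+ k ]) = suc k ℕ.* k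

AbsSum-ℤ : ∀ {f : ℤ → ℂ} → ∃ (AbsSum (λ k → f (+ k))) → ∃ (AbsSum (λ k → f -[1+ k ])) → ∃ (AbsSum f)
AbsSum-ℤ {f} (s , S) (t , T) = s +ℂ t , AbsSum-reindex [ +_ , -[1+_] ]′ injective surjective matches (AbsSum-⊎ S T)
  where
  injective : ∀ {i j : ℕ ⊎ ℕ} → [ +_ , -[1+_] ]′ i ≡ [ +_ , -[1+_] ]′ j → i ≡ j
  injective {inj₁ _} {inj₁ _} refl = refl
  injective {inj₂ _} {inj₂ _} refl = refl
  injective {inj₁ _} {inj₂ _} ()
  injective {inj₂ _} {inj₁ _} ()
  surjective : ∀ k → ∃ λ i → [ +_ , -[1+_] ]′ i ≡ k
  surjective (+ k)      = inj₁ k , refl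
  surjective (-[1+ k ]) = inj₂ k , refl
  matches : ∀ i → [ (λ k → f (+ k)) , (λ k → f -[1+ k ]) ]′ i ≐ f ([ +_ , -[1+_] ]′ i)
  matches (inj₁ _) = stagewise λ _ → refl
  matches (inj₂ _) = stagewise λ _ → refl

-- The general term of a Jacobi theta series in z with nome Q, where `z′` stands for 1/z.
θ : (ℤ → ℕ) → ℂ → ℂ → ℂ → ℤ → ℂ
θ a Q z z′ k = Q ^ℕ a k *ℂ powℤ z z′ k

module _ {Q : ℂ} (contracting : Contracting Q) (z z′ : ℂ) where

  θ-square : ∃ (AbsSum (θ square Q z z′))
  θ-square = AbsSum-ℤ
    (AbsSum-gaussian contracting z (λ k → k ℕ.* k) (λ k → k) (λ k → suc (k ℕ.+ k))
      ℕSolver.solve-∀ (λ k → ℕ.m≤n⇒m≤1+n (ℕ.m≤m+n k k)) (λ _ → refl))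
    (AbsSum-gaussian contracting z′ (λ k → suc k ℕ.* suc k) suc (λ k → 3 ℕ.+ (k ℕ.+ k))
      ℕSolver.solve-∀ (λ k → ℕ.m≤n⇒m≤o+n 3 (ℕ.m≤m+n k k)) (λ _ → refl))

  θ-pronic : ∃ (AbsSum (θ pronic Q z z′))
  θ-pronic = AbsSum-ℤ
    (AbsSum-gaussian contracting z (λ k → k ℕ.* suc k) (λ k → k) (λ k → 2 ℕ.+ (k ℕ.+ k))
      ℕSolver.solve-∀ (λ k → ℕ.m≤n⇒m≤o+n 2 (ℕ.m≤m+n k k)) (λ _ → refl))
    (AbsSum-gaussian contracting z′ (λ k → suc k ℕ.* k) suc (λ k → 2 ℕ.+ (k ℕ.+ k))
      ℕSolver.solve-∀ (λ k → ℕ.m≤n⇒m≤o+n 2 (ℕ.m≤m+n k k)) (λ _ → refl))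

-- Integer powers and the parity splitting of ℤ²

≡⇒≋ : ∀ {z w} → z ≡ w → z ≋ w
≡⇒≋ refl = ≋-refl

≋-cancel : ∀ z z′ {w u} → z′ *ℂ z ≋ 1ℂ → w ≋ z *ℂ u → z′ *ℂ w ≋ u
≋-cancel z z′ {w} {u} z′z e = ≋-trans (*-≋ˡ z′ e) (≋-trans (≐⇒≋ (stagewise λ n → sym (⊗-assoc (at z′ n) (at z n) (at u n))))
  (≋-trans (*-≋ z′z (≋-refl {u})) (≐⇒≋ (stagewise λ n → ⊗-identityˡ (at u n)))))

-- Once the squared modulus is at least δ, `recip` is a true inverse and the error is exactly 0.
inv-inverse : ∀ z (z≠0 : z ≠0) → z *ℂ inv z z≠0 ≋ 1ℂ
inv-inverse z (δ , 0<δ , N , δ≤) = close λ ε 0<ε → bound (N , λ n n≥ → ≤-trans (≤-reflexive (exact n n≥)) (<⇒≤ 0<ε))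
  where
  exact : ∀ n → N ℕ.≤ n → norm (z *ℂ inv z (δ , 0<δ , N , δ≤) -ℂ 1ℂ) n ≡ 0ℚ
  exact n n≥ = cong (λ g → ∣ real g ∣ + ∣ imag g ∣) {at (z *ℂ inv z (δ , 0<δ , N , δ≤) -ℂ 1ℂ) n} {0ᵢ} (cong₂ _⊹_
    (trans (re-part (seq (re z) n) (seq (im z) n) r) (cong (_- 1ℚ) (recip-inverse 0<∣z∣²)))
    (im-part (seq (re z) n) (seq (im z) n) r))
    where
    r : ℚ
    r = recip (seq ∣ z ∣² n)
    0<∣z∣² : 0ℚ < seq ∣ z ∣² n
    0<∣z∣² = <-≤-trans 0<δ (≤-trans (≤-reflexive (sym (+-identityˡ δ))) (δ≤ n n≥))
    re-part : ∀ a b r → a * (a * r) + - (b * (- b * r)) + - 1ℚ ≡ (a * a + b * b) * r - 1ℚ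
    re-part = solve-∀ ring
    im-part : ∀ a b r → a * (- b * r) + b * (a * r) + - 0ℚ ≡ 0ℚ
    im-part = solve-∀ ring

pow-powℤ : ∀ z z≠0 k → pow z z≠0 k ≡ powℤ z (inv z z≠0) k
pow-powℤ z z≠0 (+ _)      = refl
pow-powℤ z z≠0 (-[1+ _ ]) = refl

powℤ-neg : ∀ z z′ k → powℤ z z′ (ℤ.- k) ≡ powℤ z′ z k
powℤ-neg z z′ (+ zero)   = refl
powℤ-neg z z′ (+ suc _)  = refl
powℤ-neg z z′ (-[1+ _ ]) = refl

^ℕ-* : ∀ z w m → (z *ℂ w) ^ℕ m ≐ z ^ℕ m *ℂ w ^ℕ m
^ℕ-* z w zero    = stagewise λ _ → refl
^ℕ-* z w (suc m) = stagewise λ n → trans (cong (at z n ⊗ at w n ⊗_) (at-≡ (^ℕ-* z w m) n))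
    (regroup (at z n) (at w n) (at (z ^ℕ m) n) (at (w ^ℕ m) n))
  where
  regroup : ∀ z w p q → (z ⊗ w) ⊗ (p ⊗ q) ≡ (z ⊗ p) ⊗ (w ⊗ q)
  regroup = solve-∀ gauss

powℤ-* : ∀ z z′ w w′ k → powℤ (z *ℂ w) (z′ *ℂ w′) k ≐ powℤ z z′ k *ℂ powℤ w w′ k
powℤ-* z z′ w w′ (+ m)      = ^ℕ-* z w m
powℤ-* z z′ w w′ (-[1+ m ]) = ^ℕ-* z′ w′ (suc m)

module _ (z z′ : ℂ) (zz′ : z *ℂ z′ ≋ 1ℂ) where

  powℤ-suc : ∀ k → powℤ z z′ (+ 1 ℤ.+ k) ≋ z *ℂ powℤ z z′ k
  powℤ-suc (+ m)          = ≋-refl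
  powℤ-suc (-[1+ zero ])  = ≋-sym (≋-cancel z′ z zz′ ≋-refl)
  powℤ-suc (-[1+ suc m ]) = ≋-sym (≋-cancel z′ z zz′ ≋-refl)

  -- Obtained from `powℤ-suc` at the predecessor by cancelling z, so the case analysis on signs is
  -- done once.
  powℤ-pred : ∀ k → powℤ z z′ (ℤ.-1ℤ ℤ.+ k) ≋ z′ *ℂ powℤ z z′ k
  powℤ-pred k = ≋-sym (≋-cancel z z′ (≋-trans (*-≋-comm z′ z) zz′)
    (≋-trans (≡⇒≋ (cong (powℤ z z′) (shift-pred k))) (powℤ-suc (ℤ.-1ℤ ℤ.+ k))))
    where
    shift-pred : ∀ k → k ≡ + 1 ℤ.+ (ℤ.-1ℤ ℤ.+ k)
    shift-pred = ℤSolver.solve-∀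

  powℤ-+ : ∀ j k → powℤ z z′ (j ℤ.+ k) ≋ powℤ z z′ j *ℂ powℤ z z′ k
  powℤ-+ (+ zero)       k = ≋-trans (≡⇒≋ (cong (powℤ z z′) (ℤ.+-identityˡ k))) (≐⇒≋ (stagewise λ n → sym (⊗-identityˡ (at (powℤ z z′ k) n))))
  powℤ-+ (+ suc m)      k = ≋-trans (≡⇒≋ (cong (powℤ z z′) (ℤ.+-assoc (+ 1) (+ m) k)))
    (≋-trans (powℤ-suc (+ m ℤ.+ k)) (≋-trans (*-≋ˡ z (powℤ-+ (+ m) k))
      (≐⇒≋ (stagewise λ n → sym (⊗-assoc (at z n) (at (z ^ℕ m) n) (at (powℤ z z′ k) n))))))
  powℤ-+ (-[1+ zero ])  k = ≋-trans (powℤ-pred k) (*-≋ (≐⇒≋ (stagewise λ n → one (at z′ n))) ≋-refl)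
    where
    one : ∀ x → x ≡ x ⊗ 1ᵢ
    one = solve-∀ gauss
  powℤ-+ (-[1+ suc m ]) k = ≋-trans (≡⇒≋ (cong (powℤ z z′) (ℤ.+-assoc ℤ.-1ℤ -[1+ m ] k)))
    (≋-trans (powℤ-pred (-[1+ m ] ℤ.+ k)) (≋-trans (*-≋ˡ z′ (powℤ-+ (-[1+ m ]) k))
      (≐⇒≋ (stagewise λ n → sym (⊗-assoc (at z′ n) (at (z′ ^ℕ suc m) n) (at (powℤ z z′ k) n))))))

module _ (z w : ℂ) (z≠0 : z ≠0) (w≠0 : w ≠0) where

  private
    z′ w′ : ℂ
    z′ = inv z z≠0
    w′ = inv w w≠0

  -- The counterpart for monomials of diagonalising the form: k and l separate, with zw and z/w as
  -- the new variables.
  pow-diagonal : ∀ k l → pow z z≠0 (k ℤ.+ l) *ℂ pow w w≠0 (k ℤ.- l) ≋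
                         powℤ (z *ℂ w) (z′ *ℂ w′) k *ℂ powℤ (z *ℂ w′) (z′ *ℂ w) l
  pow-diagonal k l = begin
    pow z z≠0 (k ℤ.+ l) *ℂ pow w w≠0 (k ℤ.- l)
      ≈⟨ *-≋ (≋-trans (≡⇒≋ (pow-powℤ z z≠0 (k ℤ.+ l))) (powℤ-+ z z′ (inv-inverse z z≠0) k l))
             (≋-trans (≡⇒≋ (pow-powℤ w w≠0 (k ℤ.- l))) (powℤ-+ w w′ (inv-inverse w w≠0) k (ℤ.- l))) ⟩
    (powℤ z z′ k *ℂ powℤ z z′ l) *ℂ (powℤ w w′ k *ℂ powℤ w w′ (ℤ.- l))
      ≈⟨ *-≋ˡ (powℤ z z′ k *ℂ powℤ z z′ l) (*-≋ˡ (powℤ w w′ k) (≡⇒≋ (powℤ-neg w w′ l))) ⟩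
    (powℤ z z′ k *ℂ powℤ z z′ l) *ℂ (powℤ w w′ k *ℂ powℤ w′ w l)
      ≈⟨ ≐⇒≋ (stagewise λ n → regroup (at (powℤ z z′ k) n) (at (powℤ z z′ l) n) (at (powℤ w w′ k) n) (at (powℤ w′ w l) n)) ⟩
    (powℤ z z′ k *ℂ powℤ w w′ k) *ℂ (powℤ z z′ l *ℂ powℤ w′ w l)
      ≈⟨ *-≋ (≐⇒≋ (powℤ-* z z′ w w′ k)) (≐⇒≋ (powℤ-* z z′ w′ w l)) ⟨
    powℤ (z *ℂ w) (z′ *ℂ w′) k *ℂ powℤ (z *ℂ w′) (z′ *ℂ w) l ∎
    where
    open ≋-Reasoning
    regroup : ∀ a b c d → (a ⊗ b) ⊗ (c ⊗ d) ≡ (a ⊗ c) ⊗ (b ⊗ d)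
    regroup = solve-∀ gauss

-1*-1 : (-ℂ 1ℂ) *ℂ (-ℂ 1ℂ) ≐ 1ℂ
-1*-1 = stagewise λ _ → refl

sign-even : ∀ k → [-1]^ (k ℤ.+ k) ≋ 1ℂ
sign-even k = ≋-trans (≡⇒≋ (pow-powℤ (-ℂ 1ℂ) -1≠0 (k ℤ.+ k))) (≋-trans (powℤ-+ (-ℂ 1ℂ) _ (inv-inverse (-ℂ 1ℂ) -1≠0) k k) (≐⇒≋ (square-1 k)))
  where
  1^ : ∀ z → z *ℂ z ≐ 1ℂ → ∀ m → z ^ℕ m *ℂ z ^ℕ m ≐ 1ℂ
  1^ z e zero    = stagewise λ _ → refl
  1^ z e (suc m) = stagewise λ n → trans (regroup (at z n) (at (z ^ℕ m) n)) (cong₂ _⊗_ (at-≡ e n) (at-≡ (1^ z e m) n))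
    where
    regroup : ∀ z p → (z ⊗ p) ⊗ (z ⊗ p) ≡ (z ⊗ z) ⊗ (p ⊗ p)
    regroup = solve-∀ gauss
  square-1 : ∀ k → powℤ (-ℂ 1ℂ) (inv (-ℂ 1ℂ) -1≠0) k *ℂ powℤ (-ℂ 1ℂ) (inv (-ℂ 1ℂ) -1≠0) k ≐ 1ℂ
  square-1 (+ m)      = 1^ (-ℂ 1ℂ) -1*-1 m
  square-1 (-[1+ m ]) = 1^ (inv (-ℂ 1ℂ) -1≠0) (stagewise λ _ → refl) (suc m)

sign-odd : ∀ k → [-1]^ (+ 1 ℤ.+ (k ℤ.+ k)) ≋ -ℂ 1ℂ
sign-odd k = ≋-trans (≡⇒≋ (pow-powℤ (-ℂ 1ℂ) -1≠0 (+ 1 ℤ.+ (k ℤ.+ k))))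
  (≋-trans (powℤ-suc (-ℂ 1ℂ) _ (inv-inverse (-ℂ 1ℂ) -1≠0) (k ℤ.+ k))
    (≋-trans (*-≋ˡ (-ℂ 1ℂ) (≋-trans (≋-sym (≡⇒≋ (pow-powℤ (-ℂ 1ℂ) -1≠0 (k ℤ.+ k)))) (sign-even k))) (≐⇒≋ (stagewise λ _ → refl))))

/1-+ : ∀ i j → (i ℤ.+ j) / 1 ≡ i / 1 + j / 1
/1-+ i j = trans (/-≡ (i ℤ.+ j) 0 (i ℤ.* + 1 ℤ.+ j ℤ.* + 1) 0
    (cong (ℤ._* + 1) (sym (cong₂ ℤ._+_ (ℤ.*-identityʳ i) (ℤ.*-identityʳ j)))))
  (sym (fromℚᵘ-+ (ℚᵘ.mkℚᵘ i 0) (ℚᵘ.mkℚᵘ j 0)))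

/1-* : ∀ i j → (i ℤ.* j) / 1 ≡ (i / 1) * (j / 1)
/1-* i j = sym (fromℚᵘ-* (ℚᵘ.mkℚᵘ i 0) (ℚᵘ.mkℚᵘ j 0))

/1-neg : ∀ i → (ℤ.- i) / 1 ≡ - (i / 1)
/1-neg i = trans (sym (lemma (i / 1) ((ℤ.- i) / 1))) (trans (cong (λ c → c - i / 1) (trans (sym (/1-+ i (ℤ.- i))) (cong (_/ 1) (ℤ.+-inverseʳ i)))) (+-identityˡ (- (i / 1))))
  where
  lemma : ∀ a b → a + b - a ≡ b
  lemma = solve-∀ ring

/1-− : ∀ i j → (i ℤ.- j) / 1 ≡ i / 1 - j / 1
/1-− i j = trans (/1-+ i (ℤ.- j)) (cong (λ c → i / 1 + c) (/1-neg j))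

square-/1 : ∀ k → + square k / 1 ≡ (k / 1) * (k / 1)
square-/1 k = trans (cong (_/ 1) (square-ℤ k)) (/1-* k k)
  where
  square-ℤ : ∀ k → + square k ≡ k ℤ.* k
  square-ℤ (+ k)      = ℤ.pos-* k k
  square-ℤ (-[1+ k ]) = refl

pronic-/1 : ∀ k → + pronic k / 1 + (+ 1 / 4) ≡ (k / 1 + ½) * (k / 1 + ½)
pronic-/1 k = trans (cong (_+ (+ 1 / 4)) (trans (cong (_/ 1) (pronic-ℤ k)) (trans (/1-* k (+ 1 ℤ.+ k)) (cong (k / 1 *_) (/1-+ (+ 1) k))))) (lemma (k / 1))
  where
  pronic-ℤ : ∀ k → + pronic k ≡ k ℤ.* (+ 1 ℤ.+ k)
  pronic-ℤ (+ k)          = ℤ.pos-* k (suc k)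
  pronic-ℤ (-[1+ zero ])  = refl
  pronic-ℤ (-[1+ suc k ]) = refl
  lemma : ∀ k → k * (1ℚ + k) + (+ 1 / 4) ≡ (k + ½) * (k + ½)
  lemma = solve-∀ ring

double : ℤ ⊎ ℤ → ℤ
double = [ (λ l → l ℤ.+ l) , (λ l → + 1 ℤ.+ (l ℤ.+ l)) ]′

double-difference : ∀ k l → (k ℤ.- l) ℤ.+ (k ℤ.- l) ≡ (k ℤ.+ k) ℤ.- (l ℤ.+ l)
double-difference = ℤSolver.solve-∀

k+k-injective : ∀ {k l} → k ℤ.+ k ≡ l ℤ.+ l → k ≡ l
k+k-injective {k} {l} eq = ℤ.i-j≡0⇒i≡j k l (halve (k ℤ.- l) (trans (double-difference k l) (ℤ.i≡j⇒i-j≡0 eq)))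
  where
  halve : ∀ j → j ℤ.+ j ≡ + 0 → j ≡ + 0
  halve (+ zero) _ = refl

k+k≢1+l+l : ∀ k l → k ℤ.+ k ≢ + 1 ℤ.+ (l ℤ.+ l)
k+k≢1+l+l k l eq = not-half (k ℤ.- l) (trans (double-difference k l) (trans (cong (ℤ._- (l ℤ.+ l)) eq) (lemma (l ℤ.+ l))))
  where
  lemma : ∀ m → (+ 1 ℤ.+ m) ℤ.- m ≡ + 1
  lemma = ℤSolver.solve-∀
  not-half : ∀ j → j ℤ.+ j ≢ + 1
  not-half (+ suc j) eq with trans (sym (ℕ.+-suc j j)) (ℕ.suc-injective (ℤ.+-injective eq))
  ... | ()

double-injective : ∀ {s t} → double s ≡ double t → s ≡ t
double-injective {inj₁ k} {inj₁ l} eq = cong inj₁ (k+k-injective eq)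
double-injective {inj₂ k} {inj₂ l} eq = cong inj₂ (k+k-injective (ℤGroup.∙-cancelˡ (+ 1) (k ℤ.+ k) (l ℤ.+ l) eq))
double-injective {inj₁ k} {inj₂ l} eq = ⊥-elim (k+k≢1+l+l k l eq)
double-injective {inj₂ k} {inj₁ l} eq = ⊥-elim (k+k≢1+l+l l k (sym eq))

double-surjective : ∀ t → ∃ λ s → double s ≡ t
double-surjective (+ zero)       = inj₁ (+ 0) , refl
double-surjective (+ suc m)      with double-surjective (+ m)
... | inj₁ l , eq = inj₂ l , cong (ℤ._+_ (+ 1)) eq
... | inj₂ l , eq = inj₁ (+ 1 ℤ.+ l) , trans (lemma l) (cong (ℤ._+_ (+ 1)) eq)
  where
  lemma : ∀ l → (+ 1 ℤ.+ l) ℤ.+ (+ 1 ℤ.+ l) ≡ + 1 ℤ.+ (+ 1 ℤ.+ (l ℤ.+ l))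
  lemma = ℤSolver.solve-∀
double-surjective (-[1+ zero ])  = inj₂ -[1+ 0 ] , refl
double-surjective (-[1+ suc m ]) with double-surjective (-[1+ m ])
... | inj₁ l , eq = inj₂ (ℤ.-1ℤ ℤ.+ l) , trans (lemma l) (cong (ℤ._+_ ℤ.-1ℤ) eq)
  where
  lemma : ∀ l → + 1 ℤ.+ ((ℤ.-1ℤ ℤ.+ l) ℤ.+ (ℤ.-1ℤ ℤ.+ l)) ≡ ℤ.-1ℤ ℤ.+ (l ℤ.+ l)
  lemma = ℤSolver.solve-∀
... | inj₂ l , eq = inj₁ l , trans (lemma (l ℤ.+ l)) (cong (ℤ._+_ ℤ.-1ℤ) eq)
  where
  lemma : ∀ m → m ≡ ℤ.-1ℤ ℤ.+ (+ 1 ℤ.+ m)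
  lemma = ℤSolver.solve-∀

-- Rational powers of q

_q^_ : ℂ → ℚ → ℂ
τ q^ r = qPow τ (ℚ⇒ℝ r)

module _ (τ : ℂ) where

  q^-+ : ∀ r s → τ q^ (r + s) ≋ (τ q^ r) *ℂ (τ q^ s)
  q^-+ r s = ≋-trans (exp-≋ (≐⇒≋ (stagewise λ n → trans (cong (_⊗ at (i *ℂ τ) n) (split (seq π n)))
      (distribʳ ((seq π n * r) ⊹ 0ℚ) ((seq π n * s) ⊹ 0ℚ) (at (i *ℂ τ) n)))))
    (exp-+ (ℝ⇒ℂ (π *ℝ ℚ⇒ℝ r) *ℂ (i *ℂ τ)) (ℝ⇒ℂ (π *ℝ ℚ⇒ℝ s) *ℂ (i *ℂ τ)))
    where
    split : ∀ p → (p * (r + s)) ⊹ 0ℚ ≡ ((p * r) ⊹ 0ℚ) ⊕ ((p * s) ⊹ 0ℚ)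
    split p = cong (_⊹ 0ℚ) (*-distribˡ-+ p r s)
    distribʳ : ∀ x y z → (x ⊕ y) ⊗ z ≡ x ⊗ z ⊕ y ⊗ z
    distribʳ = solve-∀ gauss

  q^-0 : τ q^ 0ℚ ≋ 1ℂ
  q^-0 = ≋-trans (exp-≋ (≐⇒≋ (stagewise λ n → trans (cong (λ p → (p ⊹ 0ℚ) ⊗ at (i *ℂ τ) n) (*-zeroʳ (seq π n))) (zeroˡ (at (i *ℂ τ) n))))) exp-0
    where
    zeroˡ : ∀ x → 0ᵢ ⊗ x ≡ 0ᵢ
    zeroˡ = solve-∀ gauss

  q^-^ : ∀ r m → τ q^ ((+ m / 1) * r) ≋ (τ q^ r) ^ℕ m
  q^-^ r zero    = ≋-trans (≡⇒≋ (cong (τ q^_) (*-zeroˡ r))) q^-0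
  q^-^ r (suc m) = ≋-trans (≡⇒≋ (cong (τ q^_) (trans (cong (_* r) (cast-suc m)) (lemma (+ m / 1) r))))
    (≋-trans (q^-+ r ((+ m / 1) * r)) (*-≋ˡ (τ q^ r) (q^-^ r m)))
    where
    lemma : ∀ m r → (m + 1ℚ) * r ≡ r + m * r
    lemma = solve-∀ ring

  q^-square : ∀ r k → τ q^ (r * ((k / 1) * (k / 1))) ≋ (τ q^ r) ^ℕ square k
  q^-square r k = ≋-trans (≡⇒≋ (cong (τ q^_) (trans (cong (r *_) (sym (square-/1 k))) (*-comm r (+ square k / 1))))) (q^-^ r (square k))

  -- The quarter in (k + ½)² becomes a constant factor outside the series, and what remains is a
  -- natural power of a contracting base.
  q^-pronic : ∀ r k → τ q^ (r * ((k / 1 + ½) * (k / 1 + ½))) ≋ (τ q^ (r * (+ 1 / 4))) *ℂ (τ q^ r) ^ℕ pronic k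
  q^-pronic r k = ≋-trans (≡⇒≋ (cong (τ q^_) (trans (cong (r *_) (sym (pronic-/1 k))) (lemma r (+ pronic k / 1) (+ 1 / 4)))))
    (≋-trans (q^-+ (r * (+ 1 / 4)) ((+ pronic k / 1) * r)) (*-≋ˡ (τ q^ (r * (+ 1 / 4))) (q^-^ r (pronic k))))
    where
    lemma : ∀ r k c → r * (k + c) ≡ r * c + k * r
    lemma = solve-∀ ring

  q^-contracting : 0ℝ <ℝ im τ → ∀ {r} → 0ℚ < r → Contracting (τ q^ r)
  q^-contracting (δ , 0<δ , δ≤τ) {r} 0<r = record
    { gap       = ε * ½ * ½ * ½
    ; 0<gap     = half-pos (half-pos (half-pos 0<ε))
    ; gap≤1     = ≤-trans (half≤ (<⇒≤ (half-pos (half-pos 0<ε)))) (≤-trans (half≤ (<⇒≤ (half-pos 0<ε)))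
                    (≤-trans (half≤ (<⇒≤ 0<ε)) (p⊓q≤q (r * δ) 1ℚ)))
    ; contracts = exp-decay (ℝ⇒ℂ (π *ℝ ℚ⇒ℝ r) *ℂ (i *ℂ τ)) 0<ε (p⊓q≤q (r * δ) 1ℚ) (zip-eventually below 1≤π δ≤τ)
    }
    where
    open ≤-Reasoning
    -- The real part of πirτ is -πr im τ ≤ -rδ because π ≥ 1; the minimum with 1 meets the condition
    -- δ ≤ 1 of `exp-decay`.
    ε : ℚ
    ε = (r * δ) ⊓ 1ℚ
    0<ε : 0ℚ < ε
    0<ε = ⊓-glb-< (*-pos 0<r 0<δ) (positive⁻¹ 1ℚ)
      where
      ⊓-glb-< : ∀ {p q} → 0ℚ < p → 0ℚ < q → 0ℚ < p ⊓ q
      ⊓-glb-< {p} {q} 0<p 0<q with ≤-total p q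
      ... | inj₁ p≤q = subst (0ℚ <_) (sym (p≤q⇒p⊓q≡p p≤q)) 0<p
      ... | inj₂ q≤p = subst (0ℚ <_) (sym (p≥q⇒p⊓q≡q q≤p)) 0<q
    half≤ : ∀ {p} → 0ℚ ≤ p → p * ½ ≤ p
    half≤ {p} 0≤p = ≤-trans (≤-+ʳ (*-nonneg 0≤p (nonNegative⁻¹ ½))) (≤-reflexive (halves p))
    below : ∀ n → 1ℚ ≤ seq π n → 0ℚ + δ ≤ seq (im τ) n → seq (re (ℝ⇒ℂ (π *ℝ ℚ⇒ℝ r) *ℂ (i *ℂ τ))) n ≤ - ε
    below n 1≤π δ≤τ = begin
      seq (re (ℝ⇒ℂ (π *ℝ ℚ⇒ℝ r) *ℂ (i *ℂ τ))) n     ≡⟨ lemma (seq π n) r (seq (re τ) n) (seq (im τ) n) ⟩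
      - (seq π n * (r * seq (im τ) n))              ≤⟨ neg-antimono-≤ (*-mono-≤ (nonNegative⁻¹ 1ℚ) 0≤rτ 1≤π (*-monoˡ-≤-nonNeg r {{nonNegative (<⇒≤ 0<r)}} δ≤τ)) ⟩
      - (1ℚ * (r * (0ℚ + δ)))                       ≡⟨ cong -_ (trans (*-identityˡ (r * (0ℚ + δ))) (cong (r *_) (+-identityˡ δ))) ⟩
      - (r * δ)                                     ≤⟨ neg-antimono-≤ (p⊓q≤p (r * δ) 1ℚ) ⟩
      - ε                                           ∎
      where
      0≤rτ : 0ℚ ≤ r * seq (im τ) n
      0≤rτ = *-nonneg (<⇒≤ 0<r) (≤-trans (+-nonneg ≤-refl (<⇒≤ 0<δ)) δ≤τ)
      lemma : ∀ p r a b → (p * r) * (0ℚ * a + - (1ℚ * b)) + - (0ℚ * (0ℚ * b + 1ℚ * a)) ≡ - (p * (r * b))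
      lemma = solve-∀ ring

-- ℤ² splits into the pairs whose difference is even and those whose difference
-- is odd; φ a parametrises both by (k , l), with a shift in the odd class.
φ : ℤ → (ℤ × ℤ) ⊎ (ℤ × ℤ) → ℤ × ℤ
φ a (inj₁ (k , l)) = k ℤ.+ l , k ℤ.- l
φ a (inj₂ (k , l)) = (+ 1 ℤ.+ a) ℤ.+ (k ℤ.+ l) , a ℤ.+ (k ℤ.- l)

half-difference : (ℤ × ℤ) ⊎ (ℤ × ℤ) → ℤ ⊎ ℤ
half-difference (inj₁ (_ , l)) = inj₁ l
half-difference (inj₂ (_ , l)) = inj₂ l

φ-difference : ∀ a s → proj₁ (φ a s) ℤ.- proj₂ (φ a s) ≡ double (half-difference s)
φ-difference a (inj₁ (k , l)) = lemma k l
  where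
  lemma : ∀ k l → (k ℤ.+ l) ℤ.- (k ℤ.- l) ≡ l ℤ.+ l
  lemma = ℤSolver.solve-∀
φ-difference a (inj₂ (k , l)) = lemma a k l
  where
  lemma : ∀ a k l → ((+ 1 ℤ.+ a) ℤ.+ (k ℤ.+ l)) ℤ.- (a ℤ.+ (k ℤ.- l)) ≡ + 1 ℤ.+ (l ℤ.+ l)
  lemma = ℤSolver.solve-∀

-- The difference m - n determines the class and l; then n determines k.
φ-injective : ∀ a {s t} → φ a s ≡ φ a t → s ≡ t
φ-injective a {s} {t} eq = finish s t
  (double-injective (trans (sym (φ-difference a s)) (trans (cong (λ (m , n) → m ℤ.- n) eq) (φ-difference a t)))) (cong proj₂ eq)
  where
  finish : ∀ s t → half-difference s ≡ half-difference t → proj₂ (φ a s) ≡ proj₂ (φ a t) → s ≡ t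
  finish (inj₁ (k , l)) (inj₁ (k′ , .l)) refl eq = cong (λ k → inj₁ (k , l)) (ℤGroup.∙-cancelʳ (ℤ.- l) k k′ eq)
  finish (inj₂ (k , l)) (inj₂ (k′ , .l)) refl eq =
    cong (λ k → inj₂ (k , l)) (ℤGroup.∙-cancelʳ (ℤ.- l) k k′ (ℤGroup.∙-cancelˡ a (k ℤ.- l) (k′ ℤ.- l) eq))

φ-surjective : ∀ a j → ∃ λ s → φ a s ≡ j
φ-surjective a (m , n) with double-surjective (m ℤ.- n)
... | inj₁ l , eq = inj₁ (n ℤ.+ l , l) , cong₂ _,_
      (trans (ℤ.+-assoc n l l) (trans (cong (ℤ._+_ n) eq) (restore m n))) (cancel n l)
  where
  restore : ∀ m n → n ℤ.+ (m ℤ.- n) ≡ m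
  restore = ℤSolver.solve-∀
  cancel : ∀ n l → (n ℤ.+ l) ℤ.- l ≡ n
  cancel = ℤSolver.solve-∀
... | inj₂ l , eq = inj₂ (n ℤ.+ l ℤ.- a , l) , cong₂ _,_
      (trans (regroup a n l) (trans (cong (ℤ._+_ n) eq) (restore m n))) (cancel a n l)
  where
  regroup : ∀ a n l → (+ 1 ℤ.+ a) ℤ.+ ((n ℤ.+ l ℤ.- a) ℤ.+ l) ≡ n ℤ.+ (+ 1 ℤ.+ (l ℤ.+ l))
  regroup = ℤSolver.solve-∀
  restore : ∀ m n → n ℤ.+ (m ℤ.- n) ≡ m
  restore = ℤSolver.solve-∀
  cancel : ∀ a n l → a ℤ.+ ((n ℤ.+ l ℤ.- a) ℤ.- l) ≡ n
  cancel = ℤSolver.solve-∀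

-- `AbsSum-reindex` asks for `_≐_`, so the family is first carried to f ∘ ψ⁻¹, and `_≋_` comes in on
-- the way to `HasSum`.
HasSum-reindex : ∀ {I J : Set} {f : I → ℂ} {g : J → ℂ} {s} (ψ : I → J) → (∀ {i j} → ψ i ≡ ψ j → i ≡ j) → (∀ j → ∃ λ i → ψ i ≡ j) →
                 (∀ i → f i ≋ g (ψ i)) → AbsSum f s → HasSum g s
HasSum-reindex {f = f} {g} ψ injective surjective f≋g S = AbsSum⇒HasSum
  (AbsSum-reindex {g = λ j → f (proj₁ (surjective j))} ψ injective surjective
    (λ i → stagewise λ n → cong (λ i → at (f i) n) (sym (injective (proj₂ (surjective (ψ i)))))) S)
  (λ j → ≋-trans (f≋g (proj₁ (surjective j))) (≡⇒≋ (cong g (proj₂ (surjective j)))))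

module _ (a : ℤ) (Q : ℤ × ℤ → ℂ) (f g : ℤ → ℂ) {u v : ℤ × ℤ → ℂ} {s t : ℂ} (S : AbsSum u s) (T : AbsSum v t)
         (even : ∀ kl → u kl ≋ (λ (m , n) → Q (m , n) *ℂ f m *ℂ g n) (φ a (inj₁ kl)))
         (odd : ∀ kl → v kl ≋ (λ (m , n) → Q (m , n) *ℂ f m *ℂ g n) (φ a (inj₂ kl))) where

  parity-sum : HasSum (λ (m , n) → Q (m , n) *ℂ f m *ℂ g n) (s +ℂ t)
  parity-sum = HasSum-reindex (φ a) (φ-injective a) (φ-surjective a)
    (λ { (inj₁ kl) → even kl ; (inj₂ kl) → odd kl }) (AbsSum-⊎ S T)

  -- On the classes n - m is -2l and 1 + 2(-1 - l), so the sign only negates the odd class.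
  signed-parity-sum : HasSum (λ (m , n) → [-1]^ (n ℤ.- m) *ℂ Q (m , n) *ℂ f m *ℂ g n) (s +ℂ (-ℂ 1ℂ) *ℂ t)
  signed-parity-sum = HasSum-reindex (φ a) (φ-injective a) (φ-surjective a)
    (λ { (inj₁ (k , l)) → ≋-trans (≐⇒≋ (stagewise λ n → sym (⊗-identityˡ (at (u (k , l)) n))))
           (≋-trans (*-≋ (≋-sym (≋-trans (≡⇒≋ (cong [-1]^_ (even-sign k l))) (sign-even (ℤ.- l)))) (even (k , l))) (reassoc _ _ _ _))
       ; (inj₂ (k , l)) → ≋-trans (*-≋ (≋-sym (≋-trans (≡⇒≋ (cong [-1]^_ (odd-sign a k l))) (sign-odd (ℤ.-1ℤ ℤ.- l)))) (odd (k , l))) (reassoc _ _ _ _) })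
    (AbsSum-⊎ S (AbsSum-*ˡ (-ℂ 1ℂ) T))
    where
    even-sign : ∀ k l → (k ℤ.- l) ℤ.- (k ℤ.+ l) ≡ ℤ.- l ℤ.+ ℤ.- l
    even-sign = ℤSolver.solve-∀
    odd-sign : ∀ a k l → (a ℤ.+ (k ℤ.- l)) ℤ.- ((+ 1 ℤ.+ a) ℤ.+ (k ℤ.+ l)) ≡ + 1 ℤ.+ ((ℤ.-1ℤ ℤ.- l) ℤ.+ (ℤ.-1ℤ ℤ.- l))
    odd-sign = ℤSolver.solve-∀
    reassoc : ∀ p q r s → p *ℂ (q *ℂ r *ℂ s) ≋ p *ℂ q *ℂ r *ℂ s
    reassoc p q r s = ≐⇒≋ (stagewise λ n → lemma (at p n) (at q n) (at r n) (at s n))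
      where
      lemma : ∀ p q r s → p ⊗ (q ⊗ r ⊗ s) ≡ p ⊗ q ⊗ r ⊗ s
      lemma = solve-∀ gauss

-- The four double series as products of theta series

module Factorisation
    (b d : ℤ) (-2d<b : ℤ.- (+ 2 ℤ.* d) ℤ.< b) (b<2d : b ℤ.< + 2 ℤ.* d)
    (τ : ℂ) (0<τ : 0ℝ <ℝ im τ) (x y : ℂ) (x≠0 : x ≠0) (y≠0 : y ≠0)
    (√x √y : ℂ) (√x²≈x : √x ^ℕ 2 ≈ℂ x) (√y²≈y : √y ^ℕ 2 ≈ℂ y) where

  -- With u = K + L and v = K - L the form is P K² + R L²; taking half the sum and half the
  -- difference absorbs the quarter. The bounds on b say that both coefficients are positive.
  P R : ℚ
  P = (+ 2 ℤ.* d ℤ.+ b) / 1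
  R = (+ 2 ℤ.* d ℤ.- b) / 1

  /1-pos : ∀ {i} → + 0 ℤ.< i → 0ℚ < i / 1
  /1-pos {+ suc n} _ = cast-pos n
  /1-pos {+ zero} (ℤ.+<+ ())

  P-contracting : Contracting (τ q^ P)
  P-contracting = q^-contracting τ 0<τ (/1-pos
    (subst (ℤ._< + 2 ℤ.* d ℤ.+ b) (ℤ.+-inverseʳ (+ 2 ℤ.* d)) (ℤ.+-monoʳ-< (+ 2 ℤ.* d) -2d<b)))

  R-contracting : Contracting (τ q^ R)
  R-contracting = q^-contracting τ 0<τ (/1-pos
    (subst (ℤ._< + 2 ℤ.* d ℤ.- b) (ℤ.+-inverseʳ b) (ℤ.+-monoˡ-< (ℤ.- b) b<2d)))

  q-form : ∀ u v K L → u ≡ K + L → v ≡ K - L → qPow τ (form b d u v) ≋ (τ q^ (P * (K * K))) *ℂ (τ q^ (R * (L * L)))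
  q-form u v K L refl refl = ≋-trans (≡⇒≋ (cong (τ q^_) (trans (lemma (d / 1) (b / 1) K L)
      (sym (cong₂ (λ p r → p * (K * K) + r * (L * L))
        (trans (/1-+ (+ 2 ℤ.* d) b) (cong (_+ b / 1) (/1-* (+ 2) d)))
        (trans (/1-− (+ 2 ℤ.* d) b) (cong (_- b / 1) (/1-* (+ 2) d))))))))
    (q^-+ τ (P * (K * K)) (R * (L * L)))
    where
    lemma : ∀ D B K L → D * ((K + L) * (K + L)) + B * ((K + L) * (K - L)) + D * ((K - L) * (K - L)) ≡
                        ((+ 2 / 1) * D + B) * (K * K) + ((+ 2 / 1) * D - B) * (L * L)
    lemma = solve-∀ ring

  x′ y′ : ℂ
  x′ = inv x x≠0
  y′ = inv y y≠0

  X Y : ℤ → ℂ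
  X = powℤ (x *ℂ y) (x′ *ℂ y′)
  Y = powℤ (x *ℂ y′) (x′ *ℂ y)

  α β : ℂ
  α = τ q^ (P * (+ 1 / 4))
  β = τ q^ (R * (+ 1 / 4))

  e₁ e₂ o₁ o₂ : ℤ → ℂ
  e₁ = θ square (τ q^ P) (x *ℂ y) (x′ *ℂ y′)
  e₂ = θ square (τ q^ R) (x *ℂ y′) (x′ *ℂ y)
  o₁ k = α *ℂ θ pronic (τ q^ P) (x *ℂ y) (x′ *ℂ y′) k
  o₂ l = β *ℂ θ pronic (τ q^ R) (x *ℂ y′) (x′ *ℂ y) l

  Sum-e₁ : ∃ (AbsSum e₁)
  Sum-e₁ = θ-square P-contracting (x *ℂ y) (x′ *ℂ y′)
  Sum-e₂ : ∃ (AbsSum e₂)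
  Sum-e₂ = θ-square R-contracting (x *ℂ y′) (x′ *ℂ y)
  Sum-o₁ : ∃ (AbsSum o₁)
  Sum-o₁ = let s , S = θ-pronic P-contracting (x *ℂ y) (x′ *ℂ y′) in α *ℂ s , AbsSum-*ˡ α S
  Sum-o₂ : ∃ (AbsSum o₂)
  Sum-o₂ = let s , S = θ-pronic R-contracting (x *ℂ y′) (x′ *ℂ y) in β *ℂ s , AbsSum-*ˡ β S

  e₁≋ : ∀ k → (τ q^ (P * ((k / 1) * (k / 1)))) *ℂ X k ≋ e₁ k
  e₁≋ k = *-≋ (q^-square τ P k) ≋-refl

  e₂≋ : ∀ l → (τ q^ (R * ((l / 1) * (l / 1)))) *ℂ Y l ≋ e₂ l
  e₂≋ l = *-≋ (q^-square τ R l) ≋-refl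

  o₁≋ : ∀ k → (τ q^ (P * ((k / 1 + ½) * (k / 1 + ½)))) *ℂ X k ≋ o₁ k
  o₁≋ k = ≋-trans (*-≋ (q^-pronic τ P k) ≋-refl)
    (≐⇒≋ (stagewise λ n → ⊗-assoc (at α n) (at ((τ q^ P) ^ℕ pronic k) n) (at (X k) n)))

  o₂≋ : ∀ l → (τ q^ (R * ((l / 1 + ½) * (l / 1 + ½)))) *ℂ Y l ≋ o₂ l
  o₂≋ l = ≋-trans (*-≋ (q^-pronic τ R l) ≋-refl)
    (≐⇒≋ (stagewise λ n → ⊗-assoc (at β n) (at ((τ q^ R) ^ℕ pronic l) n) (at (Y l) n)))

  -- The shape shared by all four classes: the q-power splits as AB and the monomial as c·CD, and AC
  -- and BD are terms of one-dimensional series.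
  term : ∀ {Q F G A B C D E c} → Q ≋ A *ℂ B → F *ℂ G ≋ c *ℂ (C *ℂ D) → A *ℂ C ≋ E → ∀ {H} → B *ℂ D ≋ H →
         c *ℂ (E *ℂ H) ≋ Q *ℂ F *ℂ G
  term {Q} {F} {G} {A} {B} {C} {D} {E} {c} Q≋ FG≋ E≋ {H} H≋ = begin
    c *ℂ (E *ℂ H)                   ≈⟨ *-≋ˡ c (*-≋ E≋ H≋) ⟨
    c *ℂ ((A *ℂ C) *ℂ (B *ℂ D))     ≈⟨ ≐⇒≋ (stagewise λ n → regroup (at c n) (at A n) (at B n) (at C n) (at D n)) ⟩
    (A *ℂ B) *ℂ (c *ℂ (C *ℂ D))     ≈⟨ *-≋ Q≋ FG≋ ⟨
    Q *ℂ (F *ℂ G)                   ≈⟨ ≐⇒≋ (stagewise λ n → ⊗-assoc (at Q n) (at F n) (at G n)) ⟨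
    Q *ℂ F *ℂ G                     ∎
    where
    open ≋-Reasoning
    regroup : ∀ c a b x y → c ⊗ ((a ⊗ x) ⊗ (b ⊗ y)) ≡ (a ⊗ b) ⊗ (c ⊗ (x ⊗ y))
    regroup = solve-∀ gauss

  one : ∀ z → z ≋ 1ℂ *ℂ z
  one z = ≐⇒≋ (stagewise λ n → sym (⊗-identityˡ (at z n)))

  shifted : ∀ a₁ a₂ k l → pow x x≠0 (a₁ ℤ.+ (k ℤ.+ l)) *ℂ pow y y≠0 (a₂ ℤ.+ (k ℤ.- l)) ≋ (pow x x≠0 a₁ *ℂ pow y y≠0 a₂) *ℂ (X k *ℂ Y l)
  shifted a₁ a₂ k l = begin
    pow x x≠0 (a₁ ℤ.+ (k ℤ.+ l)) *ℂ pow y y≠0 (a₂ ℤ.+ (k ℤ.- l))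
      ≈⟨ *-≋ (pow-+ x x≠0 a₁ (k ℤ.+ l)) (pow-+ y y≠0 a₂ (k ℤ.- l)) ⟩
    (pow x x≠0 a₁ *ℂ pow x x≠0 (k ℤ.+ l)) *ℂ (pow y y≠0 a₂ *ℂ pow y y≠0 (k ℤ.- l))
      ≈⟨ ≐⇒≋ (stagewise λ n → regroup (at (pow x x≠0 a₁) n) (at (pow x x≠0 (k ℤ.+ l)) n) (at (pow y y≠0 a₂) n) (at (pow y y≠0 (k ℤ.- l)) n)) ⟩
    (pow x x≠0 a₁ *ℂ pow y y≠0 a₂) *ℂ (pow x x≠0 (k ℤ.+ l) *ℂ pow y y≠0 (k ℤ.- l))
      ≈⟨ *-≋ˡ (pow x x≠0 a₁ *ℂ pow y y≠0 a₂) (pow-diagonal x y x≠0 y≠0 k l) ⟩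
    (pow x x≠0 a₁ *ℂ pow y y≠0 a₂) *ℂ (X k *ℂ Y l) ∎
    where
    open ≋-Reasoning
    pow-+ : ∀ z z≠0 j k → pow z z≠0 (j ℤ.+ k) ≋ pow z z≠0 j *ℂ pow z z≠0 k
    pow-+ z z≠0 j k = ≋-trans (≡⇒≋ (pow-powℤ z z≠0 (j ℤ.+ k))) (≋-trans (powℤ-+ z (inv z z≠0) (inv-inverse z z≠0) j k)
      (*-≋ (≡⇒≋ (sym (pow-powℤ z z≠0 j))) (≡⇒≋ (sym (pow-powℤ z z≠0 k)))))
    regroup : ∀ a b c d → (a ⊗ b) ⊗ (c ⊗ d) ≡ (a ⊗ c) ⊗ (b ⊗ d)
    regroup = solve-∀ gauss

  s : ℂ
  s = √x *ℂ √y

  with-roots : ∀ m n {c z} → pow x x≠0 m *ℂ pow y y≠0 n ≋ c *ℂ z → pow½ x x≠0 √x m *ℂ pow½ y y≠0 √y n ≋ (s *ℂ c) *ℂ z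
  with-roots m n {c} {z} e = ≋-trans (≐⇒≋ (stagewise λ k → regroup (at (pow x x≠0 m) k) (at √x k) (at (pow y y≠0 n) k) (at √y k)))
    (≋-trans (*-≋ˡ s e) (≐⇒≋ (stagewise λ k → sym (⊗-assoc (at s k) (at c k) (at z k)))))
    where
    regroup : ∀ a b c d → (a ⊗ b) ⊗ (c ⊗ d) ≡ (b ⊗ d) ⊗ (a ⊗ c)
    regroup = solve-∀ gauss

  -- These are x and 1/y, left as the products of powers that `shifted` produces.
  cₓ cᵧ : ℂ
  cₓ = pow x x≠0 (+ 1) *ℂ pow y y≠0 (+ 0)
  cᵧ = pow x x≠0 (+ 0) *ℂ pow y y≠0 -[1+ 0 ]

  Q₀ Q½ : ℤ × ℤ → ℂ
  Q₀ (m , n) = qPow τ (form b d (m +0) (n +0))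
  Q½ (m , n) = qPow τ (form b d (m +½) (n +½))

  even₀ : ∀ ((k , l) : ℤ × ℤ) → 1ℂ *ℂ (e₁ k *ℂ e₂ l) ≋ Q₀ (k ℤ.+ l , k ℤ.- l) *ℂ pow x x≠0 (k ℤ.+ l) *ℂ pow y y≠0 (k ℤ.- l)
  even₀ (k , l) = term (q-form _ _ (k / 1) (l / 1) (/1-+ k l) (/1-− k l))
    (≋-trans (pow-diagonal x y x≠0 y≠0 k l) (one (X k *ℂ Y l))) (e₁≋ k) (e₂≋ l)

  -- With shift 0 the odd class has m = (k+½) + (l+½) and n = (k+½) - (l+½), so both series are
  -- pronic.
  odd₀ : ∀ ((k , l) : ℤ × ℤ) → cₓ *ℂ (o₁ k *ℂ o₂ l) ≋
         Q₀ (+ 1 ℤ.+ (k ℤ.+ l) , + 0 ℤ.+ (k ℤ.- l)) *ℂ pow x x≠0 (+ 1 ℤ.+ (k ℤ.+ l)) *ℂ pow y y≠0 (+ 0 ℤ.+ (k ℤ.- l))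
  odd₀ (k , l) = term (q-form _ _ (k / 1 + ½) (l / 1 + ½)
      (trans (/1-+ (+ 1) (k ℤ.+ l)) (trans (cong (λ c → 1ℚ + c) (/1-+ k l)) (sum (k / 1) (l / 1))))
      (trans (/1-+ (+ 0) (k ℤ.- l)) (trans (cong (λ c → 0ℚ + c) (/1-− k l)) (difference (k / 1) (l / 1)))))
    (shifted (+ 1) (+ 0) k l) (o₁≋ k) (o₂≋ l)
    where
    sum : ∀ k l → 1ℚ + (k + l) ≡ (k + ½) + (l + ½)
    sum = solve-∀ ring
    difference : ∀ k l → 0ℚ + (k - l) ≡ (k + ½) - (l + ½)
    difference = solve-∀ ring

  even½ : ∀ ((k , l) : ℤ × ℤ) → (s *ℂ 1ℂ) *ℂ (o₁ k *ℂ e₂ l) ≋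
          Q½ (k ℤ.+ l , k ℤ.- l) *ℂ pow½ x x≠0 √x (k ℤ.+ l) *ℂ pow½ y y≠0 √y (k ℤ.- l)
  even½ (k , l) = term (q-form _ _ (k / 1 + ½) (l / 1)
      (trans (cong (_+ ½) (/1-+ k l)) (sum (k / 1) (l / 1)))
      (trans (cong (_+ ½) (/1-− k l)) (difference (k / 1) (l / 1))))
    (with-roots (k ℤ.+ l) (k ℤ.- l) (≋-trans (pow-diagonal x y x≠0 y≠0 k l) (one (X k *ℂ Y l)))) (o₁≋ k) (e₂≋ l)
    where
    sum : ∀ k l → k + l + ½ ≡ (k + ½) + l
    sum = solve-∀ ring
    difference : ∀ k l → k - l + ½ ≡ (k + ½) - l
    difference = solve-∀ ring

  -- With shift -1 the odd class has m+½ = k + (l+½) and n+½ = k - (l+½), so k stays an integer and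
  -- `e₁` reappears.
  odd½ : ∀ ((k , l) : ℤ × ℤ) → (s *ℂ cᵧ) *ℂ (e₁ k *ℂ o₂ l) ≋
         Q½ (+ 0 ℤ.+ (k ℤ.+ l) , ℤ.-1ℤ ℤ.+ (k ℤ.- l)) *ℂ pow½ x x≠0 √x (+ 0 ℤ.+ (k ℤ.+ l)) *ℂ pow½ y y≠0 √y (ℤ.-1ℤ ℤ.+ (k ℤ.- l))
  odd½ (k , l) = term (q-form _ _ (k / 1) (l / 1 + ½)
      (trans (cong (_+ ½) (trans (/1-+ (+ 0) (k ℤ.+ l)) (cong (λ c → 0ℚ + c) (/1-+ k l)))) (sum (k / 1) (l / 1)))
      (trans (cong (_+ ½) (trans (/1-+ ℤ.-1ℤ (k ℤ.- l)) (cong (λ c → - 1ℚ + c) (/1-− k l)))) (difference (k / 1) (l / 1))))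
    (with-roots (+ 0 ℤ.+ (k ℤ.+ l)) (ℤ.-1ℤ ℤ.+ (k ℤ.- l)) (shifted (+ 0) ℤ.-1ℤ k l)) (e₁≋ k) (o₂≋ l)
    where
    sum : ∀ k l → 0ℚ + (k + l) + ½ ≡ k + (l + ½)
    sum = solve-∀ ring
    difference : ∀ k l → - 1ℚ + (k - l) + ½ ≡ k - (l + ½)
    difference = solve-∀ ring

  product-sum : ∀ c {f g : ℤ → ℂ} ((p , _) : ∃ (AbsSum f)) ((r , _) : ∃ (AbsSum g)) →
                AbsSum (λ ((k , l) : ℤ × ℤ) → c *ℂ (f k *ℂ g l)) (c *ℂ (p *ℂ r))
  product-sum c (_ , S) (_ , T) = AbsSum-*ˡ c (AbsSum-× ℤ._≟_ ℤ._≟_ S T)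

  E O H₀ H₁ : ℂ
  E  = 1ℂ *ℂ (proj₁ Sum-e₁ *ℂ proj₁ Sum-e₂)
  O  = cₓ *ℂ (proj₁ Sum-o₁ *ℂ proj₁ Sum-o₂)
  H₀ = (s *ℂ 1ℂ) *ℂ (proj₁ Sum-o₁ *ℂ proj₁ Sum-e₂)
  H₁ = (s *ℂ cᵧ) *ℂ (proj₁ Sum-e₁ *ℂ proj₁ Sum-o₂)

  Sum-E = product-sum 1ℂ Sum-e₁ Sum-e₂
  Sum-O = product-sum cₓ Sum-o₁ Sum-o₂
  Sum-H₀ = product-sum (s *ℂ 1ℂ) Sum-o₁ Sum-e₂
  Sum-H₁ = product-sum (s *ℂ cᵧ) Sum-e₁ Sum-o₂

  roots : s *ℂ (s *ℂ cᵧ) ≋ cₓ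
  roots = begin
    s *ℂ (s *ℂ cᵧ)
      ≈⟨ ≐⇒≋ (stagewise λ n → regroup (at √x n) (at √y n) (at y′ n)) ⟩
    (√x ^ℕ 2) *ℂ ((√y ^ℕ 2) *ℂ y′)
      ≈⟨ *-≋ (≈⇒≋ √x²≈x) (≋-trans (*-≋ (≈⇒≋ √y²≈y) ≋-refl) (inv-inverse y y≠0)) ⟩
    x *ℂ 1ℂ
      ≈⟨ ≐⇒≋ (stagewise λ n → unit (at x n)) ⟩
    cₓ ∎
    where
    open ≋-Reasoning
    regroup : ∀ a b c → (a ⊗ b) ⊗ ((a ⊗ b) ⊗ (1ᵢ ⊗ (c ⊗ 1ᵢ))) ≡ (a ⊗ (a ⊗ 1ᵢ)) ⊗ ((b ⊗ (b ⊗ 1ᵢ)) ⊗ c)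
    regroup = solve-∀ gauss
    unit : ∀ a → a ⊗ 1ᵢ ≡ (a ⊗ 1ᵢ) ⊗ 1ᵢ
    unit = solve-∀ gauss

  -- Both products contain each of the four one-dimensional sums exactly once, so only the
  -- prefactors are left to compare, by `roots`.
  E*O≋H₀*H₁ : E *ℂ O ≋ H₀ *ℂ H₁
  E*O≋H₀*H₁ = begin
    E *ℂ O
      ≈⟨ ≐⇒≋ (stagewise λ n → l₁ (at cₓ n) (at ε₁ n) (at ε₂ n) (at ω₁ n) (at ω₂ n)) ⟩
    cₓ *ℂ ((ε₁ *ℂ ε₂) *ℂ (ω₁ *ℂ ω₂))
      ≈⟨ *-≋ roots ≋-refl ⟨
    (s *ℂ (s *ℂ cᵧ)) *ℂ ((ε₁ *ℂ ε₂) *ℂ (ω₁ *ℂ ω₂))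
      ≈⟨ ≐⇒≋ (stagewise λ n → l₂ (at s n) (at cᵧ n) (at ε₁ n) (at ε₂ n) (at ω₁ n) (at ω₂ n)) ⟩
    H₀ *ℂ H₁ ∎
    where
    open ≋-Reasoning
    ε₁ ε₂ ω₁ ω₂ : ℂ
    ε₁ = proj₁ Sum-e₁
    ε₂ = proj₁ Sum-e₂
    ω₁ = proj₁ Sum-o₁
    ω₂ = proj₁ Sum-o₂
    l₁ : ∀ c e f o p → (1ᵢ ⊗ (e ⊗ f)) ⊗ (c ⊗ (o ⊗ p)) ≡ c ⊗ ((e ⊗ f) ⊗ (o ⊗ p))
    l₁ = solve-∀ gauss
    l₂ : ∀ s c e f o p → (s ⊗ (s ⊗ c)) ⊗ ((e ⊗ f) ⊗ (o ⊗ p)) ≡ ((s ⊗ 1ᵢ) ⊗ (o ⊗ f)) ⊗ ((s ⊗ c) ⊗ (e ⊗ p))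
    l₂ = solve-∀ gauss

  -- Both sides are E² + O² + H₀² + H₁² up to 2 (E O − H₀ H₁), which vanishes.
  squares : (H₀ +ℂ (-ℂ 1ℂ) *ℂ H₁) ^ℕ 2 +ℂ (E +ℂ O) ^ℕ 2 ≋ (E +ℂ (-ℂ 1ℂ) *ℂ O) ^ℕ 2 +ℂ (H₀ +ℂ H₁) ^ℕ 2
  squares = begin
    (H₀ +ℂ (-ℂ 1ℂ) *ℂ H₁) ^ℕ 2 +ℂ (E +ℂ O) ^ℕ 2
      ≈⟨ ≐⇒≋ (stagewise λ n → l₁ (at E n) (at O n) (at H₀ n) (at H₁ n)) ⟩
    T +ℂ (U +ℂ (-ℂ V))
      ≈⟨ +-≋ (≋-refl {T}) (+-≋ U≋V (neg-≋ (≋-sym U≋V))) ⟩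
    T +ℂ (V +ℂ (-ℂ U))
      ≈⟨ ≐⇒≋ (stagewise λ n → l₂ (at E n) (at O n) (at H₀ n) (at H₁ n)) ⟩
    (E +ℂ (-ℂ 1ℂ) *ℂ O) ^ℕ 2 +ℂ (H₀ +ℂ H₁) ^ℕ 2 ∎
    where
    open ≋-Reasoning
    T U V : ℂ
    T = E *ℂ E +ℂ O *ℂ O +ℂ (H₀ *ℂ H₀ +ℂ H₁ *ℂ H₁)
    U = E *ℂ O +ℂ E *ℂ O
    V = H₀ *ℂ H₁ +ℂ H₀ *ℂ H₁
    U≋V : U ≋ V
    U≋V = +-≋ E*O≋H₀*H₁ E*O≋H₀*H₁
    l₁ : ∀ e o g h → (g ⊕ (⊖ 1ᵢ) ⊗ h) ⊗ ((g ⊕ (⊖ 1ᵢ) ⊗ h) ⊗ 1ᵢ) ⊕ (e ⊕ o) ⊗ ((e ⊕ o) ⊗ 1ᵢ) ≡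
         e ⊗ e ⊕ o ⊗ o ⊕ (g ⊗ g ⊕ h ⊗ h) ⊕ ((e ⊗ o ⊕ e ⊗ o) ⊕ ⊖ (g ⊗ h ⊕ g ⊗ h))
    l₁ = solve-∀ gauss
    l₂ : ∀ e o g h → e ⊗ e ⊕ o ⊗ o ⊕ (g ⊗ g ⊕ h ⊗ h) ⊕ ((g ⊗ h ⊕ g ⊗ h) ⊕ ⊖ (e ⊗ o ⊕ e ⊗ o)) ≡
         (e ⊕ (⊖ 1ᵢ) ⊗ o) ⊗ ((e ⊕ (⊖ 1ᵢ) ⊗ o) ⊗ 1ᵢ) ⊕ (g ⊕ h) ⊗ ((g ⊕ h) ⊗ 1ᵢ)
    l₂ = solve-∀ gauss

corollary5p1 :
  (b d : ℤ) → ℤ.- (+ 2 ℤ.* d) ℤ.< b → b ℤ.< + 2 ℤ.* d →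
  (τ : ℂ) → 0ℝ <ℝ im τ →
  (x y : ℂ) (x≠0 : x ≠0) (y≠0 : y ≠0) →
  (√x √y : ℂ) → √x ^ℕ 2 ≈ℂ x → √y ^ℕ 2 ≈ℂ y →
  Σ[ A ∈ Summable (λ ((m , n) : ℤ × ℤ) →
    [-1]^ (n ℤ.- m) *ℂ qPow τ (form b d (m +½) (n +½)) *ℂ pow½ x x≠0 √x m *ℂ pow½ y y≠0 √y n) ]
  Σ[ B ∈ Summable (λ ((m , n) : ℤ × ℤ) →
    qPow τ (form b d (m +0) (n +0)) *ℂ pow x x≠0 m *ℂ pow y y≠0 n) ]
  Σ[ C ∈ Summable (λ ((m , n) : ℤ × ℤ) →
    [-1]^ (n ℤ.- m) *ℂ qPow τ (form b d (m +0) (n +0)) *ℂ pow x x≠0 m *ℂ pow y y≠0 n) ]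
  Σ[ D ∈ Summable (λ ((m , n) : ℤ × ℤ) →
    qPow τ (form b d (m +½) (n +½)) *ℂ pow½ x x≠0 √x m *ℂ pow½ y y≠0 √y n) ]
    ∑ A ^ℕ 2 +ℂ ∑ B ^ℕ 2 ≈ℂ ∑ C ^ℕ 2 +ℂ ∑ D ^ℕ 2
corollary5p1 b d -2d<b b<2d τ 0<τ x y x≠0 y≠0 √x √y √x²≈x √y²≈y =
    -- Half-integer pairs use the shift -1, integer pairs the shift 0; the signed and the unsigned
    -- series are built from the same two pieces.
    record { value = H₀ +ℂ (-ℂ 1ℂ) *ℂ H₁ ; sums = signed-parity-sum ℤ.-1ℤ Q½ (pow½ x x≠0 √x) (pow½ y y≠0 √y) Sum-H₀ Sum-H₁ even½ odd½ }
  , record { value = E +ℂ O ; sums = parity-sum (+ 0) Q₀ (pow x x≠0) (pow y y≠0) Sum-E Sum-O even₀ odd₀ }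
  , record { value = E +ℂ (-ℂ 1ℂ) *ℂ O ; sums = signed-parity-sum (+ 0) Q₀ (pow x x≠0) (pow y y≠0) Sum-E Sum-O even₀ odd₀ }
  , record { value = H₀ +ℂ H₁ ; sums = parity-sum ℤ.-1ℤ Q½ (pow½ x x≠0 √x) (pow½ y y≠0 √y) Sum-H₀ Sum-H₁ even½ odd½ }
  , ≋⇒≈ squares
  where open Factorisation b d -2d<b b<2d τ 0<τ x y x≠0 y≠0 √x √y √x²≈x √y²≈y
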